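{- Let $m = q^2 + q + 1$ for some prime power $q$, and let $n = 11m$. Then there exists an odd, monotone, unbiased voting rule $\Phi : \{ -1,1\}^n \to \{ -1,1\}$ that is not transitive-symmetric and has winning coalitions of size $\lfloor 1.508\sqrt{n} \rfloor + 5$.
   Context: A voting rule on $n$ voters is a function $\Phi : \{ -1,1\}^n \to \{ -1,1\}$. It is odd if $\Phi(-x) = -\Phi(x)$ for all $x$, and monotone if $\Phi(x) \ge \Phi(x')$ whenever $x \ge x'$ coordinate-wise. A permutation $\sigma$ of $[n]$ acts on $\{ -1,1\}^n$ by permuting coordinates, and on voting rules by $(\sigma\Phi)(x) = \Phi(\sigma^{ -1}(x))$; $\mathrm{aut}(\Phi)$ is the group of permutations $\sigma$ with $\sigma\Phi = \Phi$. $\Phi$ is transitive-symmetric if for every $u, v \in [n]$ there is $\sigma \in \mathrm{aut}(\Phi)$ with $\sigma(u) = v$. For $x \in \{ -1,1\}^n$ let $x^{\oplus i}$ be $x$ with its $i$-th coordinate negated. For a probability measure $\mu$ on $\{ -1,1\}^n$, $\mathbb{I}_i^\mu(\Phi) = \mathbb{P}_{x \sim \mu}[\Phi(x) \ne \Phi(x^{\oplus i})]$. $\Phi$ is unbiased if $\mathbb{I}_1^\mu(\Phi) = \cdots = \mathbb{I}_n^\mu(\Phi)$ for every i.i.d. measure $\mu = p^{\otimes n}$, $p$ a probability measure on $\{ -1,1\}$. A winning coalition for $\Phi$ is a set $S \subseteq [n]$ such that for each $y \in \{ -1,1\}$, whenever $x_i = y$ for all $i \in S$, then $\Phi(x) =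 y$. -}

module Defs where

open import Data.Nat as ℕ using (ℕ; zero; suc; z≤n; s≤s)
import Data.Nat.Properties as ℕ
open import Data.Nat.Primality using (Prime)
import Data.Nat.Solver as ℕSolver
open import Data.Integer as ℤ using (+_; +[1+_]; _◃_)
import Data.Integer.Properties as ℤ
open import Data.Rational as ℚ using (ℚ; mkℚ; 0ℚ; 1ℚ; ½; ∣_∣; 1/_; _/_)
import Data.Rational.Properties as ℚ
import Data.Rational.Solver as ℚSolver
open import Data.Rational.Unnormalised as ℚᵘ using (mkℚᵘ)
import Data.Rational.Unnormalised.Properties as ℚᵘ
open import Data.Sign as Sign using (Sign; opposite)
import Data.Sign.Properties as Sign
open import Data.Fin using (Fin)
open import Data.Fin.Permutation using (Permutation′; flip; _⟨$⟩ʳ_; _⟨$⟩ˡ_)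
open import Data.Fin.Subset as Subset using (Subset; _∈_)
open import Data.List as List using (List; []; _∷_; filter; cartesianProductWith)
open import Data.Vec as Vec using (Vec; []; _∷_; lookup; tabulate; updateAt)
open import Data.Vec.Relation.Binary.Pointwise.Inductive using (Pointwise)
open import Data.Product using (∃; ∃₂; _×_; _,_; proj₁; proj₂)
open import Data.Sum using (inj₁; inj₂)
open import Relation.Nullary using (¬?; yes; no)
open import Relation.Unary using (Pred; Decidable)
open import Relation.Binary.PropositionalEquality
  using (_≡_; refl; sym; trans; cong; subst; subst₂)
open import Level using (0ℓ)

-- A real number is a Cauchy sequence of rationals; equality of reals is _≈_, not _≡_.

IsCauchy : (ℕ → ℚ) → Set
IsCauchy x = ∀ ε → 0ℚ ℚ.< ε →
  ∃ λ N → ∀ m n → N ℕ.≤ m → N ℕ.≤ n → ∣ x m ℚ.- x n ∣ ℚ.< ε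

record ℝ : Set where
  constructor mkℝ
  field
    seq    : ℕ → ℚ
    cauchy : IsCauchy seq

open ℝ public

infix 4 _≈_ _≤ᵣ_ _<ᵣ_

_≈_ : ℝ → ℝ → Set
x ≈ y = ∀ ε → 0ℚ ℚ.< ε → ∃ λ N → ∀ n → N ℕ.≤ n → ∣ seq x n ℚ.- seq y n ∣ ℚ.< ε

_≤ᵣ_ : ℝ → ℝ → Set
x ≤ᵣ y = ∀ ε → 0ℚ ℚ.< ε → ∃ λ N → ∀ n → N ℕ.≤ n → seq x n ℚ.< seq y n ℚ.+ ε

_<ᵣ_ : ℝ → ℝ → Set
x <ᵣ y = ∃ λ δ → 0ℚ ℚ.< δ × ∃ λ N → ∀ n → N ℕ.≤ n → seq x n ℚ.+ δ ℚ.≤ seq y n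

private
  half>0 : ∀ {ε} → 0ℚ ℚ.< ε → 0ℚ ℚ.< ½ ℚ.* ε
  half>0 {ε} 0<ε = subst (ℚ._< ½ ℚ.* ε) (ℚ.*-zeroʳ ½) (ℚ.*-monoʳ-<-pos ½ 0<ε)

  half+half : ∀ ε → ½ ℚ.* ε ℚ.+ ½ ℚ.* ε ≡ ε
  half+half ε = trans (sym (ℚ.*-distribʳ-+ ε ½ ½)) (ℚ.*-identityˡ ε)

  const-cauchy : ∀ q → IsCauchy (λ _ → q)
  const-cauchy q ε 0<ε = 0 , λ _ _ _ _ → subst (ℚ._< ε) (sym (cong ∣_∣ (ℚ.+-inverseʳ q))) 0<ε

  +-cauchy : ∀ {x y} → IsCauchy x → IsCauchy y → IsCauchy (λ n → x n ℚ.+ y n)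
  +-cauchy {x} {y} cx cy ε 0<ε
    with M , hx ← cx (½ ℚ.* ε) (half>0 0<ε)
       | N , hy ← cy (½ ℚ.* ε) (half>0 0<ε)
    = M ℕ.⊔ N , λ m n p q → begin-strict
      ∣ x m ℚ.+ y m ℚ.- (x n ℚ.+ y n) ∣           ≡⟨ cong ∣_∣ (lemma (x m) (y m) (x n) (y n)) ⟩
      ∣ (x m ℚ.- x n) ℚ.+ (y m ℚ.- y n) ∣         ≤⟨ ℚ.∣p+q∣≤∣p∣+∣q∣ (x m ℚ.- x n) (y m ℚ.- y n) ⟩
      ∣ x m ℚ.- x n ∣ ℚ.+ ∣ y m ℚ.- y n ∣         <⟨ ℚ.+-mono-<
                                                    (hx m n (ℕ.m⊔n≤o⇒m≤o M N p) (ℕ.m⊔n≤o⇒m≤o M N q))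
                                                    (hy m n (ℕ.m⊔n≤o⇒n≤o M N p) (ℕ.m⊔n≤o⇒n≤o M N q)) ⟩
      ½ ℚ.* ε ℚ.+ ½ ℚ.* ε                         ≡⟨ half+half ε ⟩
      ε                                           ∎
    where
    open ℚ.≤-Reasoning
    open ℚSolver.+-*-Solver
    lemma : ∀ a b c d → a ℚ.+ b ℚ.- (c ℚ.+ d) ≡ (a ℚ.- c) ℚ.+ (b ℚ.- d)
    lemma = solve 4 (λ a b c d → a :+ b :- (c :+ d) := (a :- c) :+ (b :- d)) refl

  eventually-bounded : ∀ {x} → IsCauchy x →
    ∃ λ B → ℚ.Positive B × ∃ λ N → ∀ n → N ℕ.≤ n → ∣ x n ∣ ℚ.≤ B
  eventually-bounded {x} cx with N , h ← cx 1ℚ (ℚ.positive⁻¹ 1ℚ)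
    = ∣ x N ∣ ℚ.+ 1ℚ
    , ℚ.nonNeg+pos⇒pos ∣ x N ∣ {{ℚ.∣-∣-nonNeg (x N)}} 1ℚ
    , N , λ n N≤n → begin
      ∣ x n ∣                        ≡⟨ cong ∣_∣ (lemma (x n) (x N)) ⟩
      ∣ x N ℚ.+ (x n ℚ.- x N) ∣      ≤⟨ ℚ.∣p+q∣≤∣p∣+∣q∣ (x N) (x n ℚ.- x N) ⟩
      ∣ x N ∣ ℚ.+ ∣ x n ℚ.- x N ∣    ≤⟨ ℚ.+-monoʳ-≤ ∣ x N ∣ (ℚ.<⇒≤ (h n N N≤n ℕ.≤-refl)) ⟩
      ∣ x N ∣ ℚ.+ 1ℚ                 ∎
    where
    open ℚ.≤-Reasoning
    open ℚSolver.+-*-Solver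
    lemma : ∀ a b → a ≡ b ℚ.+ (a ℚ.- b)
    lemma = solve 2 (λ a b → a := b :+ (a :- b)) refl

  recip : ∀ B → .{{ℚ.Positive B}} → ℚ
  recip B = (1/ B) {{ℚ.pos⇒nonZero B}}

  product-bound : ∀ B ε .{{_ : ℚ.Positive B}} c d →
    ∣ c ∣ ℚ.≤ B → ∣ d ∣ ℚ.≤ recip B ℚ.* ε → ∣ c ℚ.* d ∣ ℚ.≤ ε
  product-bound B ε c d c≤B d≤ = begin
    ∣ c ℚ.* d ∣                  ≡⟨ ℚ.∣p*q∣≡∣p∣*∣q∣ c d ⟩
    ∣ c ∣ ℚ.* ∣ d ∣              ≤⟨ ℚ.*-monoʳ-≤-nonNeg ∣ d ∣ {{ℚ.∣-∣-nonNeg d}} c≤B ⟩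
    B ℚ.* ∣ d ∣                  ≤⟨ ℚ.*-monoˡ-≤-nonNeg B {{ℚ.pos⇒nonNeg B}} d≤ ⟩
    B ℚ.* (recip B ℚ.* ε)         ≡⟨ ℚ.*-assoc B (recip B) ε ⟨
    B ℚ.* recip B ℚ.* ε           ≡⟨ cong (ℚ._* ε) (ℚ.*-inverseʳ B {{ℚ.pos⇒nonZero B}}) ⟩
    1ℚ ℚ.* ε                     ≡⟨ ℚ.*-identityˡ ε ⟩
    ε                            ∎
    where open ℚ.≤-Reasoning

  1/B*ε>0 : ∀ B {ε} .{{_ : ℚ.Positive B}} → 0ℚ ℚ.< ε → 0ℚ ℚ.< recip B ℚ.* ε
  1/B*ε>0 B {ε} 0<ε = subst (ℚ._< recip B ℚ.* ε) (ℚ.*-zeroʳ (recip B))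
    (ℚ.*-monoʳ-<-pos (recip B) {{ℚ.1/pos⇒pos B}} 0<ε)

  *-cauchy : ∀ {x y} → IsCauchy x → IsCauchy y → IsCauchy (λ n → x n ℚ.* y n)
  *-cauchy {x} {y} cx cy ε 0<ε = go (eventually-bounded cx) (eventually-bounded cy)
    where
    open ℚ.≤-Reasoning
    open ℚSolver.+-*-Solver
    lemma : ∀ a b c d → a ℚ.* b ℚ.- c ℚ.* d ≡ a ℚ.* (b ℚ.- d) ℚ.+ d ℚ.* (a ℚ.- c)
    lemma = solve 4 (λ a b c d → a :* b :- c :* d := a :* (b :- d) :+ d :* (a :- c)) refl

    η : ℚ
    η = ½ ℚ.* (½ ℚ.* ε)

    0<½ε : 0ℚ ℚ.< ½ ℚ.* ε
    0<½ε = half>0 0<ε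

    ½ε<ε : ½ ℚ.* ε ℚ.< ε
    ½ε<ε = subst₂ ℚ._<_ (ℚ.+-identityʳ (½ ℚ.* ε)) (half+half ε) (ℚ.+-monoʳ-< (½ ℚ.* ε) 0<½ε)

    go : (∃ λ B → ℚ.Positive B × ∃ λ N → ∀ n → N ℕ.≤ n → ∣ x n ∣ ℚ.≤ B) →
         (∃ λ B → ℚ.Positive B × ∃ λ N → ∀ n → N ℕ.≤ n → ∣ y n ∣ ℚ.≤ B) →
         ∃ λ N → ∀ m n → N ℕ.≤ m → N ℕ.≤ n → ∣ x m ℚ.* y m ℚ.- x n ℚ.* y n ∣ ℚ.< ε
    go (A , A>0 , K , x≤A) (B , B>0 , L , y≤B) = N , bound
      where
      instance
        _ = A>0
        _ = B>0
      hy = cy (recip A ℚ.* η) (1/B*ε>0 A (half>0 0<½ε))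
      hx = cx (recip B ℚ.* η) (1/B*ε>0 B (half>0 0<½ε))
      N = (K ℕ.⊔ L) ℕ.⊔ (proj₁ hx ℕ.⊔ proj₁ hy)

      ≥K : ∀ {n} → N ℕ.≤ n → K ℕ.≤ n
      ≥K p = ℕ.m⊔n≤o⇒m≤o K L (ℕ.m⊔n≤o⇒m≤o (K ℕ.⊔ L) _ p)
      ≥L : ∀ {n} → N ℕ.≤ n → L ℕ.≤ n
      ≥L p = ℕ.m⊔n≤o⇒n≤o K L (ℕ.m⊔n≤o⇒m≤o (K ℕ.⊔ L) _ p)
      ≥hx : ∀ {n} → N ℕ.≤ n → proj₁ hx ℕ.≤ n
      ≥hx p = ℕ.m⊔n≤o⇒m≤o _ (proj₁ hy) (ℕ.m⊔n≤o⇒n≤o (K ℕ.⊔ L) _ p)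
      ≥hy : ∀ {n} → N ℕ.≤ n → proj₁ hy ℕ.≤ n
      ≥hy p = ℕ.m⊔n≤o⇒n≤o (proj₁ hx) _ (ℕ.m⊔n≤o⇒n≤o (K ℕ.⊔ L) _ p)

      bound : ∀ m n → N ℕ.≤ m → N ℕ.≤ n → ∣ x m ℚ.* y m ℚ.- x n ℚ.* y n ∣ ℚ.< ε
      bound m n p q = begin-strict
        ∣ x m ℚ.* y m ℚ.- x n ℚ.* y n ∣
          ≡⟨ cong ∣_∣ (lemma (x m) (y m) (x n) (y n)) ⟩
        ∣ x m ℚ.* (y m ℚ.- y n) ℚ.+ y n ℚ.* (x m ℚ.- x n) ∣
          ≤⟨ ℚ.∣p+q∣≤∣p∣+∣q∣ (x m ℚ.* (y m ℚ.- y n)) (y n ℚ.* (x m ℚ.- x n)) ⟩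
        ∣ x m ℚ.* (y m ℚ.- y n) ∣ ℚ.+ ∣ y n ℚ.* (x m ℚ.- x n) ∣
          ≤⟨ ℚ.+-mono-≤
               (product-bound A η (x m) (y m ℚ.- y n) (x≤A m (≥K p))
                 (ℚ.<⇒≤ (proj₂ hy m n (≥hy p) (≥hy q))))
               (product-bound B η (y n) (x m ℚ.- x n) (y≤B n (≥L q))
                 (ℚ.<⇒≤ (proj₂ hx m n (≥hx p) (≥hx q)))) ⟩
        η ℚ.+ η
          ≡⟨ half+half (½ ℚ.* ε) ⟩
        ½ ℚ.* ε
          <⟨ ½ε<ε ⟩
        ε ∎

fromℚ : ℚ → ℝ
fromℚ q = mkℝ (λ _ → q) (const-cauchy q)

fromℕ : ℕ → ℝ
fromℕ n = fromℚ (+ n / 1)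

0ᵣ 1ᵣ : ℝ
0ᵣ = fromℚ 0ℚ
1ᵣ = fromℚ 1ℚ

infixl 6 _+ᵣ_
infixl 7 _*ᵣ_

_+ᵣ_ : ℝ → ℝ → ℝ
x +ᵣ y = mkℝ (λ n → seq x n ℚ.+ seq y n) (+-cauchy {seq x} {seq y} (cauchy x) (cauchy y))

_*ᵣ_ : ℝ → ℝ → ℝ
x *ᵣ y = mkℝ (λ n → seq x n ℚ.* seq y n) (*-cauchy {seq x} {seq y} (cauchy x) (cauchy y))

-- The floor of a real is not computable, so it is given by its graph.
⌊_⌋≡_ : ℝ → ℕ → Set
⌊ x ⌋≡ k = fromℕ k ≤ᵣ x × x <ᵣ fromℕ (suc k)

isqrt : ℕ → ℕ
isqrt zero = 0
isqrt (suc n) with suc (isqrt n) ℕ.* suc (isqrt n) ℕ.≤? suc n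
... | yes _ = suc (isqrt n)
... | no  _ = isqrt n

isqrt-lower : ∀ n → isqrt n ℕ.* isqrt n ℕ.≤ n
isqrt-lower zero = z≤n
isqrt-lower (suc n) with suc (isqrt n) ℕ.* suc (isqrt n) ℕ.≤? suc n
... | yes p = p
... | no  _ = ℕ.m≤n⇒m≤1+n (isqrt-lower n)

isqrt-upper : ∀ n → n ℕ.< suc (isqrt n) ℕ.* suc (isqrt n)
isqrt-upper zero = s≤s z≤n
isqrt-upper (suc n) with suc (isqrt n) ℕ.* suc (isqrt n) ℕ.≤? suc n
... | yes _ = ℕ.≤-<-trans (isqrt-upper n)
                (ℕ.*-mono-< (ℕ.n<1+n (suc (isqrt n))) (ℕ.n<1+n (suc (isqrt n))))
... | no ¬p = ℕ.≰⇒> ¬p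

-- ⌊ (j+1)√n ⌋ / (j+1), which is within 1/(j+1) of √n.
√-approx : ℕ → ℕ → ℚ
√-approx n j = + isqrt (n ℕ.* (suc j ℕ.* suc j)) / suc j

private
  /-mono : ∀ a b j k → a ℕ.* suc k ℕ.≤ b ℕ.* suc j → + a / suc j ℚ.≤ + b / suc k
  /-mono a b j k h = ℚ.toℚᵘ-cancel-≤
    (ℚᵘ.≤-respˡ-≃ (ℚᵘ.≃-sym (ℚ.toℚᵘ-fromℚᵘ (mkℚᵘ (+ a) j)))
    (ℚᵘ.≤-respʳ-≃ (ℚᵘ.≃-sym (ℚ.toℚᵘ-fromℚᵘ (mkℚᵘ (+ b) k)))
    (ℚᵘ.*≤* (subst₂ ℤ._≤_ (ℤ.pos-* a (suc k)) (ℤ.pos-* b (suc j)) (ℤ.+≤+ h)))))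

  /-+ : ∀ a b j → + (a ℕ.+ b) / suc j ≡ + a / suc j ℚ.+ + b / suc j
  /-+ a b j = ℚ.toℚᵘ-injective (begin
    ℚ.toℚᵘ (+ (a ℕ.+ b) / suc j)                     ≈⟨ ℚ.toℚᵘ-fromℚᵘ (mkℚᵘ (+ (a ℕ.+ b)) j) ⟩
    mkℚᵘ (+ (a ℕ.+ b)) j                             ≈⟨ ℚᵘ.*≡* eq ⟩
    mkℚᵘ (+ a) j ℚᵘ.+ mkℚᵘ (+ b) j                   ≈⟨ ℚᵘ.+-cong (ℚ.toℚᵘ-fromℚᵘ (mkℚᵘ (+ a) j))
                                                                  (ℚ.toℚᵘ-fromℚᵘ (mkℚᵘ (+ b) j)) ⟨
    ℚ.toℚᵘ (+ a / suc j) ℚᵘ.+ ℚ.toℚᵘ (+ b / suc j)   ≈⟨ ℚ.toℚᵘ-homo-+ (+ a / suc j) (+ b / suc j) ⟨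
    ℚ.toℚᵘ (+ a / suc j ℚ.+ + b / suc j)             ∎)
    where
    open ℚᵘ.≃-Reasoning
    J = +[1+ j ]
    eq : + (a ℕ.+ b) ℤ.* (J ℤ.* J) ≡ (+ a ℤ.* J ℤ.+ + b ℤ.* J) ℤ.* J
    eq = trans (sym (ℤ.*-assoc (+ (a ℕ.+ b)) J J))
               (cong (ℤ._* J) (ℤ.*-distribʳ-+ J (+ a) (+ b)))

  /-* : ∀ a b j k → (+ a / suc j) ℚ.* (+ b / suc k) ≡ + (a ℕ.* b) / (suc j ℕ.* suc k)
  /-* a b j k = ℚ.toℚᵘ-injective (begin
    ℚ.toℚᵘ ((+ a / suc j) ℚ.* (+ b / suc k))         ≈⟨ ℚ.toℚᵘ-homo-* (+ a / suc j) (+ b / suc k) ⟩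
    ℚ.toℚᵘ (+ a / suc j) ℚᵘ.* ℚ.toℚᵘ (+ b / suc k)   ≈⟨ ℚᵘ.*-cong (ℚ.toℚᵘ-fromℚᵘ (mkℚᵘ (+ a) j))
                                                                  (ℚ.toℚᵘ-fromℚᵘ (mkℚᵘ (+ b) k)) ⟩
    mkℚᵘ (+ a ℤ.* + b) (k ℕ.+ j ℕ.* suc k)           ≡⟨ cong (λ i → mkℚᵘ i (k ℕ.+ j ℕ.* suc k)) (ℤ.pos-* a b) ⟨
    mkℚᵘ (+ (a ℕ.* b)) (k ℕ.+ j ℕ.* suc k)           ≈⟨ ℚ.toℚᵘ-fromℚᵘ _ ⟨
    ℚ.toℚᵘ (+ (a ℕ.* b) / (suc j ℕ.* suc k))         ∎)
    where open ℚᵘ.≃-Reasoning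

  archimedean : ∀ c ε → 0ℚ ℚ.< ε → ∃ λ N → ∀ j → N ℕ.≤ j → + c / suc j ℚ.< ε
  archimedean c ε 0<ε with ε | ℚ.positive 0<ε
  ... | e@(mkℚ +[1+ a ] d _) | _ = c ℕ.* suc d , λ j N≤j → ℚ.toℚᵘ-cancel-<
    (ℚᵘ.<-respˡ-≃ (ℚᵘ.≃-sym (ℚ.toℚᵘ-fromℚᵘ (mkℚᵘ (+ c) j)))
    (ℚᵘ.*<* (subst (ℤ._< + (suc a ℕ.* suc j)) (ℤ.pos-* c (suc d)) (ℤ.+<+ (begin-strict
      c ℕ.* suc d          ≤⟨ N≤j ⟩
      j                    <⟨ ℕ.n<1+n j ⟩
      suc j                ≤⟨ ℕ.m≤m+n (suc j) (a ℕ.* suc j) ⟩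
      suc a ℕ.* suc j      ∎)))))
    where open ℕ.≤-Reasoning

  ∣p-q∣<ε : ∀ p q ε → p ℚ.< q ℚ.+ ε → q ℚ.< p ℚ.+ ε → ∣ p ℚ.- q ∣ ℚ.< ε
  ∣p-q∣<ε p q ε p<q+ε q<p+ε with ℚ.∣p∣≡p∨∣p∣≡-p (p ℚ.- q)
  ... | inj₁ e = subst₂ ℚ._<_ (sym e) (l q ε) (ℚ.+-monoˡ-< (ℚ.- q) p<q+ε)
    where
    open ℚSolver.+-*-Solver
    l : ∀ q ε → q ℚ.+ ε ℚ.- q ≡ ε
    l = solve 2 (λ q ε → q :+ ε :- q := ε) refl
  ... | inj₂ e = subst₂ ℚ._<_ (trans (l′ p q) (sym e)) (l p ε) (ℚ.+-monoˡ-< (ℚ.- p) q<p+ε)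
    where
    open ℚSolver.+-*-Solver
    l : ∀ q ε → q ℚ.+ ε ℚ.- q ≡ ε
    l = solve 2 (λ q ε → q :+ ε :- q := ε) refl
    l′ : ∀ p q → q ℚ.- p ≡ ℚ.- (p ℚ.- q)
    l′ = solve 2 (λ p q → q :- p := :- (p :- q)) refl

  square-cancel-< : ∀ a b → a ℕ.* a ℕ.< b ℕ.* b → a ℕ.< b
  square-cancel-< a b h with a ℕ.<? b
  ... | yes a<b = a<b
  ... | no  a≮b with () ← ℕ.<-irrefl refl
                   (ℕ.<-≤-trans h (ℕ.*-mono-≤ (ℕ.≮⇒≥ a≮b) (ℕ.≮⇒≥ a≮b)))

  √-approx-close : ∀ n j k → √-approx n j ℚ.≤ √-approx n k ℚ.+ + 1 / suc k
  √-approx-close n j k = subst (√-approx n j ℚ.≤_) (/-+ b 1 k)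
    (/-mono a (b ℕ.+ 1) j k (ℕ.<⇒≤ (square-cancel-< (a ℕ.* K) ((b ℕ.+ 1) ℕ.* J) (begin-strict
      (a ℕ.* K) ℕ.* (a ℕ.* K)                     ≡⟨ sq a K ⟩
      (a ℕ.* a) ℕ.* (K ℕ.* K)                     ≤⟨ ℕ.*-monoˡ-≤ (K ℕ.* K) (isqrt-lower (n ℕ.* (J ℕ.* J))) ⟩
      n ℕ.* (J ℕ.* J) ℕ.* (K ℕ.* K)               ≡⟨ swap n (J ℕ.* J) (K ℕ.* K) ⟩
      n ℕ.* (K ℕ.* K) ℕ.* (J ℕ.* J)               <⟨ ℕ.*-monoˡ-< (J ℕ.* J) (isqrt-upper (n ℕ.* (K ℕ.* K))) ⟩
      (suc b ℕ.* suc b) ℕ.* (J ℕ.* J)             ≡⟨ cong (λ c → (c ℕ.* c) ℕ.* (J ℕ.* J)) (ℕ.+-comm 1 b) ⟩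
      ((b ℕ.+ 1) ℕ.* (b ℕ.+ 1)) ℕ.* (J ℕ.* J)     ≡⟨ sq (b ℕ.+ 1) J ⟨
      ((b ℕ.+ 1) ℕ.* J) ℕ.* ((b ℕ.+ 1) ℕ.* J)     ∎))))
    where
    open ℕ.≤-Reasoning
    open ℕSolver.+-*-Solver
    J = suc j
    K = suc k
    a = isqrt (n ℕ.* (J ℕ.* J))
    b = isqrt (n ℕ.* (K ℕ.* K))
    sq : ∀ a k → (a ℕ.* k) ℕ.* (a ℕ.* k) ≡ (a ℕ.* a) ℕ.* (k ℕ.* k)
    sq = solve 2 (λ a k → (a :* k) :* (a :* k) := (a :* a) :* (k :* k)) refl
    swap : ∀ n x y → n ℕ.* x ℕ.* y ≡ n ℕ.* y ℕ.* x
    swap = solve 3 (λ n x y → n :* x :* y := n :* y :* x) refl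

  √-cauchy : ∀ n → IsCauchy (√-approx n)
  √-cauchy n ε 0<ε with N , h ← archimedean 1 ε 0<ε
    = N , λ j k N≤j N≤k → ∣p-q∣<ε (√-approx n j) (√-approx n k) ε
      (ℚ.≤-<-trans (√-approx-close n j k) (ℚ.+-monoʳ-< (√-approx n k) (h k N≤k)))
      (ℚ.≤-<-trans (√-approx-close n k j) (ℚ.+-monoʳ-< (√-approx n j) (h j N≤j)))

√_ : ℕ → ℝ
√ n = mkℝ (√-approx n) (√-cauchy n)

√-nonneg : ∀ n → 0ᵣ ≤ᵣ √ n
√-nonneg n ε 0<ε = 0 , λ j _ → ℚ.<-≤-trans 0<ε
  (subst (ℚ._≤ √-approx n j ℚ.+ ε) (ℚ.+-identityˡ ε)
    (ℚ.+-monoˡ-≤ ε (/-mono 0 (isqrt (n ℕ.* (suc j ℕ.* suc j))) 0 j z≤n)))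

√-square : ∀ n → √ n *ᵣ √ n ≈ fromℕ n
√-square n ε 0<ε with N , h ← archimedean (2 ℕ.* n ℕ.+ 1) ε 0<ε
  = N , λ j N≤j → subst (λ s → ∣ s ℚ.- + n / 1 ∣ ℚ.< ε) (sym (/-* (a j) (a j) j j))
    (∣p-q∣<ε _ (+ n / 1) ε
      (ℚ.≤-<-trans (lower j)
        (subst (ℚ._< + n / 1 ℚ.+ ε) (ℚ.+-identityʳ (+ n / 1)) (ℚ.+-monoʳ-< (+ n / 1) 0<ε)))
      (ℚ.≤-<-trans (upper j) (ℚ.+-monoʳ-< (sq j) (h j N≤j))))
  where
  open ℕ.≤-Reasoning
  open ℕSolver.+-*-Solver
  a : ℕ → ℕ
  a j = isqrt (n ℕ.* (suc j ℕ.* suc j))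
  sq : ℕ → ℚ
  sq j = + (a j ℕ.* a j) / (suc j ℕ.* suc j)

  lower : ∀ j → sq j ℚ.≤ + n / 1
  lower j = /-mono (a j ℕ.* a j) n (j ℕ.+ j ℕ.* suc j) 0
    (subst (ℕ._≤ n ℕ.* (suc j ℕ.* suc j)) (sym (ℕ.*-identityʳ _)) (isqrt-lower _))

  n≤n² : ∀ n → n ℕ.≤ n ℕ.* n
  n≤n² zero    = z≤n
  n≤n² (suc n) = ℕ.m≤m+n (suc n) (n ℕ.* suc n)

  a≤nJ : ∀ j → a j ℕ.≤ n ℕ.* suc j
  a≤nJ j with a j ℕ.≤? n ℕ.* suc j
  ... | yes p = p
  ... | no ¬p with () ← ℕ.<-irrefl refl (begin-strict
      (n ℕ.* suc j) ℕ.* (n ℕ.* suc j)    <⟨ ℕ.*-mono-< (ℕ.≰⇒> ¬p) (ℕ.≰⇒> ¬p) ⟩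
      a j ℕ.* a j                        ≤⟨ isqrt-lower _ ⟩
      n ℕ.* (suc j ℕ.* suc j)            ≤⟨ ℕ.*-monoˡ-≤ (suc j ℕ.* suc j) (n≤n² n) ⟩
      n ℕ.* n ℕ.* (suc j ℕ.* suc j)      ≡⟨ solve 2 (λ n J → n :* n :* (J :* J) := (n :* J) :* (n :* J)) refl n (suc j) ⟩
      (n ℕ.* suc j) ℕ.* (n ℕ.* suc j)    ∎)

  upper : ∀ j → + n / 1 ℚ.≤ sq j ℚ.+ + (2 ℕ.* n ℕ.+ 1) / suc j
  upper j = ℚ.≤-trans
    (/-mono n (a j ℕ.* a j ℕ.+ (2 ℕ.* n ℕ.+ 1) ℕ.* J) 0 J²-1 (begin
      n ℕ.* (J ℕ.* J)                                         ≤⟨ ℕ.<⇒≤ (isqrt-upper _) ⟩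
      suc (a j) ℕ.* suc (a j)                                 ≡⟨ solve 1 (λ a → (con 1 :+ a) :* (con 1 :+ a)
                                                                  := a :* a :+ (con 2 :* a :+ con 1)) refl (a j) ⟩
      a j ℕ.* a j ℕ.+ (2 ℕ.* a j ℕ.+ 1)                       ≤⟨ ℕ.+-monoʳ-≤ (a j ℕ.* a j)
                                                                  (ℕ.+-mono-≤ (ℕ.*-monoʳ-≤ 2 (a≤nJ j)) (s≤s (z≤n {j}))) ⟩
      a j ℕ.* a j ℕ.+ (2 ℕ.* (n ℕ.* J) ℕ.+ J)                 ≡⟨ solve 3 (λ a n J → a :* a :+ (con 2 :* (n :* J) :+ J)
                                                                  := (a :* a :+ (con 2 :* n :+ con 1) :* J) :* con 1)
                                                                  refl (a j) n J ⟩
      (a j ℕ.* a j ℕ.+ (2 ℕ.* n ℕ.+ 1) ℕ.* J) ℕ.* 1           ∎))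
    (subst (ℚ._≤ sq j ℚ.+ + (2 ℕ.* n ℕ.+ 1) / J) (sym (/-+ (a j ℕ.* a j) ((2 ℕ.* n ℕ.+ 1) ℕ.* J) J²-1))
      (ℚ.+-monoʳ-≤ (sq j) (/-mono ((2 ℕ.* n ℕ.+ 1) ℕ.* J) (2 ℕ.* n ℕ.+ 1) J²-1 j
        (ℕ.≤-reflexive (ℕ.*-assoc (2 ℕ.* n ℕ.+ 1) J J)))))
    where
    J = suc j
    J²-1 = j ℕ.+ j ℕ.* suc j

IsPrimePower : ℕ → Set
IsPrimePower q = ∃₂ λ p k → Prime p × 1 ℕ.≤ k × q ≡ p ℕ.^ k

-- Sign.- and Sign.+ stand for -1 and 1.
Profile : ℕ → Set
Profile n = Vec Sign n

VotingRule : ℕ → Set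
VotingRule n = Profile n → Sign

infix 4 _≤ₛ_

_≤ₛ_ : Sign → Sign → Set
s ≤ₛ t = (s ◃ 1) ℤ.≤ (t ◃ 1)

module _ {n : ℕ} where

  Odd : VotingRule n → Set
  Odd Φ = ∀ x → Φ (Vec.map opposite x) ≡ opposite (Φ x)

  Monotone : VotingRule n → Set
  Monotone Φ = ∀ x x′ → Pointwise _≤ₛ_ x′ x → Φ x′ ≤ₛ Φ x

  -- (σ x)ᵢ = x_{σ⁻¹ i}: the entry at i moves to position σ i.
  permute : Permutation′ n → Profile n → Profile n
  permute σ x = tabulate λ i → lookup x (σ ⟨$⟩ˡ i)

  permuteRule : Permutation′ n → VotingRule n → VotingRule n
  permuteRule σ Φ x = Φ (permute (flip σ) x)

  IsAutomorphism : VotingRule n → Permutation′ n → Set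
  IsAutomorphism Φ σ = ∀ x → permuteRule σ Φ x ≡ Φ x

  TransitiveSymmetric : VotingRule n → Set
  TransitiveSymmetric Φ = ∀ u v → ∃ λ σ → IsAutomorphism Φ σ × σ ⟨$⟩ʳ u ≡ v

  IsWinningCoalition : VotingRule n → Subset n → Set
  IsWinningCoalition Φ S = ∀ y x → (∀ i → i ∈ S → lookup x i ≡ y) → Φ x ≡ y

  HasWinningCoalitionOfSize : VotingRule n → ℕ → Set
  HasWinningCoalitionOfSize Φ s = ∃ λ S → Subset.∣ S ∣ ≡ s × IsWinningCoalition Φ S

-- A measure on a finite set is given by its point masses.

∑ : {A : Set} → List A → (A → ℝ) → ℝ
∑ as f = List.foldr _+ᵣ_ 0ᵣ (List.map f as)

-- The list as enumerates the sample space without repetition.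
IsProbabilityMeasure : {A : Set} (as : List A) → (A → ℝ) → Set
IsProbabilityMeasure as μ = (∀ a → 0ᵣ ≤ᵣ μ a) × ∑ as μ ≈ 1ᵣ

signs : List Sign
signs = Sign.- ∷ Sign.+ ∷ []

cube : ∀ n → List (Profile n)
cube zero    = [] ∷ []
cube (suc n) = cartesianProductWith _∷_ signs (cube n)

ℙ : ∀ {n} (μ : Profile n → ℝ) {P : Pred (Profile n) 0ℓ} → Decidable P → ℝ
ℙ {n} μ P? = ∑ (filter P? (cube n)) μ

_⊗_ : (Sign → ℝ) → ∀ n → Profile n → ℝ
(p ⊗ n) x = Vec.foldr′ _*ᵣ_ 1ᵣ (Vec.map p x)

flipAt : ∀ {n} → Profile n → Fin n → Profile n
flipAt x i = updateAt x i opposite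

influence : ∀ {n} → (Profile n → ℝ) → Fin n → VotingRule n → ℝ
influence μ i Φ = ℙ μ (λ x → ¬? (Φ x Sign.≟ Φ (flipAt x i)))

Unbiased : ∀ {n} → VotingRule n → Set
Unbiased {n} Φ = ∀ (p : Sign → ℝ) → IsProbabilityMeasure signs p →
  ∀ i j → influence (p ⊗ n) i Φ ≈ influence (p ⊗ n) j Φ

{-# OPTIONS --safe #-}
module Submission where

-- The projective plane suggested by m = q² + q + 1 can be avoided: any odd n = 2h + 1 ≥ 77 works.
-- Let S ⊂ ℤ/n consist of an interval of length a and the first a multiples of a, where a² > h.
-- Every residue is a difference of S, so any two translates of S meet; and |S| ≤ 2a ≤ √(2n) + 2,
-- where √2 < 1.508.  Let a coalition win if it contains a translate of S and has more than
-- s = |S| + 2 members, or if it is in a family of s-sets containing translates of S; let the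
-- majority decide if neither side wins in this way.  The rule is odd and monotone, and it is
-- cyclically symmetric, hence unbiased, if the family is closed under translation.  Exchanging two
-- members f₁, f₂ of the family for two sets g₁, g₂ with the same total at every voter keeps all
-- influences unchanged.  As the family consists of the winning coalitions of size s, automorphisms
-- preserve it, and the exchange can be chosen such that some but not all voters v have the form
-- x ∖ y = {v} for members x, y.

open import Defs
import Data.Bool as Bool
open import Data.Bool using (Bool; true; false; if_then_else_)
open import Data.Empty using (⊥)
open import Data.Fin as Fin using (Fin; zero; suc; toℕ; inject₁)
import Data.Fin.Induction as Fin
open import Data.Fin.Permutation using (Permutation′; flip; _⟨$⟩ʳ_; _⟨$⟩ˡ_; inverseˡ)
import Data.Fin.Properties as Fin
open import Data.Fin.Relation.Unary.Top using (view; ‵fromℕ; ‵inject₁)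
open import Data.Fin.Subset as Subset using (Subset; inside; outside)
open import Data.Integer as ℤ using (+_; +[1+_]; _◃_)
import Data.Integer.Properties as ℤ
open import Data.List as List using (List; []; _∷_; length; filter; map; upTo; _++_)
import Data.List.Properties as List
open import Data.List.Membership.Propositional using (_∈_; _∉_)
open import Data.List.Membership.Propositional.Properties using (∈-map⁺; ∈-++⁺ˡ; ∈-++⁺ʳ; ∈-upTo⁺)
open import Data.List.Relation.Unary.Any as Any using (here; there)
import Data.List.Relation.Unary.Any.Properties as Any
open import Data.Nat as ℕ
  using (ℕ; zero; suc; NonZero; _+_; _*_; _∸_; _^_; _%_; _≤_; _<_; _≤?_; _<?_; z≤n; s≤s)
import Data.List.Membership.DecPropositional ℕ._≟_ as ListDec
open import Data.Nat.Divisibility using (_∣_; divides; _∣?_; ∣-refl; n∣m*n; >⇒∤; ∣m+n∣m⇒∣n)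
open import Data.Nat.DivMod
  using (_mod_; m%n<n; m%n≤n; m%n%n≡m%n; n%n≡0; m<n⇒m%n≡m; m≡m%n+[m/n]*n; m/n*n≤m; m<n*o⇒m/o<n; [m+n]%n≡m%n; %-distribˡ-+)
open import Data.Nat.Primality using (prime⇒nonTrivial)
import Data.Nat.Properties as ℕ
open import Data.Nat.Tactic.RingSolver using (solve-∀)
open import Data.Product using (∃; _×_; _,_; proj₁; proj₂)
open import Data.Rational as ℚ using (ℚ; mkℚ; 0ℚ; 1ℚ; _/_)
import Data.Rational.Properties as ℚ
import Data.Rational.Solver as ℚSolver
open import Data.Rational.Unnormalised as ℚᵘ using (mkℚᵘ)
import Data.Rational.Unnormalised.Properties as ℚᵘ
open import Data.Sign as Sign using (Sign; opposite)
import Data.Sign.Properties as Sign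
open import Data.Sum using (_⊎_; inj₁; inj₂)
open import Data.Vec as Vec using (Vec; []; _∷_; lookup; tabulate; _∷ʳ_; here; there)
import Data.Vec.Properties as Vec
open import Data.Vec.Relation.Binary.Pointwise.Inductive as Pointwise using (Pointwise; []; _∷_)
open import Function using (_∘_; mk⇔; _⇔_; Equivalence)
open import Level using (0ℓ)
open import Relation.Binary.PropositionalEquality
open import Relation.Nullary using (¬_; Dec; yes; no; does; ¬?; contradiction)
open import Relation.Nullary.Decidable
  using (True; toWitness; does-⇔; dec-true; dec-false; decidable-stable; _×-dec_; _⊎-dec_)
open import Relation.Unary using (Pred; Decidable)
import Algebra.Properties.CommutativeMonoid.Sum ℕ.+-0-commutativeMonoid as ∑ℕ
open import Algebra.Properties.Group ℚ.+-0-group using (∙-cancelʳ)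

open ℚSolver.+-*-Solver using (solve; _:=_; _:+_; _:*_; con)

-- The obstacle is that cyclic symmetry, the cheap source of equal influences, is itself transitive;
-- the symmetry must be broken in a way that no i.i.d. measure can see. For a monotone rule the
-- influence of a voter is linear in the outcomes, and the coefficient of a profile depends only on
-- its size and on the vote of that voter. Hence the exchanged sets must have equal size and equal
-- totals at every voter. The threshold `s` creates the freedom for this: every larger coalition
-- containing a translate wins, so monotonicity holds for any family of `s`-sets containing
-- translates. The two extra members are marks placed beyond the end of `S`. With a single mark, any
-- two members from the same translate would differ by one voter; with two marks such pairs can be
-- made exceptional. Members from different translates never interfere, because a nontrivial
-- translate of `S` misses at least four elements of `S`, more than two marks and one voter can
-- hide.

neg : ∀ {n} → Profile n → Profile n
neg = Vec.map opposite

rotate : ∀ {n} → Profile (suc n) → Profile (suc n)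
rotate (b ∷ x) = x ∷ʳ b

# : ∀ {n} → Profile n → ℕ
# []             = 0
# (Sign.- ∷ x) = # x
# (Sign.+ ∷ x) = suc (# x)

#-neg : ∀ {n} (x : Profile n) → # x + # (neg x) ≡ n
#-neg []             = refl
#-neg (Sign.- ∷ x) = trans (ℕ.+-suc (# x) (# (neg x))) (cong suc (#-neg x))
#-neg (Sign.+ ∷ x) = cong suc (#-neg x)

#-∷ : ∀ {n} b {x y : Profile n} → # x ≡ # y → # (b ∷ x) ≡ # (b ∷ y)
#-∷ Sign.- e = e
#-∷ Sign.+ e = cong suc e

#-∷ʳ : ∀ {n} b (x : Profile n) → # (x ∷ʳ b) ≡ # (b ∷ x)
#-∷ʳ b []      = refl
#-∷ʳ b (c ∷ x) = trans (#-∷ c (#-∷ʳ b x)) (swap b c x)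
  where
  swap : ∀ b c {n} (x : Profile n) → # (c ∷ b ∷ x) ≡ # (b ∷ c ∷ x)
  swap Sign.- Sign.- x = refl
  swap Sign.- Sign.+ x = refl
  swap Sign.+ Sign.- x = refl
  swap Sign.+ Sign.+ x = refl

#-rotate : ∀ {n} (x : Profile (suc n)) → # (rotate x) ≡ # x
#-rotate (b ∷ x) = #-∷ʳ b x

#-flip⁻ : ∀ {n} (x : Profile n) i → lookup x i ≡ Sign.- → # (flipAt x i) ≡ suc (# x)
#-flip⁻ (Sign.- ∷ x) zero    _ = refl
#-flip⁻ (Sign.- ∷ x) (suc i) e = #-flip⁻ x i e
#-flip⁻ (Sign.+ ∷ x) (suc i) e = cong suc (#-flip⁻ x i e)

#-flip⁺ : ∀ {n} (x : Profile n) i → lookup x i ≡ Sign.+ → suc (# (flipAt x i)) ≡ # x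
#-flip⁺ (Sign.+ ∷ x) zero    _ = refl
#-flip⁺ (Sign.- ∷ x) (suc i) e = #-flip⁺ x i e
#-flip⁺ (Sign.+ ∷ x) (suc i) e = cong suc (#-flip⁺ x i e)

neg-involutive : ∀ {n} (x : Profile n) → neg (neg x) ≡ x
neg-involutive []      = refl
neg-involutive (b ∷ x) = cong₂ _∷_ (Sign.opposite-involutive b) (neg-involutive x)

neg-rotate : ∀ {n} (x : Profile (suc n)) → neg (rotate x) ≡ rotate (neg x)
neg-rotate (b ∷ x) = Vec.map-∷ʳ opposite b x

flipAt-involutive : ∀ {n} (x : Profile n) i → flipAt (flipAt x i) i ≡ x
flipAt-involutive (b ∷ x) zero    = cong (_∷ x) (Sign.opposite-involutive b)
flipAt-involutive (b ∷ x) (suc i) = cong (b ∷_) (flipAt-involutive x i)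

flipAt-neg : ∀ {n} (x : Profile n) i → flipAt (neg x) i ≡ neg (flipAt x i)
flipAt-neg (b ∷ x) zero    = refl
flipAt-neg (b ∷ x) (suc i) = cong (opposite b ∷_) (flipAt-neg x i)

flipAt-rotate : ∀ {n} (x : Profile (suc n)) (j : Fin n) →
  flipAt (rotate x) (inject₁ j) ≡ rotate (flipAt x (suc j))
flipAt-rotate (b ∷ x) j = go x j
  where
  go : ∀ {n} (x : Profile n) j → flipAt (x ∷ʳ b) (inject₁ j) ≡ flipAt x j ∷ʳ b
  go (c ∷ x) zero    = refl
  go (c ∷ x) (suc j) = cong (c ∷_) (go x j)

-- Influences as sums over the cube

-- Recursion on the dimension, instead of a sum over the list `cube n`, turns invariance under flips
-- and negation into commutativity of addition at each coordinate.
Σ : ∀ {n} → (Profile n → ℚ) → ℚ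
Σ {zero}  f = f []
Σ {suc n} f = Σ (f ∘ (Sign.- ∷_)) ℚ.+ Σ (f ∘ (Sign.+ ∷_))

Σ-cong : ∀ {n} {f g : Profile n → ℚ} → (∀ x → f x ≡ g x) → Σ f ≡ Σ g
Σ-cong {zero}  e = e []
Σ-cong {suc n} e = cong₂ ℚ._+_ (Σ-cong (e ∘ (Sign.- ∷_))) (Σ-cong (e ∘ (Sign.+ ∷_)))

Σ-+ : ∀ {n} (f g : Profile n → ℚ) → Σ (λ x → f x ℚ.+ g x) ≡ Σ f ℚ.+ Σ g
Σ-+ {zero}  f g = refl
Σ-+ {suc n} f g = trans
  (cong₂ ℚ._+_ (Σ-+ (f ∘ (Sign.- ∷_)) (g ∘ (Sign.- ∷_))) (Σ-+ (f ∘ (Sign.+ ∷_)) (g ∘ (Sign.+ ∷_))))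
  (solve 4 (λ a b c d → a :+ b :+ (c :+ d) := a :+ c :+ (b :+ d)) refl
    (Σ (f ∘ (Sign.- ∷_))) (Σ (g ∘ (Sign.- ∷_))) (Σ (f ∘ (Sign.+ ∷_))) (Σ (g ∘ (Sign.+ ∷_))))

Σ-0 : ∀ {n} {f : Profile n → ℚ} → (∀ x → f x ≡ 0ℚ) → Σ f ≡ 0ℚ
Σ-0 {zero}  e = e []
Σ-0 {suc n} e = cong₂ ℚ._+_ (Σ-0 (e ∘ (Sign.- ∷_))) (Σ-0 (e ∘ (Sign.+ ∷_)))

Σ-flip : ∀ {n} (f : Profile n → ℚ) i → Σ (λ x → f (flipAt x i)) ≡ Σ f
Σ-flip f zero    = ℚ.+-comm (Σ (f ∘ (Sign.+ ∷_))) (Σ (f ∘ (Sign.- ∷_)))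
Σ-flip f (suc i) = cong₂ ℚ._+_ (Σ-flip (f ∘ (Sign.- ∷_)) i) (Σ-flip (f ∘ (Sign.+ ∷_)) i)

Σ-neg : ∀ {n} (f : Profile n → ℚ) → Σ (λ x → f (neg x)) ≡ Σ f
Σ-neg {zero}  f = refl
Σ-neg {suc n} f = trans
  (cong₂ ℚ._+_ (Σ-neg (f ∘ (Sign.+ ∷_))) (Σ-neg (f ∘ (Sign.- ∷_))))
  (ℚ.+-comm (Σ (f ∘ (Sign.+ ∷_))) (Σ (f ∘ (Sign.- ∷_))))

-- `Σ` splits along the first coordinate by definition; splitting it along the last one as well is
-- exactly invariance under rotation.
Σ-∷ʳ : ∀ {n} (f : Profile (suc n) → ℚ) →
  Σ f ≡ Σ (λ x → f (x ∷ʳ Sign.-)) ℚ.+ Σ (λ x → f (x ∷ʳ Sign.+))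
Σ-∷ʳ {zero}  f = refl
Σ-∷ʳ {suc n} f = trans
  (cong₂ ℚ._+_ (Σ-∷ʳ (f ∘ (Sign.- ∷_))) (Σ-∷ʳ (f ∘ (Sign.+ ∷_))))
  (solve 4 (λ a b c d → a :+ b :+ (c :+ d) := a :+ c :+ (b :+ d)) refl
    (Σ (λ x → f (Sign.- ∷ (x ∷ʳ Sign.-)))) (Σ (λ x → f (Sign.- ∷ (x ∷ʳ Sign.+))))
    (Σ (λ x → f (Sign.+ ∷ (x ∷ʳ Sign.-)))) (Σ (λ x → f (Sign.+ ∷ (x ∷ʳ Sign.+)))))

Σ-rotate : ∀ {n} (f : Profile (suc n) → ℚ) → Σ (f ∘ rotate) ≡ Σ f
Σ-rotate f = sym (Σ-∷ʳ f)

infix 4 _≟ₚ_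

_≟ₚ_ : ∀ {n} (x y : Profile n) → Dec (x ≡ y)
_≟ₚ_ = Vec.≡-dec Sign._≟_

χ : Bool → ℚ
χ true  = 1ℚ
χ false = 0ℚ

𝟙 : ∀ {P : Set} → Dec P → ℚ
𝟙 P? = χ (does P?)

𝟙-yes : ∀ {P : Set} (P? : Dec P) → P → 𝟙 P? ≡ 1ℚ
𝟙-yes P? p = cong χ (dec-true P? p)

𝟙-no : ∀ {P : Set} (P? : Dec P) → ¬ P → 𝟙 P? ≡ 0ℚ
𝟙-no P? ¬p = cong χ (dec-false P? ¬p)

Σ-point : ∀ {n} (G : Profile n → ℚ) x → Σ (λ y → G y ℚ.* 𝟙 (y ≟ₚ x)) ≡ G x
Σ-point G []      = ℚ.*-identityʳ (G [])
Σ-point G (b ∷ x) = go b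
  where
  same : ∀ b → Σ (λ y → G (b ∷ y) ℚ.* 𝟙 (b ∷ y ≟ₚ b ∷ x)) ≡ G (b ∷ x)
  same b = trans
    (Σ-cong λ y → cong (λ c → G (b ∷ y) ℚ.* χ c)
      (does-⇔ (mk⇔ Vec.∷-injectiveʳ (cong (b ∷_))) (b ∷ y ≟ₚ b ∷ x) (y ≟ₚ x)))
    (Σ-point (G ∘ (b ∷_)) x)
  different : ∀ b c → c ≢ b → Σ (λ y → G (c ∷ y) ℚ.* 𝟙 (c ∷ y ≟ₚ b ∷ x)) ≡ 0ℚ
  different b c c≢b = Σ-0 λ y → trans
    (cong (G (c ∷ y) ℚ.*_) (𝟙-no (c ∷ y ≟ₚ b ∷ x) (c≢b ∘ Vec.∷-injectiveˡ)))
    (ℚ.*-zeroʳ (G (c ∷ y)))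
  go : ∀ b → Σ (λ y → G y ℚ.* 𝟙 (y ≟ₚ b ∷ x)) ≡ G (b ∷ x)
  go Sign.- = trans (cong₂ ℚ._+_ (same Sign.-) (different Sign.- Sign.+ λ ())) (ℚ.+-identityʳ _)
  go Sign.+ = trans (cong₂ ℚ._+_ (different Sign.+ Sign.- λ ()) (same Sign.+)) (ℚ.+-identityˡ _)

-- The sequence of an influence is computed pointwise: at each index it is an
-- influence for two rational weights, which need not add up to 1.

weight : (Sign → ℚ) → ∀ {n} → Profile n → ℚ
weight c []      = 1ℚ
weight c (b ∷ x) = c b ℚ.* weight c x

infl : ∀ {n} → VotingRule n → (Sign → ℚ) → Fin n → ℚ
infl Φ c i = Σ λ x → 𝟙 (¬? (Φ x Sign.≟ Φ (flipAt x i))) ℚ.* weight c x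

sumℚ : List ℚ → ℚ
sumℚ = List.foldr ℚ._+_ 0ℚ

sumℚ-++ : ∀ as bs → sumℚ (as List.++ bs) ≡ sumℚ as ℚ.+ sumℚ bs
sumℚ-++ []       bs = sym (ℚ.+-identityˡ (sumℚ bs))
sumℚ-++ (a ∷ as) bs = trans (cong (a ℚ.+_) (sumℚ-++ as bs)) (sym (ℚ.+-assoc a (sumℚ as) (sumℚ bs)))

sumℚ-filter : ∀ {A : Set} {P : Pred A 0ℓ} (P? : Decidable P) (f : A → ℚ) as →
  sumℚ (map f (filter P? as)) ≡ sumℚ (map (λ a → 𝟙 (P? a) ℚ.* f a) as)
sumℚ-filter P? f []       = refl
sumℚ-filter P? f (a ∷ as) with does (P? a)
... | true  = cong₂ ℚ._+_ (sym (ℚ.*-identityˡ (f a))) (sumℚ-filter P? f as)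
... | false = trans (sumℚ-filter P? f as)
                (trans (sym (ℚ.+-identityˡ _)) (cong (ℚ._+ _) (sym (ℚ.*-zeroˡ (f a)))))

sumℚ-cube : ∀ n (f : Profile n → ℚ) → sumℚ (map f (cube n)) ≡ Σ f
sumℚ-cube zero    f = ℚ.+-identityʳ (f [])
sumℚ-cube (suc n) f = begin
  sumℚ (map f (map (Sign.- ∷_) C List.++ map (Sign.+ ∷_) C List.++ []))
    ≡⟨ cong (λ l → sumℚ (map f (map (Sign.- ∷_) C List.++ l))) (List.++-identityʳ (map (Sign.+ ∷_) C)) ⟩
  sumℚ (map f (map (Sign.- ∷_) C List.++ map (Sign.+ ∷_) C))
    ≡⟨ cong sumℚ (List.map-++ f (map (Sign.- ∷_) C) (map (Sign.+ ∷_) C)) ⟩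
  sumℚ (map f (map (Sign.- ∷_) C) List.++ map f (map (Sign.+ ∷_) C))
    ≡⟨ sumℚ-++ (map f (map (Sign.- ∷_) C)) (map f (map (Sign.+ ∷_) C)) ⟩
  sumℚ (map f (map (Sign.- ∷_) C)) ℚ.+ sumℚ (map f (map (Sign.+ ∷_) C))
    ≡⟨ cong₂ ℚ._+_ (half Sign.-) (half Sign.+) ⟩
  Σ f ∎
  where
  open ≡-Reasoning
  C = cube n
  half : ∀ b → sumℚ (map f (map (b ∷_) C)) ≡ Σ (f ∘ (b ∷_))
  half b = trans (cong sumℚ (sym (List.map-∘ C))) (sumℚ-cube n (f ∘ (b ∷_)))

seq-∑ : ∀ {A : Set} (as : List A) (f : A → ℝ) N → seq (∑ as f) N ≡ sumℚ (map (λ a → seq (f a) N) as)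
seq-∑ []       f N = refl
seq-∑ (a ∷ as) f N = cong (seq (f a) N ℚ.+_) (seq-∑ as f N)

seq-⊗ : ∀ {n} (p : Sign → ℝ) (x : Profile n) N → seq ((p ⊗ n) x) N ≡ weight (λ b → seq (p b) N) x
seq-⊗ p []      N = refl
seq-⊗ p (b ∷ x) N = cong (seq (p b) N ℚ.*_) (seq-⊗ p x N)

seq-influence : ∀ {n} (Φ : VotingRule n) p i N →
  seq (influence (p ⊗ n) i Φ) N ≡ infl Φ (λ b → seq (p b) N) i
seq-influence {n} Φ p i N = begin
  seq (∑ (filter piv? (cube n)) (p ⊗ n)) N
    ≡⟨ seq-∑ (filter piv? (cube n)) (p ⊗ n) N ⟩
  sumℚ (map (λ x → seq ((p ⊗ n) x) N) (filter piv? (cube n)))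
    ≡⟨ sumℚ-filter piv? (λ x → seq ((p ⊗ n) x) N) (cube n) ⟩
  sumℚ (map (λ x → 𝟙 (piv? x) ℚ.* seq ((p ⊗ n) x) N) (cube n))
    ≡⟨ sumℚ-cube n _ ⟩
  Σ (λ x → 𝟙 (piv? x) ℚ.* seq ((p ⊗ n) x) N)
    ≡⟨ Σ-cong (λ x → cong (𝟙 (piv? x) ℚ.*_) (seq-⊗ p x N)) ⟩
  infl Φ (λ b → seq (p b) N) i ∎
  where
  open ≡-Reasoning
  piv? = λ x → ¬? (Φ x Sign.≟ Φ (flipAt x i))

-- An identity for all rational weights applies at every index of the two Cauchy sequences, so their
-- difference vanishes from index 0 on and no limit argument arises.
infl-constant⇒unbiased : ∀ {n} (Φ : VotingRule n) → (∀ c i j → infl Φ c i ≡ infl Φ c j) → Unbiased Φ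
infl-constant⇒unbiased {n} Φ const p _ i j ε 0<ε = 0 , λ N _ → subst (ℚ._< ε) (sym (begin
  ℚ.∣ seq (influence (p ⊗ n) i Φ) N ℚ.- seq (influence (p ⊗ n) j Φ) N ∣
    ≡⟨ cong₂ (λ a b → ℚ.∣ a ℚ.- b ∣) (seq-influence Φ p i N) (seq-influence Φ p j N) ⟩
  ℚ.∣ infl Φ _ i ℚ.- infl Φ _ j ∣
    ≡⟨ cong (λ a → ℚ.∣ a ℚ.- infl Φ (λ b → seq (p b) N) j ∣) (const _ i j) ⟩
  ℚ.∣ infl Φ _ j ℚ.- infl Φ _ j ∣
    ≡⟨ cong ℚ.∣_∣ (ℚ.+-inverseʳ (infl Φ (λ b → seq (p b) N) j)) ⟩
  0ℚ ∎)) 0<ε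
  where open ≡-Reasoning

-- Influences under rotation and as linear forms in the outcomes

pow : ℚ → ℕ → ℚ
pow a zero    = 1ℚ
pow a (suc k) = a ℚ.* pow a k

-- An i.i.d. weight sees only how many votes of each kind there are. So rotations preserve it, and
-- sets of equal size can be exchanged.
weight-pow : ∀ c {n} (x : Profile n) → weight c x ≡ pow (c Sign.+) (# x) ℚ.* pow (c Sign.-) (# (neg x))
weight-pow c []             = refl
weight-pow c (Sign.- ∷ x) = trans (cong (c Sign.- ℚ.*_) (weight-pow c x))
  (solve 3 (λ a b d → a :* (b :* d) := b :* (a :* d)) refl
    (c Sign.-) (pow (c Sign.+) (# x)) (pow (c Sign.-) (# (neg x))))
weight-pow c (Sign.+ ∷ x) = trans (cong (c Sign.+ ℚ.*_) (weight-pow c x))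
  (sym (ℚ.*-assoc (c Sign.+) (pow (c Sign.+) (# x)) (pow (c Sign.-) (# (neg x)))))

#-neg-cong : ∀ {n} (x y : Profile n) → # x ≡ # y → # (neg x) ≡ # (neg y)
#-neg-cong x y e = ℕ.+-cancelˡ-≡ (# x) _ _
  (trans (#-neg x) (sym (trans (cong (_+ # (neg y)) e) (#-neg y))))

weight-# : ∀ c {n} (x y : Profile n) → # x ≡ # y → weight c x ≡ weight c y
weight-# c x y e = begin
  weight c x                                                     ≡⟨ weight-pow c x ⟩
  pow (c Sign.+) (# x) ℚ.* pow (c Sign.-) (# (neg x))            ≡⟨ cong₂ (λ k l → pow (c Sign.+) k ℚ.* pow (c Sign.-) l) e (#-neg-cong x y e) ⟩
  pow (c Sign.+) (# y) ℚ.* pow (c Sign.-) (# (neg y))            ≡⟨ weight-pow c y ⟨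
  weight c y                                                     ∎
  where open ≡-Reasoning

-- Voter `j` is pivotal at `rotate x` exactly when voter `j + 1` is pivotal at `x`, so neighbouring
-- voters have equal influence, and induction leads down to voter 0.
infl-rotate : ∀ {n} (Φ : VotingRule (suc n)) → (∀ x → Φ (rotate x) ≡ Φ x) → ∀ c i j → infl Φ c i ≡ infl Φ c j
infl-rotate {n} Φ inv c i j = trans (to-zero i) (sym (to-zero j))
  where
  step : ∀ j → infl Φ c (inject₁ j) ≡ infl Φ c (suc j)
  step j = trans (sym (Σ-rotate (λ x → 𝟙 (¬? (Φ x Sign.≟ Φ (flipAt x (inject₁ j)))) ℚ.* weight c x)))
    (Σ-cong λ x → cong₂ ℚ._*_
      (cong₂ (λ a b → 𝟙 (¬? (a Sign.≟ b))) (inv x) (trans (cong Φ (flipAt-rotate x j)) (inv (flipAt x (suc j)))))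
      (weight-# c (rotate x) x (#-rotate x)))
  to-zero : ∀ i → infl Φ c i ≡ infl Φ c zero
  to-zero = Fin.<-weakInduction (λ i → infl Φ c i ≡ infl Φ c zero) refl (λ i e → trans (sym (step i)) e)

ε : Sign → ℚ
ε Sign.- = ℚ.- 1ℚ
ε Sign.+ = 1ℚ

φ : Sign → ℚ
φ Sign.- = 0ℚ
φ Sign.+ = 1ℚ

-- The coefficient of `φ (Φ x)` when the influence of `i` is written as a linear form in the
-- outcomes.
kernel : ∀ {n} → (Sign → ℚ) → Fin n → Profile n → ℚ
kernel c i x = ε (lookup x i) ℚ.* (weight c x ℚ.+ weight c (flipAt x i))

-- Both weights depend on `x` only through its size, once the vote of `i` tells whether the flip
-- raises or lowers it. This lets the exchange be checked one voter at a time.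
kernel-# : ∀ c {n} (i : Fin n) x y → lookup x i ≡ lookup y i → # x ≡ # y → kernel c i x ≡ kernel c i y
kernel-# c i x y e k = cong₂ (λ s w → ε s ℚ.* w) e
  (cong₂ ℚ._+_ (weight-# c x y k) (weight-# c (flipAt x i) (flipAt y i) (#-flip (lookup y i) refl)))
  where
  #-flip : ∀ s → lookup y i ≡ s → # (flipAt x i) ≡ # (flipAt y i)
  #-flip Sign.- e′ = trans (#-flip⁻ x i (trans e e′)) (trans (cong suc k) (sym (#-flip⁻ y i e′)))
  #-flip Sign.+ e′ = ℕ.suc-injective (trans (#-flip⁺ x i (trans e e′)) (trans k (sym (#-flip⁺ y i e′))))

≤ₛ-refl : ∀ {s} → s ≤ₛ s
≤ₛ-refl = ℤ.≤-refl

-≤+ : Sign.- ≤ₛ Sign.+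
-≤+ = ℤ.-≤+

+≰- : ¬ (Sign.+ ≤ₛ Sign.-)
+≰- ()

flip-≥ : ∀ {n} (x : Profile n) i → lookup x i ≡ Sign.- → Pointwise _≤ₛ_ x (flipAt x i)
flip-≥ (Sign.- ∷ x) zero    e = -≤+ ∷ Pointwise.refl ≤ₛ-refl
flip-≥ (b ∷ x)      (suc i) e = ≤ₛ-refl ∷ flip-≥ x i e

flip-≤ : ∀ {n} (x : Profile n) i → lookup x i ≡ Sign.+ → Pointwise _≤ₛ_ (flipAt x i) x
flip-≤ (Sign.+ ∷ x) zero    e = -≤+ ∷ Pointwise.refl ≤ₛ-refl
flip-≤ (b ∷ x)      (suc i) e = ≤ₛ-refl ∷ flip-≤ x i e

-- For monotone Φ the pivotality of i at x is ε(xᵢ)(φ(Φ x) − φ(Φ x^{⊕i})); moving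
-- the flip from Φ to the rest of the summand makes the influence linear in φ ∘ Φ.
infl-kernel : ∀ {n} (Φ : VotingRule n) → Monotone Φ → ∀ c i → infl Φ c i ≡ Σ (λ x → kernel c i x ℚ.* φ (Φ x))
infl-kernel Φ mono c i = begin
  infl Φ c i
    ≡⟨ Σ-cong (λ x → pointwise x (lookup x i) refl) ⟩
  Σ (λ x → f x ℚ.+ g (flipAt x i))
    ≡⟨ Σ-+ f (λ x → g (flipAt x i)) ⟩
  Σ f ℚ.+ Σ (λ x → g (flipAt x i))
    ≡⟨ cong (Σ f ℚ.+_) (Σ-flip g i) ⟩
  Σ f ℚ.+ Σ g
    ≡⟨ Σ-+ f g ⟨
  Σ (λ x → f x ℚ.+ g x)
    ≡⟨ Σ-cong (λ x → solve 4 (λ e u v p → e :* u :* p :+ e :* v :* p := e :* (u :+ v) :* p) refl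
         (ε (lookup x i)) (weight c x) (weight c (flipAt x i)) (φ (Φ x))) ⟩
  Σ (λ x → kernel c i x ℚ.* φ (Φ x)) ∎
  where
  open ≡-Reasoning
  f g : Profile _ → ℚ
  f x = ε (lookup x i) ℚ.* weight c x ℚ.* φ (Φ x)
  g x = ε (lookup x i) ℚ.* weight c (flipAt x i) ℚ.* φ (Φ x)

  -- Of the eight sign patterns, monotonicity excludes the two in which the outcome moves against
  -- the flip; the others are arithmetic.
  signs-identity : ∀ s u v w → (s ≡ Sign.- → u ≤ₛ v) → (s ≡ Sign.+ → v ≤ₛ u) →
    𝟙 (¬? (u Sign.≟ v)) ℚ.* w ≡ ε s ℚ.* w ℚ.* φ u ℚ.+ ε (opposite s) ℚ.* w ℚ.* φ v
  signs-identity Sign.- Sign.- Sign.- w _ _ = solve 1 (λ w → con 0ℚ :* w := con (ℚ.- 1ℚ) :* w :* con 0ℚ :+ con 1ℚ :* w :* con 0ℚ) refl w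
  signs-identity Sign.- Sign.- Sign.+ w _ _ = solve 1 (λ w → con 1ℚ :* w := con (ℚ.- 1ℚ) :* w :* con 0ℚ :+ con 1ℚ :* w :* con 1ℚ) refl w
  signs-identity Sign.- Sign.+ Sign.- w h _ = contradiction (h refl) +≰-
  signs-identity Sign.- Sign.+ Sign.+ w _ _ = solve 1 (λ w → con 0ℚ :* w := con (ℚ.- 1ℚ) :* w :* con 1ℚ :+ con 1ℚ :* w :* con 1ℚ) refl w
  signs-identity Sign.+ Sign.- Sign.- w _ _ = solve 1 (λ w → con 0ℚ :* w := con 1ℚ :* w :* con 0ℚ :+ con (ℚ.- 1ℚ) :* w :* con 0ℚ) refl w
  signs-identity Sign.+ Sign.- Sign.+ w _ h = contradiction (h refl) +≰-
  signs-identity Sign.+ Sign.+ Sign.- w _ _ = solve 1 (λ w → con 1ℚ :* w := con 1ℚ :* w :* con 1ℚ :+ con (ℚ.- 1ℚ) :* w :* con 0ℚ) refl w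
  signs-identity Sign.+ Sign.+ Sign.+ w _ _ = solve 1 (λ w → con 0ℚ :* w := con 1ℚ :* w :* con 1ℚ :+ con (ℚ.- 1ℚ) :* w :* con 1ℚ) refl w

  pointwise : ∀ x s → lookup x i ≡ s → 𝟙 (¬? (Φ x Sign.≟ Φ (flipAt x i))) ℚ.* weight c x ≡ f x ℚ.+ g (flipAt x i)
  pointwise x s e = trans
    (signs-identity s (Φ x) (Φ (flipAt x i)) (weight c x)
      (λ s≡- → mono (flipAt x i) x (flip-≥ x i (trans e s≡-)))
      (λ s≡+ → mono x (flipAt x i) (flip-≤ x i (trans e s≡+))))
    (cong₂ ℚ._+_
      (cong (λ t → ε t ℚ.* weight c x ℚ.* φ (Φ x)) (sym e))
      (cong₂ (λ t w → ε t ℚ.* w ℚ.* φ (Φ (flipAt x i)))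
        (sym (trans (Vec.lookup∘updateAt i x) (cong opposite e)))
        (cong (weight c) (sym (flipAt-involutive x i)))))

-- The coordinatewise order on profiles

infix 4 _≼_

_≼_ : ∀ {n} → Profile n → Profile n → Set
_≼_ = Pointwise _≤ₛ_

#-mono : ∀ {n} {x y : Profile n} → x ≼ y → # x ≤ # y
#-mono []                                          = z≤n
#-mono (_∷_ {x = Sign.-} {y = Sign.-} _ x≼y) = #-mono x≼y
#-mono (_∷_ {x = Sign.-} {y = Sign.+} _ x≼y) = ℕ.m≤n⇒m≤1+n (#-mono x≼y)
#-mono (_∷_ {x = Sign.+} {y = Sign.+} _ x≼y) = s≤s (#-mono x≼y)

≼∧#≤⇒≡ : ∀ {n} {x y : Profile n} → x ≼ y → # y ≤ # x → x ≡ y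
≼∧#≤⇒≡ []                                          _       = refl
≼∧#≤⇒≡ (_∷_ {x = Sign.-} {y = Sign.-} _ x≼y) le       = cong (Sign.- ∷_) (≼∧#≤⇒≡ x≼y le)
≼∧#≤⇒≡ (_∷_ {x = Sign.-} {y = Sign.+} _ x≼y) le       = contradiction (ℕ.≤-trans le (#-mono x≼y)) ℕ.1+n≰n
≼∧#≤⇒≡ (_∷_ {x = Sign.+} {y = Sign.+} _ x≼y) (s≤s le) = cong (Sign.+ ∷_) (≼∧#≤⇒≡ x≼y le)

neg-antitone : ∀ {n} {x y : Profile n} → x ≼ y → neg y ≼ neg x
neg-antitone []                                    = []
neg-antitone (_∷_ {x = Sign.-} {y = Sign.-} _ x≼y) = ≤ₛ-refl {Sign.+} ∷ neg-antitone x≼y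
neg-antitone (_∷_ {x = Sign.-} {y = Sign.+} _ x≼y) = -≤+ ∷ neg-antitone x≼y
neg-antitone (_∷_ {x = Sign.+} {y = Sign.+} _ x≼y) = ≤ₛ-refl {Sign.-} ∷ neg-antitone x≼y

≤ₛ-from : ∀ {s t} → (s ≡ Sign.+ → t ≡ Sign.+) → s ≤ₛ t
≤ₛ-from {Sign.-} {Sign.-} _ = ≤ₛ-refl {Sign.-}
≤ₛ-from {Sign.-} {Sign.+} _ = -≤+
≤ₛ-from {Sign.+} {t}        h = subst (Sign.+ ≤ₛ_) (sym (h refl)) (≤ₛ-refl {Sign.+})

-- Rules with a prescribed family of winning coalitions of the smallest size

-- The arguments tell whether the `+` voters win outright, whether the `-` voters do, and whether
-- `+` has the majority.
verdict : Bool → Bool → Bool → Sign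
verdict true  _     _     = Sign.+
verdict false true  _     = Sign.-
verdict false false true  = Sign.+
verdict false false false = Sign.-

module Rules (h s : ℕ) (s≤h : s ≤ h)
  (C : Pred (Profile (suc (h + h))) 0ℓ) (C? : Decidable C)
  (C-mono : ∀ {x y} → x ≼ y → C x → C y)
  (C-disjoint : ∀ {x} → C x → ¬ C (neg x))
  where

  private
    n : ℕ
    n = suc (h + h)

  record Family : Set₁ where
    field
      F   : Pred (Profile n) 0ℓ
      F?  : Decidable F
      F⇒# : ∀ {x} → F x → # x ≡ s
      F⇒C : ∀ {x} → F x → C x

  -- The rule of the empty family is the common reference with which both families of the exchange
  -- are compared.
  ∅ : Family
  ∅ = record { F = λ _ → ⊥ ; F? = λ _ → no λ () ; F⇒# = λ () ; F⇒C = λ () }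

  minority : ∀ (x : Profile n) → # x ≤ h → h < # (neg x)
  minority x x≤h = ℕ.≰⇒> λ nx≤h → ℕ.<⇒≢ (s≤s (ℕ.+-mono-≤ x≤h nx≤h)) (#-neg x)

  majority : ∀ (x : Profile n) → h < # x → # (neg x) ≤ h
  majority x h<x = ℕ.≮⇒≥ λ h<nx → ℕ.<-irrefl (sym (#-neg x))
    (ℕ.≤-trans (ℕ.≤-reflexive (cong suc (sym (ℕ.+-suc h h)))) (ℕ.+-mono-≤ h<x h<nx))

  module Rule (𝓕 : Family) where
    open Family 𝓕

    W : Pred (Profile n) 0ℓ
    W x = (C x × s < # x) ⊎ F x

    W? : Decidable W
    W? x = (C? x ×-dec s <? # x) ⊎-dec F? x

    Φ : VotingRule n
    Φ x = verdict (does (W? x)) (does (W? (neg x))) (does (h <? # x))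

    W⇒C : ∀ {x} → W x → C x
    W⇒C (inj₁ (c , _)) = c
    W⇒C (inj₂ f)       = F⇒C f

    W-disjoint : ∀ {x} → W x → ¬ W (neg x)
    W-disjoint w w′ = C-disjoint (W⇒C w) (W⇒C w′)

    -- A proper superset of a member has more than `s` members and still satisfies `C`, so the first
    -- clause of `W` takes over, whatever the family is.
    W-mono : ∀ {x y} → x ≼ y → W x → W y
    W-mono x≼y (inj₁ (c , s<x)) = inj₁ (C-mono x≼y c , ℕ.<-≤-trans s<x (#-mono x≼y))
    W-mono {x} {y} x≼y (inj₂ f) with # y ℕ.≤? s
    ... | yes y≤s = inj₂ (subst F (≼∧#≤⇒≡ x≼y (subst (# y ≤_) (sym (F⇒# f)) y≤s)) f)
    ... | no  y≰s = inj₁ (C-mono x≼y (F⇒C f) , ℕ.≰⇒> y≰s)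

    Φ-W : ∀ {x} → W x → Φ x ≡ Sign.+
    Φ-W {x} w = cong (λ b → verdict b (does (W? (neg x))) (does (h <? # x))) (dec-true (W? x) w)

    Φ-neg : ∀ {x} → W (neg x) → Φ x ≡ Sign.-
    Φ-neg {x} w = cong₂ (λ a b → verdict a b (does (h <? # x)))
      (dec-false (W? x) λ w′ → W-disjoint w′ w) (dec-true (W? (neg x)) w)

    Φ-else : ∀ {x} → ¬ W x → ¬ W (neg x) → Φ x ≡ verdict false false (does (h <? # x))
    Φ-else {x} ¬w ¬w′ = cong₂ (λ a b → verdict a b (does (h <? # x)))
      (dec-false (W? x) ¬w) (dec-false (W? (neg x)) ¬w′)

    Φ-majority : ∀ {x} → ¬ W (neg x) → h < # x → Φ x ≡ Sign.+
    Φ-majority {x} ¬w′ h<x with W? x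
    ... | yes w = Φ-W w
    ... | no ¬w = trans (Φ-else ¬w ¬w′) (cong (verdict false false) (dec-true (h <? # x) h<x))

    Φ-minority : ∀ {x} → ¬ W x → # x ≤ h → Φ x ≡ Sign.-
    Φ-minority {x} ¬w x≤h with W? (neg x)
    ... | yes w′ = Φ-neg w′
    ... | no ¬w′ = trans (Φ-else ¬w ¬w′) (cong (verdict false false) (dec-false (h <? # x) (ℕ.≤⇒≯ x≤h)))

    Φ≡+ : ∀ {x} → Φ x ≡ Sign.+ → W x ⊎ (¬ W (neg x) × h < # x)
    Φ≡+ {x} e with W? x
    ... | yes w = inj₁ w
    ... | no ¬w = inj₂
      ( (λ w′ → contradiction (trans (sym e) (Φ-neg w′)) λ ())
      , ℕ.≰⇒> λ x≤h → contradiction (trans (sym e) (Φ-minority ¬w x≤h)) λ ())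

    Φ-odd : Odd Φ
    Φ-odd x with W? x
    ... | yes w = trans (Φ-neg (subst W (sym (neg-involutive x)) w)) (cong opposite (sym (Φ-W w)))
    ... | no ¬w with W? (neg x)
    ...   | yes w′ = trans (Φ-W w′) (cong opposite (sym (Φ-neg w′)))
    ...   | no ¬w′ with h <? # x
    ...     | yes h<x = trans (Φ-minority ¬w′ (majority x h<x)) (cong opposite (sym (Φ-majority ¬w′ h<x)))
    ...     | no h≮x  = trans (Φ-majority (¬w ∘ subst W (neg-involutive x)) (minority x (ℕ.≮⇒≥ h≮x)))
                          (cong opposite (sym (Φ-minority ¬w (ℕ.≮⇒≥ h≮x))))

    Φ-monotone : Monotone Φ
    Φ-monotone x x′ x′≼x = ≤ₛ-from (go ∘ Φ≡+)
      where
      go : W x′ ⊎ (¬ W (neg x′) × h < # x′) → Φ x ≡ Sign.+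
      go (inj₁ w)          = Φ-W (W-mono x′≼x w)
      go (inj₂ (¬w , h<x)) = Φ-majority (¬w ∘ W-mono (neg-antitone x′≼x)) (ℕ.<-≤-trans h<x (#-mono x′≼x))

    -- At most `s ≤ h` votes are too few both for the first clause of `W` and for a majority, so
    -- only membership can have decided. The family can thus be recovered from the rule.
    Φ≡+∧#≤⇒F : ∀ {x} → Φ x ≡ Sign.+ → # x ≤ s → F x
    Φ≡+∧#≤⇒F e x≤s with Φ≡+ e
    ... | inj₁ (inj₁ (_ , s<x)) = contradiction s<x (ℕ.≤⇒≯ x≤s)
    ... | inj₁ (inj₂ f)         = f
    ... | inj₂ (_ , h<x)        = contradiction h<x (ℕ.≤⇒≯ (ℕ.≤-trans x≤s s≤h))

    Φ-rotate : (∀ x → C (rotate x) ⇔ C x) → (∀ x → F (rotate x) ⇔ F x) → ∀ x → Φ (rotate x) ≡ Φ x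
    Φ-rotate C⇔ F⇔ x = trans
      (cong₂ (λ a b → verdict a b (does (h <? # (rotate x))))
        (does-⇔ (W⇔ x) (W? (rotate x)) (W? x))
        (trans (cong (does ∘ W?) (neg-rotate x)) (does-⇔ (W⇔ (neg x)) (W? (rotate (neg x))) (W? (neg x)))))
      (cong (λ k → verdict (does (W? x)) (does (W? (neg x))) (does (h <? k))) (#-rotate x))
      where
      open Equivalence
      W⇔ : ∀ x → W (rotate x) ⇔ W x
      W⇔ x = mk⇔
        (λ { (inj₁ (c , l)) → inj₁ (to (C⇔ x) c , subst (s <_) (#-rotate x) l) ; (inj₂ f) → inj₂ (to (F⇔ x) f) })
        (λ { (inj₁ (c , l)) → inj₁ (from (C⇔ x) c , subst (s <_) (sym (#-rotate x)) l) ; (inj₂ f) → inj₂ (from (F⇔ x) f) })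

  open Rule using (Φ)
  open Family

  module _ (𝓕 : Family) where
    private
      module R = Rule 𝓕
      module E = Rule ∅

      values : ∀ {a a′ b b′ p p′ q q′} → a ≡ a′ → p ≡ p′ → b ≡ b′ → q ≡ q′ →
        φ a′ ℚ.+ p′ ≡ φ b′ ℚ.+ q′ → φ a ℚ.+ p ≡ φ b ℚ.+ q
      values refl refl refl refl e = e

    -- Since `s ≤ h`, a member loses under the reference rule by majority; the family turns it into
    -- a win and, by oddness, turns the win of its negation into a loss. Nothing else changes, so
    -- the effect is additive over the members. Terms are moved across to avoid subtraction.
    φ-family : ∀ x → φ (Φ 𝓕 x) ℚ.+ 𝟙 (F? 𝓕 (neg x)) ≡ φ (Φ ∅ x) ℚ.+ 𝟙 (F? 𝓕 x)
    φ-family x = go (E.W? x) (E.W? (neg x)) (F? 𝓕 x) (F? 𝓕 (neg x))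
      where
      in-𝓕 : ∀ {y} → F 𝓕 y → 𝟙 (F? 𝓕 y) ≡ 1ℚ
      in-𝓕 {y} = 𝟙-yes (F? 𝓕 y)
      not-in-𝓕 : ∀ {y} → ¬ F 𝓕 y → 𝟙 (F? 𝓕 y) ≡ 0ℚ
      not-in-𝓕 {y} = 𝟙-no (F? 𝓕 y)
      F⇒≤h : ∀ {y} → F 𝓕 y → # y ≤ h
      F⇒≤h f = subst (_≤ h) (sym (F⇒# 𝓕 f)) s≤h
      large⇒∉ : ∀ {y} → s < # y → ¬ F 𝓕 y
      large⇒∉ s<y f = ℕ.<⇒≢ s<y (sym (F⇒# 𝓕 f))
      go : Dec (E.W x) → Dec (E.W (neg x)) → Dec (F 𝓕 x) → Dec (F 𝓕 (neg x)) →
        φ (Φ 𝓕 x) ℚ.+ 𝟙 (F? 𝓕 (neg x)) ≡ φ (Φ ∅ x) ℚ.+ 𝟙 (F? 𝓕 x)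
      go (yes (inj₁ w)) _ _ _ = values
        (R.Φ-W (inj₁ w)) (not-in-𝓕 λ f → C-disjoint (proj₁ w) (F⇒C 𝓕 f))
        (E.Φ-W (inj₁ w)) (not-in-𝓕 (large⇒∉ (proj₂ w))) refl
      go (no _) (yes (inj₁ w)) _ _ = values
        (R.Φ-neg (inj₁ w)) (not-in-𝓕 (large⇒∉ (proj₂ w)))
        (E.Φ-neg (inj₁ w)) (not-in-𝓕 λ f → C-disjoint (F⇒C 𝓕 f) (proj₁ w)) refl
      go (no ¬w) (no _) (yes f) _ = values
        (R.Φ-W (inj₂ f)) (not-in-𝓕 λ f′ → C-disjoint (F⇒C 𝓕 f) (F⇒C 𝓕 f′))
        (E.Φ-minority ¬w (F⇒≤h f)) (in-𝓕 f) refl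
      go (no _) (no ¬w′) (no ¬f) (yes f′) = values
        (R.Φ-neg (inj₂ f′)) (in-𝓕 f′)
        (E.Φ-majority ¬w′ (ℕ.≰⇒> λ x≤h → ℕ.<⇒≱ (minority x x≤h) (F⇒≤h f′))) (not-in-𝓕 ¬f) refl
      go (no ¬w) (no ¬w′) (no ¬f) (no ¬f′) = values
        (R.Φ-else (λ { (inj₁ w) → ¬w (inj₁ w) ; (inj₂ f) → ¬f f })
                  (λ { (inj₁ w) → ¬w′ (inj₁ w) ; (inj₂ f) → ¬f′ f })) (not-in-𝓕 ¬f′)
        (E.Φ-else ¬w ¬w′) (not-in-𝓕 ¬f) refl

  open Rule using (Φ-monotone; Φ-rotate)

  -- Trading the members f₁, f₂ of a family for g₁, g₂ does not change any influence if, at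
  -- every voter, f₁ and f₂ take the same two values as g₁ and g₂ up to order.
  module Trade (𝓕 : Family) (f₁ f₂ g₁ g₂ : Profile n)
    (f₁∈𝓕 : F 𝓕 f₁) (f₂∈𝓕 : F 𝓕 f₂) (f₁≢f₂ : f₁ ≢ f₂)
    (g₁∉𝓕 : ¬ F 𝓕 g₁) (g₂∉𝓕 : ¬ F 𝓕 g₂) (g₁≢g₂ : g₁ ≢ g₂)
    (#g₁ : # g₁ ≡ s) (#g₂ : # g₂ ≡ s) (Cg₁ : C g₁) (Cg₂ : C g₂)
    (balanced : ∀ i → (lookup f₁ i ≡ lookup g₁ i × lookup f₂ i ≡ lookup g₂ i) ⊎
                      (lookup f₁ i ≡ lookup g₂ i × lookup f₂ i ≡ lookup g₁ i))
    where

    𝓖 : Family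
    𝓖 = record
      { F   = λ x → (F 𝓕 x × x ≢ f₁ × x ≢ f₂) ⊎ (x ≡ g₁ ⊎ x ≡ g₂)
      ; F?  = λ x → (F? 𝓕 x ×-dec ¬? (x ≟ₚ f₁) ×-dec ¬? (x ≟ₚ f₂)) ⊎-dec ((x ≟ₚ g₁) ⊎-dec (x ≟ₚ g₂))
      ; F⇒# = λ { (inj₁ (f , _)) → F⇒# 𝓕 f ; (inj₂ (inj₁ refl)) → #g₁ ; (inj₂ (inj₂ refl)) → #g₂ }
      ; F⇒C = λ { (inj₁ (f , _)) → F⇒C 𝓕 f ; (inj₂ (inj₁ refl)) → Cg₁ ; (inj₂ (inj₂ refl)) → Cg₂ }
      }

    private
      trade : ∀ x → 𝟙 (F? 𝓖 x) ℚ.+ (𝟙 (x ≟ₚ f₁) ℚ.+ 𝟙 (x ≟ₚ f₂)) ≡ 𝟙 (F? 𝓕 x) ℚ.+ (𝟙 (x ≟ₚ g₁) ℚ.+ 𝟙 (x ≟ₚ g₂))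
      trade x = go (x ≟ₚ f₁) (x ≟ₚ f₂) (x ≟ₚ g₁) (x ≟ₚ g₂)
        where
        Goal : Set
        Goal = 𝟙 (F? 𝓖 x) ℚ.+ (𝟙 (x ≟ₚ f₁) ℚ.+ 𝟙 (x ≟ₚ f₂)) ≡ 𝟙 (F? 𝓕 x) ℚ.+ (𝟙 (x ≟ₚ g₁) ℚ.+ 𝟙 (x ≟ₚ g₂))
        values : ∀ {a b c d e f} → 𝟙 (F? 𝓖 x) ≡ a → 𝟙 (x ≟ₚ f₁) ≡ b → 𝟙 (x ≟ₚ f₂) ≡ c →
          𝟙 (F? 𝓕 x) ≡ d → 𝟙 (x ≟ₚ g₁) ≡ e → 𝟙 (x ≟ₚ g₂) ≡ f → a ℚ.+ (b ℚ.+ c) ≡ d ℚ.+ (e ℚ.+ f) → Goal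
        values refl refl refl refl refl refl h = h
        removed : F 𝓕 x → ¬ (x ≢ f₁ × x ≢ f₂) → ¬ F 𝓖 x
        removed f ¬keep (inj₁ (_ , keep))     = ¬keep keep
        removed f ¬keep (inj₂ (inj₁ x≡g₁)) = g₁∉𝓕 (subst (F 𝓕) x≡g₁ f)
        removed f ¬keep (inj₂ (inj₂ x≡g₂)) = g₂∉𝓕 (subst (F 𝓕) x≡g₂ f)
        no-g : ∀ {g} → F 𝓕 x → ¬ F 𝓕 g → 𝟙 (x ≟ₚ g) ≡ 0ℚ
        no-g {g} f g∉ = 𝟙-no (x ≟ₚ g) λ x≡g → g∉ (subst (F 𝓕) x≡g f)
        no-f : ∀ {f} → ¬ F 𝓕 x → F 𝓕 f → 𝟙 (x ≟ₚ f) ≡ 0ℚ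
        no-f {f} x∉ f∈ = 𝟙-no (x ≟ₚ f) λ x≡f → x∉ (subst (F 𝓕) (sym x≡f) f∈)
        go : Dec (x ≡ f₁) → Dec (x ≡ f₂) → Dec (x ≡ g₁) → Dec (x ≡ g₂) → Goal
        go (yes e) _ _ _ = values
          (𝟙-no (F? 𝓖 x) (removed x∈ λ keep → proj₁ keep e)) (𝟙-yes (x ≟ₚ f₁) e) (𝟙-no (x ≟ₚ f₂) (f₁≢f₂ ∘ trans (sym e)))
          (𝟙-yes (F? 𝓕 x) x∈) (no-g x∈ g₁∉𝓕) (no-g x∈ g₂∉𝓕) refl
          where x∈ = subst (F 𝓕) (sym e) f₁∈𝓕
        go (no ≢f₁) (yes e) _ _ = values
          (𝟙-no (F? 𝓖 x) (removed x∈ λ keep → proj₂ keep e)) (𝟙-no (x ≟ₚ f₁) ≢f₁) (𝟙-yes (x ≟ₚ f₂) e)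
          (𝟙-yes (F? 𝓕 x) x∈) (no-g x∈ g₁∉𝓕) (no-g x∈ g₂∉𝓕) refl
          where x∈ = subst (F 𝓕) (sym e) f₂∈𝓕
        go (no _) (no _) (yes e) _ = values
          (𝟙-yes (F? 𝓖 x) (inj₂ (inj₁ e))) (no-f x∉ f₁∈𝓕) (no-f x∉ f₂∈𝓕)
          (𝟙-no (F? 𝓕 x) x∉) (𝟙-yes (x ≟ₚ g₁) e) (𝟙-no (x ≟ₚ g₂) (g₁≢g₂ ∘ trans (sym e))) refl
          where x∉ = g₁∉𝓕 ∘ subst (F 𝓕) e
        go (no _) (no _) (no ≢g₁) (yes e) = values
          (𝟙-yes (F? 𝓖 x) (inj₂ (inj₂ e))) (no-f x∉ f₁∈𝓕) (no-f x∉ f₂∈𝓕)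
          (𝟙-no (F? 𝓕 x) x∉) (𝟙-no (x ≟ₚ g₁) ≢g₁) (𝟙-yes (x ≟ₚ g₂) e) refl
          where x∉ = g₂∉𝓕 ∘ subst (F 𝓕) e
        go (no ≢f₁) (no ≢f₂) (no ≢g₁) (no ≢g₂) = values
          (cong χ (does-⇔ (mk⇔ kept (λ f → inj₁ (f , ≢f₁ , ≢f₂))) (F? 𝓖 x) (F? 𝓕 x)))
          (𝟙-no (x ≟ₚ f₁) ≢f₁) (𝟙-no (x ≟ₚ f₂) ≢f₂) refl (𝟙-no (x ≟ₚ g₁) ≢g₁) (𝟙-no (x ≟ₚ g₂) ≢g₂) refl
          where
          kept : F 𝓖 x → F 𝓕 x
          kept (inj₁ (f , _))      = f
          kept (inj₂ (inj₁ x≡g₁)) = contradiction x≡g₁ ≢g₁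
          kept (inj₂ (inj₂ x≡g₂)) = contradiction x≡g₂ ≢g₂

    private
      points : Profile n → Profile n → (Profile n → ℚ) → Profile n → ℚ
      points a b G x = G x ℚ.* 𝟙 (x ≟ₚ a) ℚ.+ G x ℚ.* 𝟙 (x ≟ₚ b)

      Σ-points : ∀ a b G → Σ (points a b G) ≡ G a ℚ.+ G b
      Σ-points a b G = trans (Σ-+ (λ x → G x ℚ.* 𝟙 (x ≟ₚ a)) (λ x → G x ℚ.* 𝟙 (x ≟ₚ b)))
        (cong₂ ℚ._+_ (Σ-point G a) (Σ-point G b))

    Σ-trade : ∀ i (G : Profile n → ℚ) → (∀ x y → lookup x i ≡ lookup y i → # x ≡ # y → G x ≡ G y) →
      Σ (points f₁ f₂ G) ≡ Σ (points g₁ g₂ G)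
    Σ-trade i G local = trans (Σ-points f₁ f₂ G) (trans (go (balanced i)) (sym (Σ-points g₁ g₂ G)))
      where
      go : _ → G f₁ ℚ.+ G f₂ ≡ G g₁ ℚ.+ G g₂
      go (inj₁ (e , e′)) = cong₂ ℚ._+_ (local f₁ g₁ e (trans (F⇒# 𝓕 f₁∈𝓕) (sym #g₁))) (local f₂ g₂ e′ (trans (F⇒# 𝓕 f₂∈𝓕) (sym #g₂)))
      go (inj₂ (e , e′)) = trans
        (cong₂ ℚ._+_ (local f₁ g₂ e (trans (F⇒# 𝓕 f₁∈𝓕) (sym #g₂))) (local f₂ g₁ e′ (trans (F⇒# 𝓕 f₂∈𝓕) (sym #g₁))))
        (ℚ.+-comm (G g₂) (G g₁))

    -- The outcome changes only at the four exchanged sets and at their negations. `Σ-trade`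
    -- balances the former with the kernel `K` and the latter with `K ∘ neg`. The same correction is
    -- added to both sides and cancelled at the end.
    infl-trade : ∀ c i → infl (Φ 𝓖) c i ≡ infl (Φ 𝓕) c i
    infl-trade c i = begin
      infl (Φ 𝓖) c i                    ≡⟨ infl-kernel (Φ 𝓖) (Φ-monotone 𝓖) c i ⟩
      Σ (λ x → K x ℚ.* φ (Φ 𝓖 x))       ≡⟨ ∙-cancelʳ _ _ _ (begin
        Σ (λ x → K x ℚ.* φ (Φ 𝓖 x)) ℚ.+ (Σ (points f₁ f₂ K) ℚ.+ Σ (points g₁ g₂ (K ∘ neg)))
          ≡⟨ regroup (λ x → K x ℚ.* φ (Φ 𝓖 x)) (points f₁ f₂ K) (points g₁ g₂ (K ∘ neg)) ⟩
        Σ (λ x → K x ℚ.* φ (Φ 𝓖 x) ℚ.+ (points f₁ f₂ K x ℚ.+ points g₁ g₂ (K ∘ neg) (neg x)))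
          ≡⟨ Σ-cong pointwise ⟩
        Σ (λ x → K x ℚ.* φ (Φ 𝓕 x) ℚ.+ (points g₁ g₂ K x ℚ.+ points f₁ f₂ (K ∘ neg) (neg x)))
          ≡⟨ regroup (λ x → K x ℚ.* φ (Φ 𝓕 x)) (points g₁ g₂ K) (points f₁ f₂ (K ∘ neg)) ⟨
        Σ (λ x → K x ℚ.* φ (Φ 𝓕 x)) ℚ.+ (Σ (points g₁ g₂ K) ℚ.+ Σ (points f₁ f₂ (K ∘ neg)))
          ≡⟨ cong (Σ (λ x → K x ℚ.* φ (Φ 𝓕 x)) ℚ.+_) (cong₂ ℚ._+_
               (sym (Σ-trade i K (kernel-# c i)))
               (Σ-trade i (K ∘ neg) λ x y e k → kernel-# c i (neg x) (neg y) (lookup-neg x y e) (#-neg-cong x y k))) ⟩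
        Σ (λ x → K x ℚ.* φ (Φ 𝓕 x)) ℚ.+ (Σ (points f₁ f₂ K) ℚ.+ Σ (points g₁ g₂ (K ∘ neg)))  ∎) ⟩
      Σ (λ x → K x ℚ.* φ (Φ 𝓕 x))       ≡⟨ infl-kernel (Φ 𝓕) (Φ-monotone 𝓕) c i ⟨
      infl (Φ 𝓕) c i                    ∎
      where
      open ≡-Reasoning
      K = kernel c i

      lookup-neg : ∀ x y → lookup x i ≡ lookup y i → lookup (neg x) i ≡ lookup (neg y) i
      lookup-neg x y e = trans (Vec.lookup-map i opposite x) (trans (cong opposite e) (sym (Vec.lookup-map i opposite y)))

      regroup : ∀ (f g g′ : Profile n → ℚ) → Σ f ℚ.+ (Σ g ℚ.+ Σ g′) ≡ Σ (λ x → f x ℚ.+ (g x ℚ.+ g′ (neg x)))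
      regroup f g g′ = sym (trans (Σ-+ f (λ x → g x ℚ.+ g′ (neg x)))
        (cong (Σ f ℚ.+_) (trans (Σ-+ g (g′ ∘ neg)) (cong (Σ g ℚ.+_) (Σ-neg g′)))))

      factor : ∀ k p a b c d →
        k ℚ.* p ℚ.+ ((k ℚ.* a ℚ.+ k ℚ.* b) ℚ.+ (k ℚ.* c ℚ.+ k ℚ.* d)) ≡ k ℚ.* (p ℚ.+ ((a ℚ.+ b) ℚ.+ (c ℚ.+ d)))
      factor = solve 6 (λ k p a b c d →
        k :* p :+ ((k :* a :+ k :* b) :+ (k :* c :+ k :* d)) := k :* (p :+ ((a :+ b) :+ (c :+ d)))) refl

      -- Here `e` is the outcome of the reference rule, which drops out. `G`, `F`, `f`, `g` are
      -- indicator values at `x`, and the superscript minus marks their values at `neg x`.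
      cancel : ∀ p p′ e G G⁻ F F⁻ f f⁻ g g⁻ → p ℚ.+ G⁻ ≡ e ℚ.+ G → p′ ℚ.+ F⁻ ≡ e ℚ.+ F →
        G ℚ.+ f ≡ F ℚ.+ g → G⁻ ℚ.+ f⁻ ≡ F⁻ ℚ.+ g⁻ → p ℚ.+ (f ℚ.+ g⁻) ≡ p′ ℚ.+ (g ℚ.+ f⁻)
      cancel p p′ e G G⁻ F F⁻ f f⁻ g g⁻ h₁ h₂ h₃ h₄ = ∙-cancelʳ (G⁻ ℚ.+ F⁻) _ _ (begin
        p ℚ.+ (f ℚ.+ g⁻) ℚ.+ (G⁻ ℚ.+ F⁻)      ≡⟨ solve 5 (λ p f g⁻ G⁻ F⁻ → p :+ (f :+ g⁻) :+ (G⁻ :+ F⁻) := (p :+ G⁻) :+ f :+ (F⁻ :+ g⁻)) refl p f g⁻ G⁻ F⁻ ⟩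
        (p ℚ.+ G⁻) ℚ.+ f ℚ.+ (F⁻ ℚ.+ g⁻)      ≡⟨ cong₂ (λ a b → a ℚ.+ f ℚ.+ b) h₁ (sym h₄) ⟩
        (e ℚ.+ G) ℚ.+ f ℚ.+ (G⁻ ℚ.+ f⁻)       ≡⟨ cong (ℚ._+ (G⁻ ℚ.+ f⁻)) (ℚ.+-assoc e G f) ⟩
        e ℚ.+ (G ℚ.+ f) ℚ.+ (G⁻ ℚ.+ f⁻)       ≡⟨ cong (λ a → e ℚ.+ a ℚ.+ (G⁻ ℚ.+ f⁻)) h₃ ⟩
        e ℚ.+ (F ℚ.+ g) ℚ.+ (G⁻ ℚ.+ f⁻)       ≡⟨ cong (ℚ._+ (G⁻ ℚ.+ f⁻)) (ℚ.+-assoc e F g) ⟨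
        (e ℚ.+ F) ℚ.+ g ℚ.+ (G⁻ ℚ.+ f⁻)       ≡⟨ cong (λ a → a ℚ.+ g ℚ.+ (G⁻ ℚ.+ f⁻)) h₂ ⟨
        (p′ ℚ.+ F⁻) ℚ.+ g ℚ.+ (G⁻ ℚ.+ f⁻)     ≡⟨ solve 5 (λ p F⁻ g G⁻ f⁻ → (p :+ F⁻) :+ g :+ (G⁻ :+ f⁻) := p :+ (g :+ f⁻) :+ (G⁻ :+ F⁻)) refl p′ F⁻ g G⁻ f⁻ ⟩
        p′ ℚ.+ (g ℚ.+ f⁻) ℚ.+ (G⁻ ℚ.+ F⁻)     ∎)

      spread : ∀ Ψ a a′ b b′ x →
        K x ℚ.* Ψ ℚ.+ (points a a′ K x ℚ.+ points b b′ (K ∘ neg) (neg x)) ≡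
        K x ℚ.* (Ψ ℚ.+ ((𝟙 (x ≟ₚ a) ℚ.+ 𝟙 (x ≟ₚ a′)) ℚ.+ (𝟙 (neg x ≟ₚ b) ℚ.+ 𝟙 (neg x ≟ₚ b′))))
      spread Ψ a a′ b b′ x = trans
        (cong (λ k → K x ℚ.* Ψ ℚ.+ (points a a′ K x ℚ.+ (k ℚ.* 𝟙 (neg x ≟ₚ b) ℚ.+ k ℚ.* 𝟙 (neg x ≟ₚ b′))))
          (cong K (neg-involutive x)))
        (factor (K x) Ψ (𝟙 (x ≟ₚ a)) (𝟙 (x ≟ₚ a′)) (𝟙 (neg x ≟ₚ b)) (𝟙 (neg x ≟ₚ b′)))

      pointwise : ∀ x →
        K x ℚ.* φ (Φ 𝓖 x) ℚ.+ (points f₁ f₂ K x ℚ.+ points g₁ g₂ (K ∘ neg) (neg x)) ≡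
        K x ℚ.* φ (Φ 𝓕 x) ℚ.+ (points g₁ g₂ K x ℚ.+ points f₁ f₂ (K ∘ neg) (neg x))
      pointwise x = trans (spread (φ (Φ 𝓖 x)) f₁ f₂ g₁ g₂ x) (trans
        (cong (K x ℚ.*_) (cancel (φ (Φ 𝓖 x)) (φ (Φ 𝓕 x)) (φ (Φ ∅ x)) _ _ _ _ _ _ _ _
          (φ-family 𝓖 x) (φ-family 𝓕 x) (trade x) (trade (neg x))))
        (sym (spread (φ (Φ 𝓕 x)) g₁ g₂ f₁ f₂ x)))

-- Translates of a difference cover

-- Pigeonhole: `length L + 1` distinct values cannot all occur in `L`.
avoid : (f : ℕ → ℕ) → (∀ {i j} → f i ≡ f j → i ≡ j) → ∀ L → ∃ λ j → j ≤ length L × f j ∉ L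
avoid f f-injective L with Fin.any? {n = suc (length L)} (λ j → ¬? (f (toℕ j) ListDec.∈? L))
... | yes (j , ∉L) = toℕ j , ℕ.s≤s⁻¹ (Fin.toℕ<n j) , ∉L
... | no none = contradiction (Fin.toℕ-injective (f-injective fi≡fj)) (Fin.<⇒≢ i<j)
  where
  ∈L : ∀ j → f (toℕ j) ∈ L
  ∈L j = decidable-stable (f (toℕ j) ListDec.∈? L) (λ ∉L → none (j , ∉L))
  collision = Fin.pigeonhole (ℕ.n<1+n (length L)) (λ j → Any.index (∈L j))
  i = proj₁ collision
  j = proj₁ (proj₂ collision)
  i<j = proj₁ (proj₂ (proj₂ collision))
  fi≡fj : f (toℕ i) ≡ f (toℕ j)
  fi≡fj = trans (Any.lookup-index (∈L i))
    (trans (cong (List.lookup L) (proj₂ (proj₂ (proj₂ collision)))) (sym (Any.lookup-index (∈L j))))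

%-absorbˡ : ∀ x y n .{{_ : NonZero n}} → (x % n + y) % n ≡ (x + y) % n
%-absorbˡ x y n = trans (%-distribˡ-+ (x % n) y n)
  (trans (cong (λ z → (z + y % n) % n) (m%n%n≡m%n x n)) (sym (%-distribˡ-+ x y n)))

∤-between : ∀ {a k m} → 0 < k → k < a → a ∣ m → ¬ a ∣ m + k
∤-between 0<k k<a a∣m a∣m+k = >⇒∤ {{ℕ.>-nonZero 0<k}} k<a (∣m+n∣m⇒∣n a∣m+k a∣m)

∣x+d-unique : ∀ {a d x y} → a ∣ x + d → a ∣ y + d → x < a → y < a → x ≡ y
∣x+d-unique {a} {d} a∣x+d a∣y+d x<a y<a = ℕ.≤-antisym (≯ a∣y+d a∣x+d x<a) (≯ a∣x+d a∣y+d y<a)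
  where
  ≯ : ∀ {x y} → a ∣ x + d → a ∣ y + d → y < a → y ≤ x
  ≯ {x} {y} a∣x+d a∣y+d y<a = ℕ.≮⇒≥ λ x<y → ∤-between
    (ℕ.m<n⇒0<n∸m x<y) (ℕ.≤-<-trans (ℕ.m∸n≤m y x) y<a) a∣x+d
    (subst (a ∣_) (trans (cong (_+ d) (sym (ℕ.m+[n∸m]≡n (ℕ.<⇒≤ x<y)))) (shift x (y ∸ x) d)) a∣y+d)
    where
    shift : ∀ x k d → x + k + d ≡ x + d + k
    shift = solve-∀

-- A difference cover of the integers modulo 2h + 1, of size 2a ≈ 2√h.
module Cover (h a : ℕ) (h<aa : h < a * a) (room : 6 + a * a ≤ suc (h + h)) (6≤a : 6 ≤ a) where

  n w : ℕ
  n = suc (h + h)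
  w = a * a

  instance
    a-nonZero : NonZero a
    a-nonZero = ℕ.>-nonZero (ℕ.<-≤-trans (s≤s z≤n) 6≤a)

  open ℕ.≤-Reasoning

  w<n : w < n
  w<n = ℕ.≤-trans (ℕ.m≤n+m (suc w) 5) room

  a≤w : a ≤ w
  a≤w = ℕ.m≤m*n a a

  S : ℕ → Set
  S x = x < a ⊎ (a ∣ x × x ≤ w)

  S? : Decidable S
  S? x = (x <? a) ⊎-dec ((a ∣? x) ×-dec (x ≤? w))

  S⇒≤w : ∀ {x} → S x → x ≤ w
  S⇒≤w (inj₁ x<a)       = ℕ.≤-trans (ℕ.<⇒≤ x<a) a≤w
  S⇒≤w (inj₂ (_ , x≤w)) = x≤w

  ∉S : ∀ {x} → a ≤ x → ¬ a ∣ x → ¬ S x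
  ∉S a≤x ∤x (inj₁ x<a)     = ℕ.<⇒≱ x<a a≤x
  ∉S a≤x ∤x (inj₂ (∣x , _)) = ∤x ∣x

  -- Round `d` up to the next larger multiple of `a`. The distance to it is less than `a`, hence in
  -- the interval, or equals `a` when `a` divides `d`, and then it is itself a multiple. The
  -- multiple is at most `w` because `d ≤ h < a * a`.
  small-difference : ∀ {d} → d ≤ h → ∃ λ x → x + d ≤ w × S x × S (x + d)
  small-difference {d} d≤h = x , x+d≤w , Sx , inj₂ (subst (a ∣_) (sym x+d≡) (n∣m*n (suc (d ℕ./ a))) , x+d≤w)
    where
    x = a ∸ d % a
    x+d≡ : x + d ≡ suc (d ℕ./ a) * a
    x+d≡ = begin-equality
      x + d                          ≡⟨ cong (λ z → x + z) (m≡m%n+[m/n]*n d a) ⟩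
      x + (d % a + d ℕ./ a * a)        ≡⟨ ℕ.+-assoc x (d % a) (d ℕ./ a * a) ⟨
      x + d % a + d ℕ./ a * a          ≡⟨ cong (_+ d ℕ./ a * a) (ℕ.m∸n+n≡m (ℕ.<⇒≤ (m%n<n d a))) ⟩
      suc (d ℕ./ a) * a                ∎
    x+d≤w : x + d ≤ w
    x+d≤w = subst (_≤ w) (sym x+d≡) (ℕ.*-monoˡ-≤ a {suc (d ℕ./ a)} {a} (m<n*o⇒m/o<n (ℕ.≤-<-trans d≤h h<aa)))
    Sx : S x
    Sx with ℕ.m≤n⇒m<n∨m≡n (ℕ.m∸n≤m a (d % a))
    ... | inj₁ x<a = inj₁ x<a
    ... | inj₂ x≡a = inj₂ (subst (a ∣_) (sym x≡a) ∣-refl , subst (_≤ w) (sym x≡a) a≤w)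

  -- One of `d` and `n ∸ d` is at most `h`; in the second case the pair found for `n ∸ d` is read in
  -- the opposite order.
  difference : ∀ {d} → d < n → ∃ λ x → x < n × S x × S ((x + d) % n)
  difference {d} d<n with d ≤? h
  ... | yes d≤h with x , x+d≤w , Sx , Sx+d ← small-difference d≤h =
        x , ℕ.≤-<-trans (S⇒≤w Sx) w<n , Sx , subst S (sym (m<n⇒m%n≡m (ℕ.≤-<-trans x+d≤w w<n))) Sx+d
  ... | no d≰h with y , y+e≤w , Sy , Sy+e ← small-difference {n ∸ d} (ℕ.+-cancelˡ-≤ d _ _ (begin
        d + (n ∸ d)    ≡⟨ ℕ.m+[n∸m]≡n (ℕ.<⇒≤ d<n) ⟩
        suc h + h      ≤⟨ ℕ.+-monoˡ-≤ h (ℕ.≰⇒> d≰h) ⟩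
        d + h          ∎)) =
        y + (n ∸ d) , ℕ.≤-<-trans y+e≤w w<n , Sy+e , subst S (sym (wrap y Sy)) Sy
    where
    wrap : ∀ y → S y → (y + (n ∸ d) + d) % n ≡ y
    wrap y Sy = trans (cong (_% n) (trans (ℕ.+-assoc y (n ∸ d) d) (cong (λ z → y + z) (ℕ.m∸n+n≡m (ℕ.<⇒≤ d<n)))))
      (trans ([m+n]%n≡m%n y n) (m<n⇒m%n≡m (ℕ.≤-<-trans (S⇒≤w Sy) w<n)))

  private
    Separated : ℕ → List ℕ → Set
    Separated d L = ∃ λ x → x < n × S x × ¬ S ((x + d) % n) × x ∉ L

    -- The candidates `2a`, ..., `5a` outnumber three forbidden values. Starting at `2a` leaves room
    -- to shift down by less than `a` without entering the interval; stopping at `5a` leaves room to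
    -- shift up by less than `a` within `w`, since `6 ≤ a`.
    multiple : ∀ L → ∃ λ j → j ≤ length L × (2 + j) * a ∉ L
    multiple = avoid (λ j → (2 + j) * a) (λ {i} {j} e → ℕ.+-cancelˡ-≡ 2 i j (ℕ.*-cancelʳ-≡ (2 + i) (2 + j) a e))

    multiple≤w : ∀ {j} → j ≤ 3 → (2 + j) * a ≤ w
    multiple≤w j≤3 = ℕ.*-monoˡ-≤ a (ℕ.≤-trans (ℕ.+-monoʳ-≤ 2 j≤3) (ℕ.≤-trans (ℕ.n≤1+n 5) 6≤a))

    separate-above : ∀ {d} → 0 < d → d < a → ∀ L → length L ≤ 3 → Separated d L
    separate-above {d} 0<d d<a L len with j , j≤len , ∉L ← multiple L =
      x , ℕ.≤-<-trans (multiple≤w j≤3) w<n , inj₂ (n∣m*n (2 + j) , multiple≤w j≤3) ,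
      subst (λ y → ¬ S y) (sym (m<n⇒m%n≡m (ℕ.<-trans x+d<w w<n)))
        (∉S (ℕ.≤-trans (ℕ.m≤n*m a (2 + j)) (ℕ.m≤m+n x d)) (∤-between 0<d d<a (n∣m*n (2 + j)))) ,
      ∉L
      where
      x = (2 + j) * a
      j≤3 = ℕ.≤-trans j≤len len
      x+d<w : x + d < w
      x+d<w = begin-strict
        x + d            <⟨ ℕ.+-monoʳ-< x d<a ⟩
        x + a            ≡⟨ ℕ.+-comm x a ⟩
        (3 + j) * a      ≤⟨ ℕ.*-monoˡ-≤ a (ℕ.+-monoʳ-≤ 3 j≤3) ⟩
        6 * a            ≤⟨ ℕ.*-monoˡ-≤ a 6≤a ⟩
        w                ∎

    -- Modulo `n` the shift by `d` is a shift down by `e`, where `1 ≤ e ≤ 4 < a`. It takes a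
    -- multiple of `a` from `2a` on to a nonmultiple that is still at least `a`.
    separate-below : ∀ {d} → d < n → n ≤ 4 + d → ∀ L → length L ≤ 3 → Separated d L
    separate-below {d} d<n n≤4+d L len with j , j≤len , ∉L ← multiple L =
      x j , ℕ.≤-<-trans (multiple≤w (j≤3 j≤len)) w<n , inj₂ (n∣m*n (2 + j) , multiple≤w (j≤3 j≤len)) ,
      subst (λ y → ¬ S y) (sym (x+d≡y j (j≤3 j≤len))) (∉S (a≤y j) λ ∣y →
        ∤-between (ℕ.m<n⇒0<n∸m d<n) e<a ∣y (subst (a ∣_) (sym (y+e≡x j)) (n∣m*n (2 + j)))) ,
      ∉L
      where
      e = n ∸ d
      x y : ℕ → ℕ
      x j = (2 + j) * a
      y j = x j ∸ e
      j≤3 : ∀ {j} → j ≤ length L → j ≤ 3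
      j≤3 j≤len = ℕ.≤-trans j≤len len
      e<a : e < a
      e<a = ℕ.≤-trans (s≤s (ℕ.m≤n+o⇒m∸n≤o n d (ℕ.≤-trans n≤4+d (ℕ.≤-reflexive (ℕ.+-comm 4 d)))))
        (ℕ.≤-trans (ℕ.n≤1+n 5) 6≤a)
      y+e≡x : ∀ j → y j + e ≡ x j
      y+e≡x j = ℕ.m∸n+n≡m (ℕ.≤-trans (ℕ.<⇒≤ e<a) (ℕ.m≤n*m a (2 + j)))
      a≤y : ∀ j → a ≤ y j
      a≤y j = ℕ.+-cancelʳ-≤ e a (y j) (begin
        a + e            ≤⟨ ℕ.+-monoʳ-≤ a (ℕ.<⇒≤ e<a) ⟩
        a + a            ≤⟨ ℕ.m≤m+n (a + a) (j * a) ⟩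
        a + a + j * a    ≡⟨ ℕ.+-assoc a a (j * a) ⟩
        x j              ≡⟨ y+e≡x j ⟨
        y j + e          ∎)
      x+d≡y : ∀ j → j ≤ 3 → (x j + d) % n ≡ y j
      x+d≡y j j≤3 = begin-equality
        (x j + d) % n          ≡⟨ cong (λ z → (z + d) % n) (y+e≡x j) ⟨
        (y j + e + d) % n      ≡⟨ cong (_% n) (ℕ.+-assoc (y j) e d) ⟩
        (y j + (e + d)) % n    ≡⟨ cong (λ z → (y j + z) % n) (ℕ.m∸n+n≡m (ℕ.<⇒≤ d<n)) ⟩
        (y j + n) % n          ≡⟨ [m+n]%n≡m%n (y j) n ⟩
        y j % n                ≡⟨ m<n⇒m%n≡m (ℕ.≤-<-trans (ℕ.≤-trans (ℕ.m∸n≤m (x j) e) (multiple≤w j≤3)) w<n) ⟩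
        y j                    ∎

    4<a : ∀ {x} → x ≤ 4 → x < a
    4<a x≤4 = ℕ.≤-trans (s≤s x≤4) (ℕ.≤-trans (ℕ.n≤1+n 5) 6≤a)

    -- The candidates are 0, ..., 4 from the interval. Their shifts lie beyond the interval and do
    -- not wrap around, so only a multiple of `a` can be harmful, and it comes from `b` alone. Five
    -- candidates survive three forbidden values and `b`.
    avoiding : ∀ {d} → a ≤ d → 4 + d < n → ∀ L → length L ≤ 3 → ∀ b → (∀ {x} → x ≤ 4 → a ∣ x + d → x ≡ b) → Separated d L
    avoiding {d} a≤d 4+d<n L len b unique with x , x≤len , ∉L ← avoid (λ x → x) (λ e → e) (b ∷ L) =
      x , ℕ.<-trans (4<a (x≤4 x≤len)) (ℕ.≤-<-trans a≤w w<n) , inj₁ (4<a (x≤4 x≤len)) ,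
      subst (λ y → ¬ S y) (sym (m<n⇒m%n≡m (ℕ.≤-<-trans (ℕ.+-monoˡ-≤ d (x≤4 x≤len)) 4+d<n)))
        (∉S (ℕ.≤-trans a≤d (ℕ.m≤n+m d x)) (λ ∣x+d → ∉L (here (unique (x≤4 x≤len) ∣x+d)))) ,
      ∉L ∘ there
      where
      x≤4 : ∀ {x} → x ≤ length (b ∷ L) → x ≤ 4
      x≤4 x≤len = ℕ.≤-trans x≤len (s≤s len)

    separate-far : ∀ {d} → a ≤ d → 4 + d < n → ∀ L → length L ≤ 3 → Separated d L
    separate-far {d} a≤d 4+d<n L len with Fin.any? {n = 5} (λ x → a ∣? toℕ x + d)
    ... | yes (b , ∣b+d) = avoiding a≤d 4+d<n L len (toℕ b) λ x≤4 ∣x+d →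
            ∣x+d-unique ∣x+d ∣b+d (4<a x≤4) (4<a (ℕ.s≤s⁻¹ (Fin.toℕ<n b)))
    -- No candidate is shifted to a multiple of `a`; 0 is a placeholder for `b`, with a vacuous
    -- condition.
    ... | no none = avoiding a≤d 4+d<n L len 0 λ x≤4 ∣x+d → contradiction
            (Fin.fromℕ< (s≤s x≤4) , subst (λ y → a ∣ y + d) (sym (Fin.toℕ-fromℕ< (s≤s x≤4))) ∣x+d) none

  -- A nontrivial translate of S misses at least four elements of S.
  separate : ∀ {d} → 0 < d → d < n → ∀ L → length L ≤ 3 →
    ∃ λ x → x < n × S x × ¬ S ((x + d) % n) × x ∉ L
  separate {d} 0<d d<n with d <? a | 4 + d <? n
  ... | yes d<a | _         = separate-above 0<d d<a
  ... | no d≮a  | yes 4+d<n = separate-far (ℕ.≮⇒≥ d≮a) 4+d<n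
  ... | no _    | no  4+d≮n = separate-below d<n (ℕ.≮⇒≥ 4+d≮n)

-- Order, rotation, permutation and size of profiles

≼-trans : ∀ {n} {x y z : Profile n} → x ≼ y → y ≼ z → x ≼ z
≼-trans = Pointwise.trans ℤ.≤-trans

≼-intro : ∀ {n} {x y : Profile n} → (∀ i → lookup x i ≡ Sign.+ → lookup y i ≡ Sign.+) → x ≼ y
≼-intro {x = []}    {[]}    h = []
≼-intro {x = b ∷ x} {c ∷ y} h = ≤ₛ-from (h zero) ∷ ≼-intro (h ∘ suc)

≼-lookup : ∀ {n} {x y : Profile n} → x ≼ y → ∀ i → lookup x i ≡ Sign.+ → lookup y i ≡ Sign.+
≼-lookup {x = Sign.+ ∷ _} {Sign.+ ∷ _} _         zero    _ = refl
≼-lookup {x = _ ∷ _}      {_ ∷ _}      (_ ∷ x≼y) (suc i) e = ≼-lookup x≼y i e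

≼-rotate : ∀ {n} {x y : Profile (suc n)} → x ≼ y ⇔ rotate x ≼ rotate y
≼-rotate {x = b ∷ x} {c ∷ y} = mk⇔ (λ { (b≤c ∷ x≼y) → to x≼y b≤c }) from
  where
  to : ∀ {m} {x y : Profile m} → x ≼ y → b ≤ₛ c → x ∷ʳ b ≼ y ∷ʳ c
  to []          b≤c = b≤c ∷ []
  to (d≤e ∷ x≼y) b≤c = d≤e ∷ to x≼y b≤c
  from : ∀ {m} {x y : Profile m} → x ∷ʳ b ≼ y ∷ʳ c → b ∷ x ≼ c ∷ y
  from {x = []}    {[]}    (b≤c ∷ []) = b≤c ∷ []
  from {x = d ∷ x} {e ∷ y} (d≤e ∷ h) with b≤c ∷ x≼y ← from {x = x} {y} h = b≤c ∷ d≤e ∷ x≼y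

rotate-injective : ∀ {n} {x y : Profile (suc n)} → rotate x ≡ rotate y → x ≡ y
rotate-injective {x = b ∷ x} {c ∷ y} e with refl , refl ← Vec.∷ʳ-injective x y e = refl

lookup-∷ʳ-inject₁ : ∀ {A : Set} {n} (x : Vec A n) b i → lookup (x ∷ʳ b) (inject₁ i) ≡ lookup x i
lookup-∷ʳ-inject₁ (c ∷ x) b zero    = refl
lookup-∷ʳ-inject₁ (c ∷ x) b (suc i) = lookup-∷ʳ-inject₁ x b i

lookup-∷ʳ-fromℕ : ∀ {A : Set} {n} (x : Vec A n) b → lookup (x ∷ʳ b) (Fin.fromℕ n) ≡ b
lookup-∷ʳ-fromℕ []      b = refl
lookup-∷ʳ-fromℕ (c ∷ x) b = lookup-∷ʳ-fromℕ x b

toℕ-mod : ∀ m n .{{_ : NonZero n}} → toℕ (m mod n) ≡ m % n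
toℕ-mod m n = Fin.toℕ-fromℕ< (m%n<n m n)

lookup-rotate : ∀ {n} (x : Profile (suc n)) i → lookup (rotate x) i ≡ lookup x (suc (toℕ i) mod suc n)
lookup-rotate {n} (b ∷ x) i with view i
... | ‵fromℕ     = trans (lookup-∷ʳ-fromℕ x b) (cong (lookup (b ∷ x)) (Fin.toℕ-injective (sym (begin
      toℕ (suc (toℕ (Fin.fromℕ n)) mod suc n)    ≡⟨ toℕ-mod (suc (toℕ (Fin.fromℕ n))) (suc n) ⟩
      suc (toℕ (Fin.fromℕ n)) % suc n            ≡⟨ cong (λ k → suc k % suc n) (Fin.toℕ-fromℕ n) ⟩
      suc n % suc n                          ≡⟨ n%n≡0 (suc n) ⟩
      0                                      ∎))))
  where open ≡-Reasoning
... | ‵inject₁ j = trans (lookup-∷ʳ-inject₁ x b j) (cong (lookup (b ∷ x)) (Fin.toℕ-injective (sym (begin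
      toℕ (suc (toℕ (inject₁ j)) mod suc n)  ≡⟨ toℕ-mod (suc (toℕ (inject₁ j))) (suc n) ⟩
      suc (toℕ (inject₁ j)) % suc n          ≡⟨ cong (λ k → suc k % suc n) (Fin.toℕ-inject₁ j) ⟩
      suc (toℕ j) % suc n                    ≡⟨ m<n⇒m%n≡m (s≤s (Fin.toℕ<n j)) ⟩
      suc (toℕ j)                            ∎))))
  where open ≡-Reasoning

#-≤-length : ∀ {n} (x : Profile n) L → (∀ i → lookup x i ≡ Sign.+ → i ∈ L) → # x ≤ length L
#-≤-length x [] h = ℕ.≤-reflexive (none x λ i e → contradiction (h i e) λ ())
  where
  none : ∀ {n} (x : Profile n) → (∀ i → ¬ lookup x i ≡ Sign.+) → # x ≡ 0
  none []           h = refl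
  none (Sign.- ∷ x) h = none x (h ∘ suc)
  none (Sign.+ ∷ x) h = contradiction refl (h zero)
#-≤-length x (j ∷ L) h with lookup x j in e
... | Sign.+ = subst (_≤ suc (length L)) (#-flip⁺ x j e) (s≤s (#-≤-length (flipAt x j) L rest))
  where
  rest : ∀ i → lookup (flipAt x j) i ≡ Sign.+ → i ∈ L
  rest i e′ with i Fin.≟ j
  ... | yes refl = contradiction (trans (sym e′) (trans (Vec.lookup∘updateAt j x) (cong opposite e))) λ ()
  ... | no i≢j with h i (trans (sym (Vec.lookup∘updateAt′ i j i≢j x)) e′)
  ...   | here i≡j  = contradiction i≡j i≢j
  ...   | there i∈L = i∈L
... | Sign.- = ℕ.m≤n⇒m≤1+n (#-≤-length x L rest)
  where
  rest : ∀ i → lookup x i ≡ Sign.+ → i ∈ L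
  rest i e′ with h i e′
  ... | here refl = contradiction (trans (sym e) e′) λ ()
  ... | there i∈L = i∈L

superset-of-size : ∀ {n} (x : Profile n) k → # x ≤ k → k ≤ n →
  ∃ λ (A : Subset n) → Subset.∣ A ∣ ≡ k × ∀ i → lookup x i ≡ Sign.+ → i Subset.∈ A
superset-of-size []           zero    _         _         = [] , refl , λ ()
superset-of-size (Sign.+ ∷ x) (suc k) (s≤s x≤k) (s≤s k≤n) with A , ∣A∣ , x⊆A ← superset-of-size x k x≤k k≤n =
  inside ∷ A , cong suc ∣A∣ , λ { zero _ → here ; (suc i) e → there (x⊆A i e) }
superset-of-size {suc n} (Sign.- ∷ x) k x≤k k≤1+n with ℕ.m≤n⇒m<n∨m≡n k≤1+n
... | inj₁ (s≤s k≤n) with A , ∣A∣ , x⊆A ← superset-of-size x k x≤k k≤n =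
  outside ∷ A , ∣A∣ , λ { (suc i) e → there (x⊆A i e) }
... | inj₂ refl with A , ∣A∣ , x⊆A ← superset-of-size x n (subst (# x ≤_) (#-neg x) (ℕ.m≤m+n (# x) _)) ℕ.≤-refl =
  inside ∷ A , cong suc ∣A∣ , λ { (suc i) e → there (x⊆A i e) }

∣∣≤# : ∀ {n} (A : Subset n) (x : Profile n) → (∀ i → i Subset.∈ A → lookup x i ≡ Sign.+) → Subset.∣ A ∣ ≤ # x
∣∣≤# []            []           h = z≤n
∣∣≤# (outside ∷ A) (Sign.- ∷ x) h = ∣∣≤# A x (λ i → h (suc i) ∘ there)
∣∣≤# (outside ∷ A) (Sign.+ ∷ x) h = ℕ.m≤n⇒m≤1+n (∣∣≤# A x (λ i → h (suc i) ∘ there))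
∣∣≤# (inside ∷ A)  (Sign.- ∷ x) h = contradiction (h zero here) λ ()
∣∣≤# (inside ∷ A)  (Sign.+ ∷ x) h = s≤s (∣∣≤# A x (λ i → h (suc i) ∘ there))

private
  ι : Sign → ℕ
  ι Sign.- = 0
  ι Sign.+ = 1

#-sum : ∀ {n} (x : Profile n) → # x ≡ ∑ℕ.sum (ι ∘ lookup x)
#-sum []           = refl
#-sum (Sign.- ∷ x) = #-sum x
#-sum (Sign.+ ∷ x) = cong suc (#-sum x)

lookup-permute : ∀ {n} (σ : Permutation′ n) x i → lookup (permute (flip σ) x) i ≡ lookup x (σ ⟨$⟩ʳ i)
lookup-permute σ x i = Vec.lookup∘tabulate (λ i → lookup x (flip σ ⟨$⟩ˡ i)) i

#-permute : ∀ {n} (σ : Permutation′ n) x → # (permute (flip σ) x) ≡ # x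
#-permute σ x = begin
  # (permute (flip σ) x)                         ≡⟨ #-sum (permute (flip σ) x) ⟩
  ∑ℕ.sum (ι ∘ lookup (permute (flip σ) x))       ≡⟨ ∑ℕ.sum-cong-≗ (λ i → cong ι (lookup-permute σ x i)) ⟩
  ∑ℕ.sum (λ i → ι (lookup x (σ ⟨$⟩ʳ i)))         ≡⟨ ∑ℕ.sum-permute (ι ∘ lookup x) σ ⟨
  ∑ℕ.sum (ι ∘ lookup x)                          ≡⟨ #-sum x ⟨
  # x                                            ∎
  where open ≡-Reasoning

sgn : ∀ {P : Set} → Dec P → Sign
sgn P? = if does P? then Sign.+ else Sign.-

sgn-yes : ∀ {P : Set} (P? : Dec P) → P → sgn P? ≡ Sign.+
sgn-yes (yes _) _ = refl
sgn-yes (no ¬p) p = contradiction p ¬p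

sgn-no : ∀ {P : Set} (P? : Dec P) → ¬ P → sgn P? ≡ Sign.-
sgn-no (yes p) ¬p = contradiction p ¬p
sgn-no (no _)  _  = refl

sgn≡+ : ∀ {P : Set} (P? : Dec P) → sgn P? ≡ Sign.+ → P
sgn≡+ (yes p) _ = p

-- Translates of sets of residues modulo 2h + 1

module Blocks (h : ℕ) where
  private
    n : ℕ
    n = suc (h + h)

  infixl 6 _⊕_

  _⊕_ : Fin n → ℕ → ℕ
  i ⊕ t = (toℕ i + t) % n

  -- The voter that has position `x` after the shift by `t`; `n ∸ t % n` represents the residue of
  -- -t.
  at : ℕ → ℕ → Fin n
  at x t = (x + (n ∸ t % n)) mod n

  private
    complement : ∀ t → (n ∸ t % n + t) % n ≡ 0
    complement t = begin
      (n ∸ t % n + t) % n          ≡⟨ cong (_% n) (ℕ.+-comm (n ∸ t % n) t) ⟩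
      (t + (n ∸ t % n)) % n        ≡⟨ %-absorbˡ t (n ∸ t % n) n ⟨
      (t % n + (n ∸ t % n)) % n    ≡⟨ cong (_% n) (ℕ.m+[n∸m]≡n (m%n≤n t n)) ⟩
      n % n                        ≡⟨ n%n≡0 n ⟩
      0                            ∎
      where open ≡-Reasoning

    %-absorbʳ : ∀ x y → (x + y % n) % n ≡ (x + y) % n
    %-absorbʳ x y = trans (cong (_% n) (ℕ.+-comm x (y % n)))
      (trans (%-absorbˡ y x n) (cong (_% n) (ℕ.+-comm y x)))

    %-+0 : ∀ x y → y % n ≡ 0 → (x + y) % n ≡ x % n
    %-+0 x y y≡0 = trans (sym (%-absorbʳ x y)) (trans (cong (λ z → (x + z) % n) y≡0) (cong (_% n) (ℕ.+-identityʳ x)))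

  toℕ% : ∀ (i : Fin n) → toℕ i % n ≡ toℕ i
  toℕ% i = m<n⇒m%n≡m (Fin.toℕ<n i)

  at-⊕-shift : ∀ x t t′ → at x t ⊕ t′ ≡ (x + (n ∸ t % n + t′) % n) % n
  at-⊕-shift x t t′ = begin
    at x t ⊕ t′                             ≡⟨ cong (λ z → (z + t′) % n) (toℕ-mod (x + (n ∸ t % n)) n) ⟩
    ((x + (n ∸ t % n)) % n + t′) % n        ≡⟨ %-absorbˡ (x + (n ∸ t % n)) t′ n ⟩
    (x + (n ∸ t % n) + t′) % n              ≡⟨ cong (_% n) (ℕ.+-assoc x (n ∸ t % n) t′) ⟩
    (x + (n ∸ t % n + t′)) % n              ≡⟨ %-absorbʳ x (n ∸ t % n + t′) ⟨
    (x + (n ∸ t % n + t′) % n) % n          ∎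
    where open ≡-Reasoning

  at-⊕ : ∀ {x} t → x < n → at x t ⊕ t ≡ x
  at-⊕ {x} t x<n = begin
    at x t ⊕ t                           ≡⟨ at-⊕-shift x t t ⟩
    (x + (n ∸ t % n + t) % n) % n        ≡⟨ cong (λ z → (x + z) % n) (complement t) ⟩
    (x + 0) % n                          ≡⟨ cong (_% n) (ℕ.+-identityʳ x) ⟩
    x % n                                ≡⟨ m<n⇒m%n≡m x<n ⟩
    x                                    ∎
    where open ≡-Reasoning

  ⊕-at : ∀ i t → at (i ⊕ t) t ≡ i
  ⊕-at i t = Fin.toℕ-injective (begin
    toℕ (at (i ⊕ t) t)                       ≡⟨ toℕ-mod (i ⊕ t + (n ∸ t % n)) n ⟩
    ((toℕ i + t) % n + (n ∸ t % n)) % n      ≡⟨ %-absorbˡ (toℕ i + t) (n ∸ t % n) n ⟩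
    (toℕ i + t + (n ∸ t % n)) % n            ≡⟨ cong (_% n) (trans (ℕ.+-assoc (toℕ i) t (n ∸ t % n))
                                                 (cong (λ z → toℕ i + z) (ℕ.+-comm t (n ∸ t % n)))) ⟩
    (toℕ i + (n ∸ t % n + t)) % n            ≡⟨ %-+0 (toℕ i) (n ∸ t % n + t) (complement t) ⟩
    toℕ i % n                                ≡⟨ toℕ% i ⟩
    toℕ i                                    ∎)
    where open ≡-Reasoning

  ⊕≡⇒≡at : ∀ i t {x} → i ⊕ t ≡ x → i ≡ at x t
  ⊕≡⇒≡at i t refl = sym (⊕-at i t)

  ⊕-zero : ∀ i → i ⊕ 0 ≡ toℕ i
  ⊕-zero i = trans (cong (_% n) (ℕ.+-identityʳ (toℕ i))) (toℕ% i)

  ⊕-suc : ∀ i {x} t → i ⊕ t ≡ x → suc x < n → i ⊕ suc t ≡ suc x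
  ⊕-suc i {x} t e 1+x<n = begin
    (toℕ i + suc t) % n            ≡⟨ cong (_% n) (trans (ℕ.+-suc (toℕ i) t) (ℕ.+-comm 1 (toℕ i + t))) ⟩
    (toℕ i + t + 1) % n            ≡⟨ %-absorbˡ (toℕ i + t) 1 n ⟨
    ((i ⊕ t) + 1) % n              ≡⟨ cong (λ z → (z + 1) % n) e ⟩
    (x + 1) % n                    ≡⟨ cong (_% n) (ℕ.+-comm x 1) ⟩
    suc x % n                      ≡⟨ m<n⇒m%n≡m 1+x<n ⟩
    suc x                          ∎
    where open ≡-Reasoning

  ⊕-pred : ∀ i {x} t → i ⊕ suc t ≡ suc x → suc x < n → i ⊕ t ≡ x
  ⊕-pred i {x} t e 1+x<n = begin
    i ⊕ t               ≡⟨ cong (_⊕ t) (trans (⊕≡⇒≡at i (suc t) e) (sym (⊕≡⇒≡at (at x t) (suc t) (⊕-suc (at x t) t (at-⊕ t x<n) 1+x<n)))) ⟩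
    at x t ⊕ t          ≡⟨ at-⊕ t x<n ⟩
    x                   ∎
    where
    open ≡-Reasoning
    x<n = ℕ.<-trans (ℕ.n<1+n x) 1+x<n

  -- The residue of t′ - t: how far the position of a fixed voter moves from the translate `t` to
  -- the translate `t′`.
  distance : ℕ → ℕ → ℕ
  distance t t′ = (n ∸ t % n + t′) % n

  0<distance : ∀ {t t′} → t < n → t′ < n → t ≢ t′ → 0 < distance t t′
  0<distance {t} {t′} t<n t′<n t≢t′ = ℕ.n≢0⇒n>0 λ d≡0 → t≢t′ (begin
    t                                    ≡⟨ m<n⇒m%n≡m t<n ⟨
    t % n                                ≡⟨ %-+0 t (n ∸ t % n + t′) d≡0 ⟨
    (t + (n ∸ t % n + t′)) % n           ≡⟨ cong (_% n) (ℕ.+-assoc t (n ∸ t % n) t′) ⟨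
    (t + (n ∸ t % n) + t′) % n           ≡⟨ cong (λ z → (t + (n ∸ z) + t′) % n) (m<n⇒m%n≡m t<n) ⟩
    (t + (n ∸ t) + t′) % n               ≡⟨ cong (λ z → (z + t′) % n) (ℕ.m+[n∸m]≡n (ℕ.<⇒≤ t<n)) ⟩
    (n + t′) % n                         ≡⟨ cong (_% n) (ℕ.+-comm n t′) ⟩
    (t′ + n) % n                         ≡⟨ [m+n]%n≡m%n t′ n ⟩
    t′ % n                               ≡⟨ m<n⇒m%n≡m t′<n ⟩
    t′                                   ∎)
    where open ≡-Reasoning

  -- block Q? t is the translate of Q by −t.
  block : {Q : ℕ → Set} → Decidable Q → ℕ → Profile n
  block Q? t = tabulate λ i → sgn (Q? (i ⊕ t))

  module _ {Q : ℕ → Set} (Q? : Decidable Q) where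

    lookup-block : ∀ t i → lookup (block Q? t) i ≡ sgn (Q? (i ⊕ t))
    lookup-block t i = Vec.lookup∘tabulate (λ i → sgn (Q? (i ⊕ t))) i

    block-∈ : ∀ t i → Q (i ⊕ t) → lookup (block Q? t) i ≡ Sign.+
    block-∈ t i q = trans (lookup-block t i) (sgn-yes (Q? (i ⊕ t)) q)

    block-∉ : ∀ t i → ¬ Q (i ⊕ t) → lookup (block Q? t) i ≡ Sign.-
    block-∉ t i ¬q = trans (lookup-block t i) (sgn-no (Q? (i ⊕ t)) ¬q)

    ∈-block : ∀ t i → lookup (block Q? t) i ≡ Sign.+ → Q (i ⊕ t)
    ∈-block t i e = sgn≡+ (Q? (i ⊕ t)) (trans (sym (lookup-block t i)) e)

    rotate-block : ∀ t → rotate (block Q? t) ≡ block Q? (suc t)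
    rotate-block t = trans (sym (Vec.tabulate∘lookup (rotate (block Q? t)))) (Vec.tabulate-cong λ i → begin
      lookup (rotate (block Q? t)) i                  ≡⟨ lookup-rotate (block Q? t) i ⟩
      lookup (block Q? t) (suc (toℕ i) mod n)         ≡⟨ lookup-block t (suc (toℕ i) mod n) ⟩
      sgn (Q? ((suc (toℕ i) mod n) ⊕ t))              ≡⟨ cong (sgn ∘ Q?) (begin
        (toℕ (suc (toℕ i) mod n) + t) % n               ≡⟨ cong (λ z → (z + t) % n) (toℕ-mod (suc (toℕ i)) n) ⟩
        (suc (toℕ i) % n + t) % n                       ≡⟨ %-absorbˡ (suc (toℕ i)) t n ⟩
        suc (toℕ i + t) % n                             ≡⟨ cong (_% n) (ℕ.+-suc (toℕ i) t) ⟨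
        i ⊕ suc t                                       ∎) ⟩
      sgn (Q? (i ⊕ suc t))                            ∎)
      where open ≡-Reasoning

    block-% : ∀ t → block Q? (t % n) ≡ block Q? t
    block-% t = Vec.tabulate-cong λ i → cong (sgn ∘ Q?) (%-absorbʳ (toℕ i) t)

    #-block : ∀ t → # (block Q? t) ≡ # (block Q? 0)
    #-block zero    = refl
    #-block (suc t) = trans (cong # (sym (rotate-block t))) (trans (#-rotate (block Q? t)) (#-block t))

    -- As `h + h` is -1 modulo `n`, adding it steps back to the previous translate.
    unrotate-block : ∀ t → rotate (block Q? (t + (h + h))) ≡ block Q? t
    unrotate-block t = begin
      rotate (block Q? (t + (h + h)))    ≡⟨ rotate-block (t + (h + h)) ⟩
      block Q? (suc (t + (h + h)))       ≡⟨ cong (block Q?) (ℕ.+-suc t (h + h)) ⟨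
      block Q? (t + n)                   ≡⟨ block-% (t + n) ⟨
      block Q? ((t + n) % n)             ≡⟨ cong (block Q?) ([m+n]%n≡m%n t n) ⟩
      block Q? (t % n)                   ≡⟨ block-% t ⟩
      block Q? t                         ∎
      where open ≡-Reasoning

    -- Shifts are natural numbers in the arithmetic but elements of `Fin n` in `C` and `𝓕`, where a
    -- finite search decides membership.
    to-Fin : ∀ {P : Profile n → Set} t → P (block Q? t) → ∃ λ (t : Fin n) → P (block Q? (toℕ t))
    to-Fin {P} t p = t mod n , subst P (sym (trans (cong (block Q?) (toℕ-mod t n)) (block-% t))) p

-- The family of marked translates and the exchange

module Construction (h a : ℕ) (h<aa : h < a * a) (room : 6 + a * a ≤ suc (h + h)) (6≤a : 6 ≤ a)
  (small : 2 + (a + a) ≤ h) where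

  open Cover h a h<aa room 6≤a
  open Blocks h

  _∪_ : (ℕ → Set) → ℕ → ℕ → Set
  (Q ∪ p) x = Q x ⊎ x ≡ p

  _∪?_ : ∀ {Q} → Decidable Q → ∀ p → Decidable (Q ∪ p)
  (Q? ∪? p) x = Q? x ⊎-dec (x ℕ.≟ p)

  #-∪ : ∀ {Q} (Q? : Decidable Q) {p} t → p < n → ¬ Q p → # (block (Q? ∪? p) t) ≡ suc (# (block Q? t))
  #-∪ {Q} Q? {p} t p<n ¬Qp = trans (cong # eq)
    (#-flip⁻ (block Q? t) (at p t) (block-∉ Q? t (at p t) (¬Qp ∘ subst Q (at-⊕ t p<n))))
    where
    eq : block (Q? ∪? p) t ≡ flipAt (block Q? t) (at p t)
    eq = trans (Vec.tabulate-cong pointwise) (Vec.tabulate∘lookup _)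
      where
      pointwise : ∀ i → sgn ((Q? ∪? p) (i ⊕ t)) ≡ lookup (flipAt (block Q? t) (at p t)) i
      pointwise i with i Fin.≟ at p t
      ... | yes refl = trans (sgn-yes ((Q? ∪? p) (at p t ⊕ t)) (inj₂ (at-⊕ t p<n)))
              (sym (trans (Vec.lookup∘updateAt (at p t) (block Q? t))
                (cong opposite (block-∉ Q? t (at p t) (¬Qp ∘ subst Q (at-⊕ t p<n))))))
      ... | no i≢ = trans (cong (if_then Sign.+ else Sign.-)
                (does-⇔ (mk⇔ (λ { (inj₁ q) → q ; (inj₂ e) → contradiction (⊕≡⇒≡at i t e) i≢ }) inj₁)
                  ((Q? ∪? p) (i ⊕ t)) (Q? (i ⊕ t))))
              (sym (trans (Vec.lookup∘updateAt′ i (at p t) i≢ (block Q? t)) (lookup-block Q? t i)))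

  T : ℕ → Profile n
  T = block S?

  -- `S` with two marks. As `w` is the largest element of `S`, marks with `1 ≤ e ≤ 5` lie beyond it,
  -- and `room` keeps them below `n`.
  Q : ℕ → ℕ → ℕ → Set
  Q e e′ = (S ∪ (e + w)) ∪ (e′ + w)

  Q? : ∀ e e′ → Decidable (Q e e′)
  Q? e e′ = (S? ∪? (e + w)) ∪? (e′ + w)

  M : ℕ → ℕ → ℕ → Profile n
  M e e′ = block (Q? e e′)

  e+w<n : ∀ {e} → e ≤ 5 → e + w < n
  e+w<n e≤5 = ℕ.≤-trans (s≤s (ℕ.+-monoˡ-≤ w e≤5)) room

  +w-injective : ∀ {e e′} → e + w ≡ e′ + w → e ≡ e′
  +w-injective {e} {e′} = ℕ.+-cancelʳ-≡ w e e′

  e+w∉S : ∀ {e} → 1 ≤ e → ¬ S (e + w)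
  e+w∉S {e} 1≤e Se = ℕ.<⇒≱ (ℕ.+-monoˡ-≤ w 1≤e) (S⇒≤w Se)

  s : ℕ
  s = 2 + # (T 0)

  #M : ∀ {e e′} t → 1 ≤ e → 1 ≤ e′ → e ≤ 5 → e′ ≤ 5 → e ≢ e′ → # (M e e′ t) ≡ s
  #M {e} {e′} t 1≤e 1≤e′ e≤5 e′≤5 e≢e′ = trans
    (#-∪ (S? ∪? (e + w)) t (e+w<n e′≤5) λ { (inj₁ Se′) → e+w∉S 1≤e′ Se′ ; (inj₂ eq) → e≢e′ (sym (+w-injective eq)) })
    (cong suc (trans (#-∪ S? t (e+w<n e≤5) (e+w∉S 1≤e)) (cong suc (#-block S? t))))

  -- The multiple 0 already lies in the interval, so only `a`, `2a`, ..., `a * a` remain to be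
  -- listed.
  #T≤ : # (T 0) ≤ a + a
  #T≤ = ℕ.≤-trans (#-≤-length (T 0) (List.map (_mod n) L) λ i e → in-list i (∈-block S? 0 i e)) (ℕ.≤-reflexive len)
    where
    L : List ℕ
    L = upTo a ++ List.map (λ j → suc j * a) (upTo a)
    len : length (List.map (_mod n) L) ≡ a + a
    len = trans (List.length-map (_mod n) L) (trans (List.length-++ (upTo a))
      (cong₂ _+_ (List.length-upTo a) (trans (List.length-map (λ j → suc j * a) (upTo a)) (List.length-upTo a))))
    S⇒∈L : ∀ {y} → S y → y ∈ L
    S⇒∈L (inj₁ y<a)                        = ∈-++⁺ˡ (∈-upTo⁺ y<a)
    S⇒∈L (inj₂ (divides zero refl , _))    = ∈-++⁺ˡ (∈-upTo⁺ (ℕ.<-≤-trans (s≤s z≤n) 6≤a))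
    S⇒∈L (inj₂ (divides (suc j) refl , y≤w)) =
      ∈-++⁺ʳ (upTo a) (∈-map⁺ (λ j → suc j * a) (∈-upTo⁺ (ℕ.*-cancelʳ-≤ (suc j) a a y≤w)))
    in-list : ∀ i → S (i ⊕ 0) → i ∈ List.map (_mod n) L
    in-list i Si = subst (_∈ List.map (_mod n) L)
      (Fin.toℕ-injective (trans (toℕ-mod (i ⊕ 0) n) (trans (cong (_% n) (⊕-zero i)) (toℕ% i))))
      (∈-map⁺ (_mod n) (S⇒∈L Si))

  s≤h : s ≤ h
  s≤h = ℕ.≤-trans (ℕ.+-monoʳ-≤ 2 #T≤) small

  C : Pred (Profile n) 0ℓ
  C x = ∃ λ (t : Fin n) → T (toℕ t) ≼ x

  C? : Decidable C
  C? x = Fin.any? λ t → Pointwise.decidable (λ b c → (b ◃ 1) ℤ.≤? (c ◃ 1)) (T (toℕ t)) x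

  C-mono : ∀ {x y} → x ≼ y → C x → C y
  C-mono x≼y (t , T≼x) = t , ≼-trans T≼x x≼y

  C-intro : ∀ {x} t → T t ≼ x → C x
  C-intro {x} t = to-Fin S? {_≼ x} t

  -- The distance of the two translates is a difference of `S`; this yields a voter in both, who
  -- would have to vote `+` in `x` and in `neg x`.
  C-disjoint : ∀ {x} → C x → ¬ C (neg x)
  C-disjoint {x} (t , T≼x) (t′ , T′≼-x) with difference (m%n<n (n ∸ toℕ t % n + toℕ t′) n)
  ... | p , p<n , Sp , Sp+d = contradiction
        (trans (sym (≼-lookup T′≼-x i (block-∈ S? (toℕ t′) i (subst S (sym (at-⊕-shift p (toℕ t) (toℕ t′))) Sp+d))))
          (trans (Vec.lookup-map i opposite x)
            (cong opposite (≼-lookup T≼x i (block-∈ S? (toℕ t) i (subst S (sym (at-⊕ (toℕ t) p<n)) Sp))))))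
        λ ()
    where
    i = at p (toℕ t)

  C-rotate : ∀ x → C (rotate x) ⇔ C x
  C-rotate x = mk⇔
    (λ (t , T≼) → C-intro (toℕ t + (h + h))
      (Equivalence.from ≼-rotate (subst (_≼ rotate x) (sym (unrotate-block S? (toℕ t))) T≼)))
    (λ (t , T≼) → C-intro (suc (toℕ t))
      (subst (_≼ rotate x) (rotate-block S? (toℕ t)) (Equivalence.to ≼-rotate T≼)))

  C-M : ∀ e e′ t → C (M e e′ t)
  C-M e e′ t = C-intro t (≼-intro λ i e₊ → block-∈ (Q? e e′) t i (inj₁ (inj₁ (∈-block S? t i e₊))))

  open Rules h s s≤h C C? C-mono C-disjoint
  open Family

  -- In each translate the marks 1, 4 and 2, 5 have nothing in common. The exchange turns 2, 5 into
  -- 1, 5 in translate 0 and into 3, 5 in translate 1, and only 1, 5 shares a mark with 1, 4.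
  𝓕 : Family
  𝓕 = record
    { F   = λ x → ∃ λ (t : Fin n) → x ≡ M 1 4 (toℕ t) ⊎ x ≡ M 2 5 (toℕ t)
    ; F?  = λ x → Fin.any? λ t → (x ≟ₚ M 1 4 (toℕ t)) ⊎-dec (x ≟ₚ M 2 5 (toℕ t))
    ; F⇒# = λ { (t , inj₁ refl) → #M (toℕ t) (s≤s z≤n) (s≤s z≤n) (ℕ.≤ᵇ⇒≤ 1 5 _) (ℕ.≤ᵇ⇒≤ 4 5 _) λ ()
              ; (t , inj₂ refl) → #M (toℕ t) (s≤s z≤n) (s≤s z≤n) (ℕ.≤ᵇ⇒≤ 2 5 _) (ℕ.≤ᵇ⇒≤ 5 5 _) λ () }
    ; F⇒C = λ { (t , inj₁ refl) → C-M 1 4 (toℕ t) ; (t , inj₂ refl) → C-M 2 5 (toℕ t) }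
    }

  M₁₄∈𝓕 : ∀ {x} t → x ≡ M 1 4 t → F 𝓕 x
  M₁₄∈𝓕 {x} t e with t′ , e′ ← to-Fin (Q? 1 4) {x ≡_} t e = t′ , inj₁ e′

  M₂₅∈𝓕 : ∀ {x} t → x ≡ M 2 5 t → F 𝓕 x
  M₂₅∈𝓕 {x} t e with t′ , e′ ← to-Fin (Q? 2 5) {x ≡_} t e = t′ , inj₂ e′

  𝓕-rotate : ∀ x → F 𝓕 (rotate x) ⇔ F 𝓕 x
  𝓕-rotate x = mk⇔
    (λ { (t , inj₁ e) → M₁₄∈𝓕 (toℕ t + (h + h)) (rotate-injective (trans e (sym (unrotate-block (Q? 1 4) (toℕ t)))))
       ; (t , inj₂ e) → M₂₅∈𝓕 (toℕ t + (h + h)) (rotate-injective (trans e (sym (unrotate-block (Q? 2 5) (toℕ t))))) })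
    (λ { (t , inj₁ e) → M₁₄∈𝓕 (suc (toℕ t)) (trans (cong rotate e) (rotate-block (Q? 1 4) (toℕ t)))
       ; (t , inj₂ e) → M₂₅∈𝓕 (suc (toℕ t)) (trans (cong rotate e) (rotate-block (Q? 2 5) (toℕ t))) })

  -- The three values that `separate` can avoid are spent on the two marks of the second set and on
  -- the voter `v`. So members from different translates never differ by `v` alone.
  M-separate : ∀ {t t′} → t < n → t′ < n → t ≢ t′ → ∀ e₁ e₁′ {e₂ e₂′} → e₂ ≤ 5 → e₂′ ≤ 5 → ∀ v →
    ∃ λ i → i ≢ v × lookup (M e₁ e₁′ t) i ≡ Sign.+ × lookup (M e₂ e₂′ t′) i ≡ Sign.-
  M-separate {t} {t′} t<n t′<n t≢t′ e₁ e₁′ {e₂} {e₂′} e₂≤5 e₂′≤5 v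
    with separate (0<distance t<n t′<n t≢t′) (m%n<n (n ∸ t % n + t′) n)
      (at (e₂ + w) t′ ⊕ t ∷ at (e₂′ + w) t′ ⊕ t ∷ v ⊕ t ∷ []) ℕ.≤-refl
  ... | p , p<n , Sp , ¬Sp+d , p∉ = i
      , (λ i≡v → p∉ (there (there (here (trans (sym i⊕t) (cong (_⊕ t) i≡v))))))
      , block-∈ (Q? e₁ e₁′) t i (inj₁ (inj₁ (subst S (sym i⊕t) Sp)))
      , block-∉ (Q? e₂ e₂′) t′ i λ
          { (inj₁ (inj₁ Si)) → ¬Sp+d (subst S (at-⊕-shift p t t′) Si)
          ; (inj₁ (inj₂ e))  → p∉ (here (trans (sym i⊕t) (cong (_⊕ t) (⊕≡⇒≡at i t′ e))))
          ; (inj₂ e)         → p∉ (there (here (trans (sym i⊕t) (cong (_⊕ t) (⊕≡⇒≡at i t′ e))))) }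
    where
    i = at p t
    i⊕t : i ⊕ t ≡ p
    i⊕t = at-⊕ t p<n

  module _ (e e′ t : ℕ) (i : Fin n) {k : ℕ} (i⊕t≡k+w : i ⊕ t ≡ k + w) where

    M-∈ : k ≡ e ⊎ k ≡ e′ → lookup (M e e′ t) i ≡ Sign.+
    M-∈ (inj₁ refl) = block-∈ (Q? e e′) t i (inj₁ (inj₂ i⊕t≡k+w))
    M-∈ (inj₂ refl) = block-∈ (Q? e e′) t i (inj₂ i⊕t≡k+w)

    M-∉ : 1 ≤ k → k ≢ e → k ≢ e′ → lookup (M e e′ t) i ≡ Sign.-
    M-∉ 1≤k k≢e k≢e′ = block-∉ (Q? e e′) t i λ
      { (inj₁ (inj₁ Sk)) → e+w∉S 1≤k (subst S i⊕t≡k+w Sk)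
      ; (inj₁ (inj₂ eq)) → k≢e (+w-injective (trans (sym i⊕t≡k+w) eq))
      ; (inj₂ eq)        → k≢e′ (+w-injective (trans (sym i⊕t≡k+w) eq)) }

  Distinguishes : ℕ → ℕ → ℕ → ℕ → ℕ → Set
  Distinguishes k e e′ d d′ = 1 ≤ k × k ≤ 5 × (k ≡ e ⊎ k ≡ e′) × k ≢ d × k ≢ d′

  distinguishes : ∀ k e e′ d d′ {_ : True (1 ≤? k ×-dec k ≤? 5 ×-dec (k ℕ.≟ e ⊎-dec k ℕ.≟ e′) ×-dec ¬? (k ℕ.≟ d) ×-dec ¬? (k ℕ.≟ d′))} →
    Distinguishes k e e′ d d′
  distinguishes k e e′ d d′ {p} = toWitness p

  ≢-by : ∀ (x y : Profile n) i → lookup x i ≡ Sign.+ → lookup y i ≡ Sign.- → x ≢ y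
  ≢-by x y i x₊ y₋ x≡y = contradiction (trans (sym x₊) (trans (cong (λ z → lookup z i) x≡y) y₋)) λ ()

  0<n : 0 < n
  0<n = s≤s z≤n

  1<n : 1 < n
  1<n = ℕ.≤-trans (s≤s (s≤s z≤n)) (ℕ.≤-trans (ℕ.m≤m+n 6 w) room)

  M-≢ : ∀ {t t′} → t < n → t′ < n → ∀ e e′ d d′ → d ≤ 5 → d′ ≤ 5 →
    (t ≡ t′ → ∃ λ k → Distinguishes k e e′ d d′) → M e e′ t ≢ M d d′ t′
  M-≢ {t} {t′} t<n t′<n e e′ d d′ d≤5 d′≤5 mark with t ℕ.≟ t′
  ... | no t≢t′ = ≢-by (M e e′ t) (M d d′ t′)
          (proj₁ witness) (proj₁ (proj₂ (proj₂ witness))) (proj₂ (proj₂ (proj₂ witness)))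
    where
    witness = M-separate t<n t′<n t≢t′ e e′ d≤5 d′≤5 zero
  ... | yes refl with k , 1≤k , k≤5 , k∈ , k≢d , k≢d′ ← mark refl = ≢-by (M e e′ t) (M d d′ t)
          i (M-∈ e e′ t i i⊕t k∈) (M-∉ d d′ t i i⊕t 1≤k k≢d k≢d′)
    where
    i = at (k + w) t
    i⊕t = at-⊕ t (e+w<n k≤5)

  -- In terms of voters the marks are w+2, w+5 for `f₁`; w+1, w+4 for `f₂`; w+1, w+5 for `g₁`; w+2,
  -- w+4 for `g₂`. The exchange swaps the voters w+1 and w+2 between the two translates.
  f₁ f₂ g₁ g₂ : Profile n
  f₁ = M 2 5 0
  f₂ = M 2 5 1
  g₁ = M 1 5 0
  g₂ = M 3 5 1


  ≤5 : ∀ k {_ : Bool.T (k ℕ.≤ᵇ 5)} → k ≤ 5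
  ≤5 k {p} = ℕ.≤ᵇ⇒≤ k 5 p

  f₁≢f₂ : f₁ ≢ f₂
  f₁≢f₂ = M-≢ 0<n 1<n 2 5 2 5 (≤5 2) (≤5 5) λ ()

  g₁≢g₂ : g₁ ≢ g₂
  g₁≢g₂ = M-≢ 0<n 1<n 1 5 3 5 (≤5 3) (≤5 5) λ ()

  g₁∉𝓕 : ¬ F 𝓕 g₁
  g₁∉𝓕 (t , inj₁ e) = M-≢ 0<n (Fin.toℕ<n t) 1 5 1 4 (≤5 1) (≤5 4) (λ _ → 5 , distinguishes 5 1 5 1 4) e
  g₁∉𝓕 (t , inj₂ e) = M-≢ 0<n (Fin.toℕ<n t) 1 5 2 5 (≤5 2) (≤5 5) (λ _ → 1 , distinguishes 1 1 5 2 5) e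

  g₂∉𝓕 : ¬ F 𝓕 g₂
  g₂∉𝓕 (t , inj₁ e) = M-≢ 1<n (Fin.toℕ<n t) 3 5 1 4 (≤5 1) (≤5 4) (λ _ → 3 , distinguishes 3 3 5 1 4) e
  g₂∉𝓕 (t , inj₂ e) = M-≢ 1<n (Fin.toℕ<n t) 3 5 2 5 (≤5 2) (≤5 5) (λ _ → 3 , distinguishes 3 3 5 2 5) e

  private
    same : ∀ i t e d {e′} → i ⊕ t ≢ e + w → i ⊕ t ≢ d + w → lookup (M e e′ t) i ≡ lookup (M d e′ t) i
    same i t e d {e′} ≢e ≢d = trans (lookup-block (Q? e e′) t i) (trans
      (cong (if_then Sign.+ else Sign.-) (does-⇔ (mk⇔ (swap ≢e) (swap ≢d)) (Q? e e′ (i ⊕ t)) (Q? d e′ (i ⊕ t))))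
      (sym (lookup-block (Q? d e′) t i)))
      where
      swap : ∀ {e d} → i ⊕ t ≢ e + w → Q e e′ (i ⊕ t) → Q d e′ (i ⊕ t)
      swap ≢e (inj₁ (inj₁ Si)) = inj₁ (inj₁ Si)
      swap ≢e (inj₁ (inj₂ e))  = contradiction e ≢e
      swap ≢e (inj₂ e)         = inj₂ e

  -- f₁ and g₁ differ at the voters w + 1 and w + 2, which in f₂ and g₂ have positions w + 2 and w + 3.
  balanced : ∀ i → (lookup f₁ i ≡ lookup g₁ i × lookup f₂ i ≡ lookup g₂ i) ⊎
                   (lookup f₁ i ≡ lookup g₂ i × lookup f₂ i ≡ lookup g₁ i)
  balanced i with i ⊕ 0 ℕ.≟ 1 + w | i ⊕ 0 ℕ.≟ 2 + w
  ... | yes e | _ = inj₂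
        ( trans (M-∉ 2 5 0 i e (s≤s z≤n) (λ ()) λ ()) (sym (M-∉ 3 5 1 i e⁺ (s≤s z≤n) (λ ()) λ ()))
        , trans (M-∈ 2 5 1 i e⁺ (inj₁ refl)) (sym (M-∈ 1 5 0 i e (inj₁ refl))))
    where e⁺ = ⊕-suc i 0 e (e+w<n (≤5 2))
  ... | no _ | yes e = inj₂
        ( trans (M-∈ 2 5 0 i e (inj₁ refl)) (sym (M-∈ 3 5 1 i e⁺ (inj₁ refl)))
        , trans (M-∉ 2 5 1 i e⁺ (s≤s z≤n) (λ ()) λ ()) (sym (M-∉ 1 5 0 i e (s≤s z≤n) (λ ()) λ ())))
    where e⁺ = ⊕-suc i 0 e (e+w<n (≤5 3))
  ... | no ≢₁ | no ≢₂ = inj₁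
        ( same i 0 2 1 ≢₂ ≢₁
        , same i 1 2 3 (λ e → ≢₁ (⊕-pred i 0 e (e+w<n (≤5 2)))) (λ e → ≢₂ (⊕-pred i 0 e (e+w<n (≤5 3)))))

  open Trade 𝓕 f₁ f₂ g₁ g₂ (M₂₅∈𝓕 0 refl) (M₂₅∈𝓕 1 refl) f₁≢f₂ g₁∉𝓕 g₂∉𝓕 g₁≢g₂
    (#M 0 (s≤s z≤n) (s≤s z≤n) (≤5 1) (≤5 5) λ ()) (#M 1 (s≤s z≤n) (s≤s z≤n) (≤5 3) (≤5 5) λ ())
    (C-M 1 5 0) (C-M 3 5 1) balanced
  open Rule 𝓖 public

  Φ-unbiased : Unbiased Φ
  Φ-unbiased = infl-constant⇒unbiased Φ λ c i j → trans (infl-trade c i) (trans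
    (infl-rotate (Rule.Φ 𝓕) (Rule.Φ-rotate 𝓕 C-rotate 𝓕-rotate) c i j) (sym (infl-trade c j)))

  -- With exactly `s` members a superset of the translate `T 0` need not win, but with more than `s`
  -- it wins by the first clause of `W`, for either sign.
  Φ-winning : ∀ {k} → s < k → k ≤ n → HasWinningCoalitionOfSize Φ k
  Φ-winning {k} s<k k≤n with superset-of-size (T 0) k (ℕ.≤-trans (ℕ.m≤n+m (# (T 0)) 2) (ℕ.<⇒≤ s<k)) k≤n
  ... | A , ∣A∣≡k , T⊆A = A , ∣A∣≡k , winning
    where
    W-coalition : ∀ x → (∀ i → i Subset.∈ A → lookup x i ≡ Sign.+) → W x
    W-coalition x x₊ = inj₁ (C-intro 0 (≼-intro λ i e → x₊ i (T⊆A i e)) ,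
      ℕ.<-≤-trans s<k (subst (_≤ # x) ∣A∣≡k (∣∣≤# A x x₊)))
    winning : IsWinningCoalition Φ A
    winning Sign.+ x h = Φ-W (W-coalition x h)
    winning Sign.- x h = Φ-neg (W-coalition (neg x) λ i i∈A → trans (Vec.lookup-map i opposite x) (cong opposite (h i i∈A)))

  -- The members of `𝓖` by translate and marks; the inequalities in `⟨2,5⟩` record the removal of
  -- `f₁` and `f₂`.
  data Member : ℕ → ℕ → ℕ → Set where
    ⟨1,4⟩   : ∀ {t} → Member t 1 4
    ⟨2,5⟩   : ∀ {t} → t ≢ 0 → t ≢ 1 → Member t 2 5
    ⟨1,5⟩₀ : Member 0 1 5
    ⟨3,5⟩₁ : Member 1 3 5

  member : ∀ {x} → F 𝓖 x → ∃ λ t → ∃ λ e → ∃ λ e′ → t < n × Member t e e′ × x ≡ M e e′ t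
  member (inj₁ ((t , inj₁ x≡) , _))               = toℕ t , 1 , 4 , Fin.toℕ<n t , ⟨1,4⟩ , x≡
  member {x} (inj₁ ((t , inj₂ x≡) , x≢f₁ , x≢f₂)) = toℕ t , 2 , 5 , Fin.toℕ<n t ,
    ⟨2,5⟩ (λ t≡0 → x≢f₁ (trans x≡ (cong (M 2 5) t≡0))) (λ t≡1 → x≢f₂ (trans x≡ (cong (M 2 5) t≡1))) , x≡
  member (inj₂ (inj₁ x≡)) = 0 , 1 , 5 , 0<n , ⟨1,5⟩₀ , x≡
  member (inj₂ (inj₂ x≡)) = 1 , 3 , 5 , 1<n , ⟨3,5⟩₁ , x≡

  ≤5-Member : ∀ {t e e′} → Member t e e′ → e ≤ 5 × e′ ≤ 5
  ≤5-Member ⟨1,4⟩       = ≤5 1 , ≤5 4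
  ≤5-Member (⟨2,5⟩ _ _) = ≤5 2 , ≤5 5
  ≤5-Member ⟨1,5⟩₀     = ≤5 1 , ≤5 5
  ≤5-Member ⟨3,5⟩₁     = ≤5 3 , ≤5 5

  record _∖_≡[_] (x y : Profile n) (v : Fin n) : Set where
    constructor difference-is
    field
      v∈x  : lookup x v ≡ Sign.+
      v∉y  : lookup y v ≡ Sign.-
      only : ∀ i → lookup x i ≡ Sign.+ → lookup y i ≡ Sign.- → i ≡ v

  open _∖_≡[_]

  -- The only members of the family differing by one voter are M 1 4 0 and g₁ = M 1 5 0,
  -- so some voters, but not voter 0, are such a difference.
  zero-not-a-difference : ∀ {x y} → F 𝓖 x → F 𝓖 y → ¬ x ∖ y ≡[ zero ]
  zero-not-a-difference {x} {y} x∈ y∈ x∖y = go (member x∈) (member y∈)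
    where
    -- A distinguishing mark belongs to a voter in the difference, so to voter 0. Two such marks
    -- would give voter 0 two positions, and in translate 0 its position is 0, which carries no
    -- mark.
    isolated : ∀ t {e e′ d d′ k} → M e e′ t ∖ M d d′ t ≡[ zero ] → Distinguishes k e e′ d d′ → zero ⊕ t ≡ k + w
    isolated t {e} {e′} {d} {d′} {k} p (1≤k , k≤5 , k∈ , k≢d , k≢d′) =
      trans (cong (_⊕ t) (sym (only p i (M-∈ e e′ t i i⊕t k∈) (M-∉ d d′ t i i⊕t 1≤k k≢d k≢d′)))) i⊕t
      where
      i = at (k + w) t
      i⊕t = at-⊕ t (e+w<n k≤5)

    isolated-twice : ∀ t {e e′ d d′ k l} → M e e′ t ∖ M d d′ t ≡[ zero ] → k ≢ l →
      Distinguishes k e e′ d d′ → ¬ Distinguishes l e e′ d d′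
    isolated-twice t p k≢l k-distinguishes l-distinguishes =
      k≢l (+w-injective (trans (sym (isolated t p k-distinguishes)) (isolated t p l-distinguishes)))

    isolated-at-0 : ∀ {e e′ d d′ k} → M e e′ 0 ∖ M d d′ 0 ≡[ zero ] → ¬ Distinguishes k e e′ d d′
    isolated-at-0 {k = zero}  p (() , _)
    isolated-at-0 {k = suc k} p k-distinguishes = contradiction (isolated 0 p k-distinguishes) λ ()

    irreflexive : ∀ {x v} → ¬ x ∖ x ≡[ v ]
    irreflexive p = contradiction (trans (sym (v∈x p)) (v∉y p)) λ ()

    -- Distinct pairs of marks differ in two marks, except 1, 4 and 1, 5, which occur together only
    -- in translate 0.
    same-translate : ∀ {t e e′ d d′} → Member t e e′ → Member t d d′ → ¬ M e e′ t ∖ M d d′ t ≡[ zero ]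
    same-translate ⟨1,4⟩ ⟨1,4⟩ p = irreflexive p
    same-translate ⟨1,4⟩ (⟨2,5⟩ _ _) p = isolated-twice _ p (λ ()) (distinguishes 1 1 4 2 5) (distinguishes 4 1 4 2 5)
    same-translate ⟨1,4⟩ ⟨1,5⟩₀ p = isolated-at-0 p (distinguishes 4 1 4 1 5)
    same-translate ⟨1,4⟩ ⟨3,5⟩₁ p = isolated-twice _ p (λ ()) (distinguishes 1 1 4 3 5) (distinguishes 4 1 4 3 5)
    same-translate (⟨2,5⟩ _ _) ⟨1,4⟩ p = isolated-twice _ p (λ ()) (distinguishes 2 2 5 1 4) (distinguishes 5 2 5 1 4)
    same-translate (⟨2,5⟩ _ _) (⟨2,5⟩ _ _) p = irreflexive p
    same-translate (⟨2,5⟩ t≢0 _) ⟨1,5⟩₀ p = t≢0 refl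
    same-translate (⟨2,5⟩ _ t≢1) ⟨3,5⟩₁ p = t≢1 refl
    same-translate ⟨1,5⟩₀ ⟨1,4⟩ p = isolated-at-0 p (distinguishes 5 1 5 1 4)
    same-translate ⟨1,5⟩₀ (⟨2,5⟩ t≢0 _) p = t≢0 refl
    same-translate ⟨1,5⟩₀ ⟨1,5⟩₀ p = irreflexive p
    same-translate ⟨3,5⟩₁ ⟨1,4⟩ p = isolated-twice _ p (λ ()) (distinguishes 3 3 5 1 4) (distinguishes 5 3 5 1 4)
    same-translate ⟨3,5⟩₁ (⟨2,5⟩ _ t≢1) p = t≢1 refl
    same-translate ⟨3,5⟩₁ ⟨3,5⟩₁ p = irreflexive p

    members : ∀ {t e e′ t′ d d′} → Dec (t ≡ t′) → t < n → t′ < n → Member t e e′ → Member t′ d d′ →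
      ¬ M e e′ t ∖ M d d′ t′ ≡[ zero ]
    members (yes refl) _ _ m m′ p = same-translate m m′ p
    members {e = e} {e′} (no t≢t′) t<n t′<n _ m′ p =
      let i , i≢0 , i∈x , i∉y = M-separate t<n t′<n t≢t′ e e′ (proj₁ (≤5-Member m′)) (proj₂ (≤5-Member m′)) zero
      in i≢0 (only p i i∈x i∉y)

    Code : Profile n → Set
    Code x = ∃ λ t → ∃ λ e → ∃ λ e′ → t < n × Member t e e′ × x ≡ M e e′ t

    go : Code x → Code y → ⊥
    go (t , e , e′ , t<n , m , x≡) (t′ , d , d′ , t′<n , m′ , y≡) =
      members (t ℕ.≟ t′) t<n t′<n m m′ (subst₂ (_∖_≡[ zero ]) x≡ y≡ x∖y)

  M₁₄₀∈𝓖 : F 𝓖 (M 1 4 0)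
  M₁₄₀∈𝓖 = inj₁ (M₁₄∈𝓕 0 refl , ≢f₁ , ≢f₂)
    where
    ≢f₁ = M-≢ 0<n 0<n 1 4 2 5 (≤5 2) (≤5 5) (λ _ → 1 , distinguishes 1 1 4 2 5)
    ≢f₂ = M-≢ 0<n 1<n 1 4 2 5 (≤5 2) (≤5 5) λ ()

  M₁₄₀∖g₁ : M 1 4 0 ∖ g₁ ≡[ at (4 + w) 0 ]
  M₁₄₀∖g₁ = difference-is (M-∈ 1 4 0 v ⊕0 (inj₂ refl)) (M-∉ 1 5 0 v ⊕0 (s≤s z≤n) (λ ()) λ ()) unique
    where
    v = at (4 + w) 0
    ⊕0 = at-⊕ 0 (e+w<n (≤5 4))
    go : ∀ i → Q 1 4 (i ⊕ 0) → ¬ Q 1 5 (i ⊕ 0) → i ≡ at (4 + w) 0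
    go i (inj₁ q) ¬q = contradiction (inj₁ q) ¬q
    go i (inj₂ e) _  = ⊕≡⇒≡at i 0 e
    unique : ∀ i → lookup (M 1 4 0) i ≡ Sign.+ → lookup g₁ i ≡ Sign.- → i ≡ at (4 + w) 0
    unique i i₊ i₋ = go i (∈-block (Q? 1 4) 0 i i₊)
      λ q → contradiction (trans (sym (block-∈ (Q? 1 5) 0 i q)) i₋) λ ()

  -- An automorphism taking voter 0 to the voter w+4 would pull `M 1 4 0` and `g₁` back to two
  -- members whose difference is voter 0.
  Φ-not-transitive : ¬ TransitiveSymmetric Φ
  Φ-not-transitive transitive with σ , aut , σ0≡v ← transitive zero (at (4 + w) 0) =
    zero-not-a-difference (moved-∈ M₁₄₀∈𝓖) (moved-∈ (inj₂ (inj₁ refl))) (moved-∖ (M 1 4 0) g₁ M₁₄₀∖g₁)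
    where
    moved : Profile n → Profile n
    moved = permute (flip σ)
    moved-∈ : ∀ {x} → F 𝓖 x → F 𝓖 (moved x)
    moved-∈ {x} x∈ = Φ≡+∧#≤⇒F (trans (aut x) (Φ-W (inj₂ x∈)))
      (ℕ.≤-reflexive (trans (#-permute σ x) (F⇒# 𝓖 x∈)))
    σ-injective : ∀ {i j} → σ ⟨$⟩ʳ i ≡ σ ⟨$⟩ʳ j → i ≡ j
    σ-injective e = trans (sym (inverseˡ σ)) (trans (cong (σ ⟨$⟩ˡ_) e) (inverseˡ σ))
    moved-∖ : ∀ x y → x ∖ y ≡[ at (4 + w) 0 ] → moved x ∖ moved y ≡[ zero ]
    moved-∖ x y p = difference-is
      (trans (lookup-permute σ x zero) (trans (cong (lookup x) σ0≡v) (v∈x p)))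
      (trans (lookup-permute σ y zero) (trans (cong (lookup y) σ0≡v) (v∉y p)))
      λ i i₊ i₋ → σ-injective (trans (only p (σ ⟨$⟩ʳ i)
        (trans (sym (lookup-permute σ x i)) i₊) (trans (sym (lookup-permute σ y i)) i₋)) (sym σ0≡v))

-- Rounding a rational multiple of a square root

/-mono-≤ : ∀ a b j k → a * suc k ≤ b * suc j → + a / suc j ℚ.≤ + b / suc k
/-mono-≤ a b j k h = ℚ.toℚᵘ-cancel-≤
  (ℚᵘ.≤-respˡ-≃ (ℚᵘ.≃-sym (ℚ.toℚᵘ-fromℚᵘ (mkℚᵘ (+ a) j)))
  (ℚᵘ.≤-respʳ-≃ (ℚᵘ.≃-sym (ℚ.toℚᵘ-fromℚᵘ (mkℚᵘ (+ b) k)))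
  (ℚᵘ.*≤* (subst₂ ℤ._≤_ (ℤ.pos-* a (suc k)) (ℤ.pos-* b (suc j)) (ℤ.+≤+ h)))))

/-homo-+ : ∀ a b j k →
  (+ a / suc j) ℚ.+ (+ b / suc k) ≡ + (a * suc k + b * suc j) / (suc j * suc k)
/-homo-+ a b j k = ℚ.toℚᵘ-injective (begin
  ℚ.toℚᵘ ((+ a / suc j) ℚ.+ (+ b / suc k))         ≈⟨ ℚ.toℚᵘ-homo-+ (+ a / suc j) (+ b / suc k) ⟩
  ℚ.toℚᵘ (+ a / suc j) ℚᵘ.+ ℚ.toℚᵘ (+ b / suc k)   ≈⟨ ℚᵘ.+-cong (ℚ.toℚᵘ-fromℚᵘ (mkℚᵘ (+ a) j))
                                                                (ℚ.toℚᵘ-fromℚᵘ (mkℚᵘ (+ b) k)) ⟩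
  mkℚᵘ (+ a ℤ.* + suc k ℤ.+ + b ℤ.* + suc j) d     ≡⟨ cong (λ i → mkℚᵘ i d) (cong₂ ℤ._+_ (ℤ.pos-* a (suc k)) (ℤ.pos-* b (suc j))) ⟨
  mkℚᵘ (+ (a * suc k + b * suc j)) d               ≈⟨ ℚ.toℚᵘ-fromℚᵘ _ ⟨
  ℚ.toℚᵘ (+ (a * suc k + b * suc j) / (suc j * suc k)) ∎)
  where
  open ℚᵘ.≃-Reasoning
  d = k + j * suc k

/-homo-* : ∀ a b j k → (+ a / suc j) ℚ.* (+ b / suc k) ≡ + (a * b) / (suc j * suc k)
/-homo-* a b j k = ℚ.toℚᵘ-injective (begin
  ℚ.toℚᵘ ((+ a / suc j) ℚ.* (+ b / suc k))         ≈⟨ ℚ.toℚᵘ-homo-* (+ a / suc j) (+ b / suc k) ⟩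
  ℚ.toℚᵘ (+ a / suc j) ℚᵘ.* ℚ.toℚᵘ (+ b / suc k)   ≈⟨ ℚᵘ.*-cong (ℚ.toℚᵘ-fromℚᵘ (mkℚᵘ (+ a) j))
                                                                (ℚ.toℚᵘ-fromℚᵘ (mkℚᵘ (+ b) k)) ⟩
  mkℚᵘ (+ a ℤ.* + b) (k + j * suc k)               ≡⟨ cong (λ i → mkℚᵘ i (k + j * suc k)) (ℤ.pos-* a b) ⟨
  mkℚᵘ (+ (a * b)) (k + j * suc k)                 ≈⟨ ℚ.toℚᵘ-fromℚᵘ _ ⟨
  ℚ.toℚᵘ (+ (a * b) / (suc j * suc k))             ∎)
  where open ℚᵘ.≃-Reasoning

/-eventually-< : ∀ c ε → 0ℚ ℚ.< ε → ∃ λ N → ∀ j → N ≤ j → + c / suc j ℚ.< ε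
/-eventually-< c ε 0<ε with ε | ℚ.positive 0<ε
... | mkℚ +[1+ a ] d _ | _ = c * suc d , λ j N≤j → ℚ.toℚᵘ-cancel-<
  (ℚᵘ.<-respˡ-≃ (ℚᵘ.≃-sym (ℚ.toℚᵘ-fromℚᵘ (mkℚᵘ (+ c) j)))
  (ℚᵘ.*<* (subst (ℤ._< + (suc a * suc j)) (ℤ.pos-* c (suc d)) (ℤ.+<+ (begin-strict
    c * suc d        ≤⟨ N≤j ⟩
    j                <⟨ ℕ.n<1+n j ⟩
    suc j            ≤⟨ ℕ.m≤m+n (suc j) (a * suc j) ⟩
    suc a * suc j    ∎)))))
  where open ℕ.≤-Reasoning

square-cancel-< : ∀ {a b} → a * a < b * b → a < b
square-cancel-< h = ℕ.≰⇒> λ b≤a → ℕ.<⇒≱ h (ℕ.*-mono-≤ b≤a b≤a)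

square-cancel-≤ : ∀ {a b} → a * a ≤ b * b → a ≤ b
square-cancel-≤ h = ℕ.≮⇒≥ λ b<a → ℕ.<⇒≱ (ℕ.*-mono-< b<a b<a) h

module _ (p q n : ℕ) where

  private
    Q N : ℕ
    Q = suc q
    N = p * p * n

  -- The integer part of (p/Q)√n is that of the square root of p²n/Q², and rounding that quotient
  -- down first does not affect it. The argument `q` is the denominator minus one, so 1508/1000 is
  -- entered as 1508 and 999.
  ⌊p/q√⌋ : ℕ
  ⌊p/q√⌋ = isqrt (N ℕ./ (Q * Q))

  private
    k K : ℕ
    k = ⌊p/q√⌋
    K = suc k
    open ℕ.≤-Reasoning

  ⌊p/q√⌋-lower : (k * k) * (Q * Q) ≤ N
  ⌊p/q√⌋-lower = ℕ.≤-trans (ℕ.*-monoˡ-≤ (Q * Q) (isqrt-lower (N ℕ./ (Q * Q)))) (m/n*n≤m N (Q * Q))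

  ⌊p/q√⌋-upper : N < (K * K) * (Q * Q)
  ⌊p/q√⌋-upper = begin-strict
    N                                              ≡⟨ m≡m%n+[m/n]*n N (Q * Q) ⟩
    N % (Q * Q) + N ℕ./ (Q * Q) * (Q * Q)        <⟨ ℕ.+-monoˡ-< _ (m%n<n N (Q * Q)) ⟩
    suc (N ℕ./ (Q * Q)) * (Q * Q)                  ≤⟨ ℕ.*-monoˡ-≤ (Q * Q) (isqrt-upper (N ℕ./ (Q * Q))) ⟩
    (K * K) * (Q * Q)                              ∎

  -- The hypotheses are √2 ≤ p/Q and √2 r ≤ √n; their product is 2r ≤ (p/Q)√n.
  ≤⌊p/q√⌋ : 2 * (Q * Q) ≤ p * p → ∀ r → 2 * (r * r) ≤ n → 2 * r ≤ k
  ≤⌊p/q√⌋ 2Q²≤p² r 2r²≤n = ℕ.≮⇒≥ λ k<2r → ℕ.<⇒≱ ⌊p/q√⌋-upper (begin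
    (K * K) * (Q * Q)                    ≤⟨ ℕ.*-monoˡ-≤ (Q * Q) (ℕ.*-mono-≤ k<2r k<2r) ⟩
    (2 * r) * (2 * r) * (Q * Q)          ≡⟨ regroup r (Q * Q) ⟩
    2 * (Q * Q) * (2 * (r * r))          ≤⟨ ℕ.*-mono-≤ 2Q²≤p² 2r²≤n ⟩
    N                                    ∎)
    where
    regroup : ∀ r x → (2 * r) * (2 * r) * x ≡ 2 * x * (2 * (r * r))
    regroup = solve-∀

  ⌊p/q√⌋²≤4n : p * p ≤ 4 * (Q * Q) → k * k ≤ 4 * n
  ⌊p/q√⌋²≤4n p²≤4Q² = ℕ.*-cancelʳ-≤ (k * k) (4 * n) (Q * Q) (begin
    (k * k) * (Q * Q)        ≤⟨ ⌊p/q√⌋-lower ⟩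
    p * p * n                ≤⟨ ℕ.*-monoˡ-≤ n p²≤4Q² ⟩
    4 * (Q * Q) * n          ≡⟨ regroup (Q * Q) n ⟩
    4 * n * (Q * Q)          ∎)
    where
    regroup : ∀ x n → 4 * x * n ≡ 4 * n * x
    regroup = solve-∀

  private
    u : ℕ → ℕ
    u j = isqrt (n * (suc j * suc j))

    seq≡ : ∀ j → seq (fromℚ (+ p / Q) *ᵣ √ n) j ≡ + (p * u j) / (Q * suc j)
    seq≡ j = /-homo-* p (u j) q j

    lower-bound : ∀ j → k * (Q * suc j) ≤ p * suc (u j)
    lower-bound j = square-cancel-≤ (begin
      (k * (Q * j⁺)) * (k * (Q * j⁺))        ≡⟨ lhs k Q j⁺ ⟩
      (k * k) * (Q * Q) * (j⁺ * j⁺)          ≤⟨ ℕ.*-monoˡ-≤ (j⁺ * j⁺) ⌊p/q√⌋-lower ⟩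
      p * p * n * (j⁺ * j⁺)                  ≡⟨ ℕ.*-assoc (p * p) n (j⁺ * j⁺) ⟩
      p * p * (n * (j⁺ * j⁺))                ≤⟨ ℕ.*-monoʳ-≤ (p * p) (ℕ.<⇒≤ (isqrt-upper (n * (j⁺ * j⁺)))) ⟩
      p * p * (suc (u j) * suc (u j))        ≡⟨ rhs p (suc (u j)) ⟩
      (p * suc (u j)) * (p * suc (u j))      ∎)
      where
      j⁺ : ℕ
      j⁺ = suc j
      lhs : ∀ k q j → (k * (q * j)) * (k * (q * j)) ≡ (k * k) * (q * q) * (j * j)
      lhs = solve-∀
      rhs : ∀ p u → p * p * (u * u) ≡ (p * u) * (p * u)
      rhs = solve-∀

  -- The approximation of √n at index `j` is too small by less than 1/(j+1), which costs at most
  -- p/(j+1) after scaling and tends to 0.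
  ⌊p/q√⌋-≤ᵣ : fromℕ k ≤ᵣ fromℚ (+ p / Q) *ᵣ √ n
  ⌊p/q√⌋-≤ᵣ ε 0<ε with M , small ← /-eventually-< p ε 0<ε = M , λ j M≤j →
    subst (λ r → + k / 1 ℚ.< r ℚ.+ ε) (sym (seq≡ j))
      (ℚ.≤-<-trans (close j) (ℚ.+-monoʳ-< (+ (p * u j) / (Q * suc j)) (small j M≤j)))
    where
    close : ∀ j → + k / 1 ℚ.≤ + (p * u j) / (Q * suc j) ℚ.+ + p / suc j
    close j = subst (+ k / 1 ℚ.≤_) (sym (/-homo-+ (p * u j) p (j + q * suc j) j))
      (/-mono-≤ k (p * u j * j⁺ + p * (Q * j⁺)) 0 (ℕ.pred (Q * j⁺ * j⁺)) (begin
        k * (Q * j⁺ * j⁺)                    ≡⟨ ℕ.*-assoc k (Q * j⁺) j⁺ ⟨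
        k * (Q * j⁺) * j⁺                    ≤⟨ ℕ.*-monoˡ-≤ j⁺ (lower-bound j) ⟩
        p * suc (u j) * j⁺                   ≡⟨ expand p (u j) j⁺ ⟩
        p * u j * j⁺ + p * j⁺                ≤⟨ ℕ.+-monoʳ-≤ (p * u j * j⁺) (ℕ.*-monoʳ-≤ p (ℕ.m≤m+n j⁺ (q * j⁺))) ⟩
        p * u j * j⁺ + p * (Q * j⁺)          ≡⟨ ℕ.*-identityʳ _ ⟨
        (p * u j * j⁺ + p * (Q * j⁺)) * 1    ∎))
      where
      j⁺ : ℕ
      j⁺ = suc j
      expand : ∀ p u j → p * suc u * j ≡ p * u * j + p * j
      expand = solve-∀

  <ᵣ-⌊p/q√⌋ : fromℚ (+ p / Q) *ᵣ √ n <ᵣ fromℕ K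
  <ᵣ-⌊p/q√⌋ = + 1 / D
            , ℚ.positive⁻¹ (+ 1 / D) {{ℚ.normalize-pos 1 D}}
            , 0 , λ j _ → subst (λ r → r ℚ.+ + 1 / D ℚ.≤ + K / 1) (sym (seq≡ j)) (close j)
    where
    -- The gap between N and (K Q)² is at least 1, so 1/(2KQ²) is a gap between pu/Qj and K.
    D e : ℕ
    D = 2 * (K * (Q * Q))
    e = ℕ.pred (K * D)

    -- As `suc e` is `K * D`, this says √N ≤ Q(K - 1/D). Replacing `suc e` by `e` costs at most
    -- 2Q²KD = D², which is paid for by `suc N ≤ (K * K) * (Q * Q)`.
    gap : N * (D * D) ≤ (Q * e) * (Q * e)
    gap = ℕ.+-cancelʳ-≤ (D * D) _ _ (begin
      N * (D * D) + D * D                                   ≡⟨ ℕ.+-comm (N * (D * D)) (D * D) ⟩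
      suc N * (D * D)                                       ≤⟨ ℕ.*-monoˡ-≤ (D * D) ⌊p/q√⌋-upper ⟩
      (K * K) * (Q * Q) * (D * D)                           ≡⟨ l₁ K Q D ⟩
      (Q * Q) * (suc e * suc e)                             ≡⟨ l₂ Q e ⟩
      (Q * e) * (Q * e) + (2 * (Q * Q) * e + Q * Q)         ≤⟨ ℕ.+-monoʳ-≤ ((Q * e) * (Q * e)) (begin
        2 * (Q * Q) * e + Q * Q                               ≤⟨ ℕ.+-monoʳ-≤ (2 * (Q * Q) * e) (ℕ.m≤m+n (Q * Q) (Q * Q + 0)) ⟩
        2 * (Q * Q) * e + 2 * (Q * Q)                         ≡⟨ l₃ (2 * (Q * Q)) e ⟩
        2 * (Q * Q) * suc e                                   ≡⟨ l₄ Q K D ⟩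
        D * D                                                 ∎) ⟩
      (Q * e) * (Q * e) + D * D                             ∎)
      where
      l₁ : ∀ k q d → (k * k) * (q * q) * (d * d) ≡ (q * q) * ((k * d) * (k * d))
      l₁ = solve-∀
      l₂ : ∀ q e → (q * q) * (suc e * suc e) ≡ (q * e) * (q * e) + (2 * (q * q) * e + q * q)
      l₂ = solve-∀
      l₃ : ∀ x e → x * e + x ≡ x * suc e
      l₃ = solve-∀
      l₄ : ∀ q k d → 2 * (q * q) * (k * d) ≡ 2 * (k * (q * q)) * d
      l₄ = solve-∀

    bound : ∀ j → p * u j * D ≤ suc j * (Q * e)
    bound j = square-cancel-≤ (begin
      (p * u j * D) * (p * u j * D)                 ≡⟨ l₁ p (u j) D ⟩
      p * p * (u j * u j) * (D * D)                 ≤⟨ ℕ.*-monoˡ-≤ (D * D) (ℕ.*-monoʳ-≤ (p * p) (isqrt-lower (n * (j⁺ * j⁺)))) ⟩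
      p * p * (n * (j⁺ * j⁺)) * (D * D)             ≡⟨ l₂ (p * p) n (j⁺ * j⁺) (D * D) ⟩
      j⁺ * j⁺ * (N * (D * D))                       ≤⟨ ℕ.*-monoʳ-≤ (j⁺ * j⁺) gap ⟩
      j⁺ * j⁺ * ((Q * e) * (Q * e))                 ≡⟨ l₃ j⁺ (Q * e) ⟩
      (j⁺ * (Q * e)) * (j⁺ * (Q * e))               ∎)
      where
      j⁺ : ℕ
      j⁺ = suc j
      l₁ : ∀ p u d → (p * u * d) * (p * u * d) ≡ p * p * (u * u) * (d * d)
      l₁ = solve-∀
      l₂ : ∀ p n j d → p * (n * j) * d ≡ j * (p * n * d)
      l₂ = solve-∀
      l₃ : ∀ x y → x * x * (y * y) ≡ (x * y) * (x * y)
      l₃ = solve-∀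

    close : ∀ j → + (p * u j) / (Q * suc j) ℚ.+ + 1 / D ℚ.≤ + K / 1
    close j = subst (ℚ._≤ + K / 1) (sym (/-homo-+ (p * u j) 1 (j + q * suc j) (ℕ.pred D)))
      (/-mono-≤ (p * u j * D + 1 * (Q * j⁺)) K (ℕ.pred (Q * j⁺ * D)) 0 (begin
        (p * u j * D + 1 * (Q * j⁺)) * 1      ≡⟨ ℕ.*-identityʳ _ ⟩
        p * u j * D + 1 * (Q * j⁺)            ≤⟨ ℕ.+-monoˡ-≤ (1 * (Q * j⁺)) (bound j) ⟩
        j⁺ * (Q * e) + 1 * (Q * j⁺)           ≡⟨ l₁ j⁺ Q e ⟩
        Q * j⁺ * suc e                        ≡⟨ l₂ (Q * j⁺) K D ⟩
        K * (Q * j⁺ * D)                      ∎))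
      where
      j⁺ : ℕ
      j⁺ = suc j
      l₁ : ∀ j q e → j * (q * e) + 1 * (q * j) ≡ q * j * suc e
      l₁ = solve-∀
      l₂ : ∀ x k d → x * (k * d) ≡ k * (x * d)
      l₂ = solve-∀

-- Choice of the parameters

HasRule : ℕ → Set
HasRule n = ∃ λ (k : ℕ) → (⌊ fromℚ (+ 1508 / 1000) *ᵣ (√ n) ⌋≡ k) ×
  ∃ λ (Φ : VotingRule n) →
    Odd Φ × Monotone Φ × Unbiased Φ × (¬ TransitiveSymmetric Φ) × HasWinningCoalitionOfSize Φ (k + 5)

-- The bound 38 is the value of `h` for the smallest prime power 2, where n = 77; it gives `6 ≤ r`.
rule-on-odd : ∀ h → 38 ≤ h → HasRule (suc (h + h))
rule-on-odd h 38≤h = k , (⌊p/q√⌋-≤ᵣ 1508 999 n , <ᵣ-⌊p/q√⌋ 1508 999 n) ,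
  Φ , Φ-odd , Φ-monotone , Φ-unbiased , Φ-not-transitive , Φ-winning s<k+5 k+5≤n
  where
  open ℕ.≤-Reasoning
  n r k : ℕ
  n = suc (h + h)
  r = isqrt h
  k = ⌊p/q√⌋ 1508 999 n

  6≤r : 6 ≤ r
  6≤r = ℕ.s≤s⁻¹ (square-cancel-< {6} {suc r} (ℕ.<-trans (ℕ.≤-trans (ℕ.≤ᵇ⇒≤ 37 38 _) 38≤h) (isqrt-upper h)))

  6r≤h : 6 * r ≤ h
  6r≤h = ℕ.≤-trans (ℕ.*-monoˡ-≤ r 6≤r) (isqrt-lower h)

  2r+r+3r≡6r : ∀ r → 2 * r + r + 3 * r ≡ 6 * r
  2r+r+3r≡6r = solve-∀

  room : 6 + suc r * suc r ≤ n
  room = begin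
    6 + suc r * suc r                    ≡⟨ expand r ⟩
    suc (r * r + (2 * r + 6))            ≤⟨ s≤s (ℕ.+-mono-≤ (isqrt-lower h) (ℕ.+-monoʳ-≤ (2 * r) 6≤r)) ⟩
    suc (h + (2 * r + r))                ≤⟨ s≤s (ℕ.+-monoʳ-≤ h (ℕ.m≤m+n (2 * r + r) (3 * r))) ⟩
    suc (h + (2 * r + r + 3 * r))        ≡⟨ cong (λ x → suc (h + x)) (2r+r+3r≡6r r) ⟩
    suc (h + 6 * r)                      ≤⟨ s≤s (ℕ.+-monoʳ-≤ h 6r≤h) ⟩
    suc (h + h)                          ∎
    where
    expand : ∀ r → 6 + suc r * suc r ≡ suc (r * r + (2 * r + 6))
    expand = solve-∀

  small : 2 + (suc r + suc r) ≤ h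
  small = begin
    2 + (suc r + suc r)      ≡⟨ expand r ⟩
    2 * r + 4                ≤⟨ ℕ.+-monoʳ-≤ (2 * r) (ℕ.≤-trans (ℕ.≤ᵇ⇒≤ 4 6 _) 6≤r) ⟩
    2 * r + r                ≤⟨ ℕ.m≤m+n (2 * r + r) (3 * r) ⟩
    2 * r + r + 3 * r        ≡⟨ 2r+r+3r≡6r r ⟩
    6 * r                    ≤⟨ 6r≤h ⟩
    h                        ∎
    where
    expand : ∀ r → 2 + (suc r + suc r) ≡ 2 * r + 4
    expand = solve-∀

  -- `suc r` is the least `a` with `h < a * a`.
  open Construction h (suc r) (isqrt-upper h) room (ℕ.m≤n⇒m≤1+n 6≤r) small

  -- `S` has at most 2r + 2 elements, so `s` is at most 2r + 4, and 2r ≤ 2√h < √(2n) < 1.508√n gives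
  -- 2r ≤ k. The summand 5 provides the one unit above `s` that `Φ-winning` requires.
  s<k+5 : s < k + 5
  s<k+5 = begin-strict
    2 + # (T 0)                    ≤⟨ ℕ.+-monoʳ-≤ 2 #T≤ ⟩
    2 + (suc r + suc r)            <⟨ ℕ.n<1+n _ ⟩
    3 + (suc r + suc r)            ≡⟨ collect r ⟩
    2 * r + 5                      ≤⟨ ℕ.+-monoˡ-≤ 5 (≤⌊p/q√⌋ 1508 999 n (ℕ.≤ᵇ⇒≤ (2 * (1000 * 1000)) (1508 * 1508) _) r 2r²≤n) ⟩
    k + 5                          ∎
    where
    collect : ∀ r → 3 + (suc r + suc r) ≡ 2 * r + 5
    collect = solve-∀
    2r²≤n : 2 * (r * r) ≤ n
    2r²≤n = ℕ.≤-trans (ℕ.*-monoʳ-≤ 2 (isqrt-lower h))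
      (ℕ.≤-trans (ℕ.≤-reflexive (cong (λ x → h + x) (ℕ.+-identityʳ h))) (ℕ.n≤1+n (h + h)))

  -- Otherwise `k` would be at least 17 and so close to `n` that k² > 4n, contrary to 1.508 < 2.
  k+5≤n : k + 5 ≤ n
  k+5≤n = ℕ.≮⇒≥ λ n<k+5 → ℕ.<⇒≱ (k²-large (ℕ.s≤s⁻¹ (subst (suc n ≤_) (ℕ.+-suc k 4) n<k+5)))
    (⌊p/q√⌋²≤4n 1508 999 n (ℕ.≤ᵇ⇒≤ (1508 * 1508) (4 * (1000 * 1000)) _))
    where
    k²-large : n ≤ k + 4 → 4 * n < k * k
    k²-large n≤k+4 = begin-strict
      4 * n                  ≤⟨ ℕ.*-monoʳ-≤ 4 n≤k+4 ⟩
      4 * (k + 4)            <⟨ ℕ.n<1+n _ ⟩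
      suc (4 * (k + 4))      ≡⟨ expand k ⟩
      4 * k + 17             ≤⟨ ℕ.+-monoʳ-≤ (4 * k) (ℕ.≤-trans 17≤k (ℕ.m≤m+n k _)) ⟩
      4 * k + 13 * k         ≡⟨ collect k ⟩
      17 * k                 ≤⟨ ℕ.*-monoˡ-≤ k 17≤k ⟩
      k * k                  ∎
      where
      expand : ∀ k → suc (4 * (k + 4)) ≡ 4 * k + 17
      expand = solve-∀
      collect : ∀ k → 4 * k + 13 * k ≡ 17 * k
      collect = solve-∀
      17≤k : 17 ≤ k
      17≤k = ℕ.+-cancelʳ-≤ 4 17 k (begin
        21         ≤⟨ ℕ.≤ᵇ⇒≤ 21 38 _ ⟩
        38         ≤⟨ 38≤h ⟩
        h          ≤⟨ ℕ.m≤m+n h h ⟩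
        h + h      ≤⟨ ℕ.n≤1+n (h + h) ⟩
        n          ≤⟨ n≤k+4 ⟩
        k + 4      ∎)

pronic-even : ∀ q → ∃ λ g → q * suc q ≡ g + g
pronic-even zero    = 0 , refl
pronic-even (suc q) with g , e ← pronic-even q = g + suc q , (begin
  suc q * suc (suc q)              ≡⟨ expand q ⟩
  q * suc q + (suc q + suc q)      ≡⟨ cong (_+ (suc q + suc q)) e ⟩
  g + g + (suc q + suc q)          ≡⟨ collect g (suc q) ⟩
  g + suc q + (g + suc q)          ∎)
  where
  open ≡-Reasoning
  expand : ∀ q → suc q * suc (suc q) ≡ q * suc q + (suc q + suc q)
  expand = solve-∀
  collect : ∀ g q → g + g + (q + q) ≡ g + q + (g + q)
  collect = solve-∀

prime-power≥2 : ∀ {q} → IsPrimePower q → 2 ≤ q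
prime-power≥2 (p , suc k , p-prime , _ , refl) = begin
  2              ≤⟨ 2≤p ⟩
  p              ≡⟨ ℕ.*-identityʳ p ⟨
  p * 1          ≤⟨ ℕ.*-monoʳ-≤ p (ℕ.m^n>0 p {{ℕ.>-nonZero (ℕ.<-trans (s≤s z≤n) 2≤p)}} k) ⟩
  p * p ^ k      ∎
  where
  open ℕ.≤-Reasoning
  2≤p = ℕ.nonTrivial⇒n>1 p {{prime⇒nonTrivial p-prime}}

-- With q(q+1) = 2g the number is 22g + 11 = 2(11g + 5) + 1, and q ≥ 2 forces g ≥ 3.
n-odd : ∀ q → 2 ≤ q → ∃ λ h → 38 ≤ h × 11 * (q ^ 2 + q + 1) ≡ suc (h + h)
n-odd q 2≤q with g , q[1+q]≡2g ← pronic-even q = 11 * g + 5 , ℕ.+-monoˡ-≤ 5 (ℕ.*-monoʳ-≤ 11 3≤g) , (begin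
  11 * (q ^ 2 + q + 1)                  ≡⟨ expand 11 q ⟩
  11 * (q * suc q) + 11                 ≡⟨ cong (λ x → 11 * x + 11) q[1+q]≡2g ⟩
  11 * (g + g) + 11                     ≡⟨ cong (_+ 11) (ℕ.*-distribˡ-+ 11 g g) ⟩
  11 * g + 11 * g + 11                  ≡⟨ collect (11 * g) ⟩
  suc (11 * g + 5 + (11 * g + 5))       ∎)
  where
  open ≡-Reasoning
  expand : ∀ c q → c * (q * (q * 1) + q + 1) ≡ c * (q * suc q) + c
  expand = solve-∀
  collect : ∀ x → x + x + 11 ≡ suc (x + 5 + (x + 5))
  collect = solve-∀
  3≤g : 3 ≤ g
  3≤g = ℕ.≮⇒≥ λ { (s≤s g≤2) → ℕ.<⇒≱ (s≤s (ℕ.+-mono-≤ g≤2 g≤2)) (ℕ.≤-trans (ℕ.n≤1+n 5)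
    (ℕ.≤-trans (ℕ.*-mono-≤ 2≤q (s≤s 2≤q)) (ℕ.≤-reflexive q[1+q]≡2g))) }

theorem16 : (q m n : ℕ) → IsPrimePower q → m ≡ q ^ 2 + q + 1 → n ≡ 11 * m →
    ∃ λ (k : ℕ) → (⌊ fromℚ (+ 1508 / 1000) *ᵣ (√ n) ⌋≡ k) ×
    ∃ λ (Φ : VotingRule n) →
    Odd Φ × Monotone Φ × Unbiased Φ × (¬ TransitiveSymmetric Φ) ×
    HasWinningCoalitionOfSize Φ (k + 5)
theorem16 q m n q-prime-power m≡ n≡ =
  let h , 38≤h , ≡2h+1 = n-odd q (prime-power≥2 q-prime-power)
      n≡2h+1 = trans n≡ (trans (cong (11 *_) m≡) ≡2h+1)
  in subst HasRule (sym n≡2h+1) (rule-on-odd h 38≤h)
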